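{- For every finite simple graph $G=(V,E)$, the geometric rank of the matching polytope of $G$ is at most $1$.
   Context: The matching polytope $P\subseteq\mathbb{R}^E$ of $G$ is the convex hull of the incidence vectors of matchings of $G$; it is full-dimensional, so $\dim P=|E|$. Let $\mathcal{F}$ be the set of facet-defining inequalities $fx\le f_0$ of $P$ (one for each facet), and for $(f,f_0)\in\mathcal{F}$ let $F_f=\{x\in P: fx=f_0\}$ be the corresponding facet. For $\mathcal{F}_{\min}\subseteq\mathcal{F}$ set $P_{\min}=\{x\in\mathbb{R}^E: fx\le f_0\ \forall(f,f_0)\in\mathcal{F}_{\min}\}$ and, for $(h,h_0)\in\mathcal{F}_{\min}$, let $P^h_{\min}$ be defined likewise using $\mathcal{F}_{\min}\setminus\{(h,h_0)\}$. $\mathcal{F}_{\min}$ is a minimal formulation of $P$ if $P=\mathrm{conv}(P_{\min}\cap\mathbb{Z}^E)$ and, for every $(h,h_0)\in\mathcal{F}_{\min}$, $P\cap\mathbb{Z}^E$ is a proper subset of $P^h_{\min}\cap\mathbb{Z}^E$. Geometric rank (Padberg): $\mathcal{F}_0$ is the set of $(f,f_0)\in\mathcal{F}$ belonging to some minimal formulation of $P$. Given nonempty disjoint families $\mathcal{F}_0,\dots,\mathcal{F}_\rho$ with $\bigcup_{i=0}^{\rho}\mathcal{F}_i\neq\mathcal{F}$, define $\mathcal{F}_{\rho+1}$ as the set of $(f,f_0)\in\mathcal{F}\setminus\bigcup_{i=0}^{\rho}\mathcal{F}_i$ for which there exists $(h,h_0)\in\bigcup_{i=0}^{\rho}\mathcal{F}_i$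 with $\dim(F_f\cap F_h)=\dim P-2$. If $\mathcal{F}=\bigcup_{i=0}^{\rho}\mathcal{F}_i$, then $\rho$ is the geometric rank of $P$. -}

module Defs where

open import Data.Nat using (ℕ; zero; suc)
open import Data.Integer using (ℤ)
open import Data.Fin using (Fin; zero; suc)
open import Data.Bool using (Bool; true; false)
open import Data.Product using (Σ; ∃; ∃-syntax; _×_; _,_; proj₁; proj₂)
open import Data.Sum using (_⊎_)
open import Data.Unit using (⊤)
open import Data.List using (List; length; removeAt)
open import Data.List.Relation.Unary.All using (All)
open import Data.List.Relation.Unary.Any using (Any)
open import Data.Rational using (ℚ; 0ℚ; 1ℚ; _+_; _*_; _-_; _≤_; _/_)
open import Relation.Binary.PropositionalEquality using (_≡_; _≢_)
open import Relation.Nullary using (¬_)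

record Graph : Set where
  field
    nV nE : ℕ
    ends : Fin nE → Fin nV × Fin nV
    loopless : ∀ e → proj₁ (ends e) ≢ proj₂ (ends e)
    noParallel : ∀ e e' →
      ((proj₁ (ends e) ≡ proj₁ (ends e') × proj₂ (ends e) ≡ proj₂ (ends e'))
       ⊎ (proj₁ (ends e) ≡ proj₂ (ends e') × proj₂ (ends e) ≡ proj₁ (ends e'))) →
      e ≡ e'

open Graph public

Vect : ℕ → Set
Vect k = Fin k → ℚ

sumF : ∀ {k} → (Fin k → ℚ) → ℚ
sumF {zero} f = 0ℚ
sumF {suc k} f = f zero + sumF (λ i → f (suc i))

dot : ∀ {k} → Vect k → Vect k → ℚ
dot f x = sumF (λ e → f e * x e)

_≗ᵥ_ : ∀ {k} → Vect k → Vect k → Set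
x ≗ᵥ y = ∀ e → x e ≡ y e

Integral : ∀ {k} → Vect k → Set
Integral x = ∀ e → ∃[ z ] x e ≡ z / 1

Conv : ∀ {k} → (Vect k → Set) → Vect k → Set
Conv {k} S x =
  ∃[ r ] Σ (Fin r → Vect k) λ p → Σ (Fin r → ℚ) λ w →
    (∀ i → S (p i)) × (∀ i → 0ℚ ≤ w i) × (sumF w ≡ 1ℚ) ×
    (∀ e → x e ≡ sumF (λ i → w i * p i e))

IsMatching : (G : Graph) → (Fin (nE G) → Bool) → Set
IsMatching G M = ∀ e e' → M e ≡ true → M e' ≡ true → e ≢ e' →
  let a = proj₁ (ends G e) ; b = proj₂ (ends G e)
      c = proj₁ (ends G e') ; d = proj₂ (ends G e') in
  (a ≢ c) × (a ≢ d) × (b ≢ c) × (b ≢ d)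

incidence : ∀ {k} → (Fin k → Bool) → Vect k
incidence M e with M e
... | true = 1ℚ
... | false = 0ℚ

MatchingVector : (G : Graph) → Vect (nE G) → Set
MatchingVector G y = Σ (Fin (nE G) → Bool) λ M → IsMatching G M × (y ≗ᵥ incidence M)

MatchingPolytope : (G : Graph) → Vect (nE G) → Set
MatchingPolytope G = Conv (MatchingVector G)

-- Dimension via affine independence.
-- AffRank S r  means: the affine hull of S has dimension r - 1,
-- i.e. dim S = r - 1 (r = 0 ⇔ S empty).

AffIndep : ∀ {k} r → (Fin r → Vect k) → Set
AffIndep zero p = ⊤
AffIndep {k} (suc r) p =
  (λs : Fin r → ℚ) →
  (∀ e → sumF (λ i → λs i * (p (suc i) e - p zero e)) ≡ 0ℚ) →
  ∀ i → λs i ≡ 0ℚ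

AffRank : ∀ {k} → (Vect k → Set) → ℕ → Set
AffRank {k} S r =
  (Σ (Fin r → Vect k) λ p → (∀ i → S (p i)) × AffIndep r p) ×
  ((p : Fin (suc r) → Vect k) → (∀ i → S (p i)) → ¬ AffIndep (suc r) p)

Ineq : ℕ → Set
Ineq k = Vect k × ℚ

Satisfies : ∀ {k} → Ineq k → Vect k → Set
Satisfies (f , f₀) x = dot f x ≤ f₀

Face : (G : Graph) → Ineq (nE G) → Vect (nE G) → Set
Face G (f , f₀) x = MatchingPolytope G x × dot f x ≡ f₀

-- facet-defining: valid for P, face nonempty, and dim face = dim P - 1 = |E| - 1
FacetDefining : (G : Graph) → Ineq (nE G) → Set
FacetDefining G ineq =
  (∀ x → MatchingPolytope G x → Satisfies ineq x) ×
  (∃[ x ] Face G ineq x) ×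
  AffRank (Face G ineq) (nE G)

SameIneq : ∀ {k} → Ineq k → Ineq k → Set
SameIneq (f , f₀) (h , h₀) = (f ≗ᵥ h) × (f₀ ≡ h₀)

Polyhedron : ∀ {k} → List (Ineq k) → Vect k → Set
Polyhedron L x = All (λ ineq → Satisfies ineq x) L

MinimalFormulation : (G : Graph) → List (Ineq (nE G)) → Set
MinimalFormulation G L =
  All (FacetDefining G) L ×
  (∀ x → (MatchingPolytope G x → Conv (λ y → Integral y × Polyhedron L y) x) ×
         (Conv (λ y → Integral y × Polyhedron L y) x → MatchingPolytope G x)) ×
  (∀ (i : Fin (length L)) →
     (∀ y → Integral y → MatchingPolytope G y → Polyhedron (removeAt L i) y) ×
     (∃[ y ] Integral y × Polyhedron (removeAt L i) y × ¬ MatchingPolytope G y))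

InF₀ : (G : Graph) → Ineq (nE G) → Set
InF₀ G ineq = ∃[ L ] MinimalFormulation G L × Any (SameIneq ineq) L

-- geometric rank ≤ 1: every facet-defining inequality is in 𝓕₀ or in 𝓕₁,
-- i.e. its facet meets some facet from 𝓕₀ in a face of dimension |E| - 2.
GeometricRankAtMost1 : Graph → Set
GeometricRankAtMost1 G =
  ∀ (f : Ineq (nE G)) → FacetDefining G f →
    InF₀ G f ⊎
    (∃[ h ] InF₀ G h × ∃[ r ] AffRank (λ x → Face G f x × Face G h x) r × suc r ≡ nE G)

{-# OPTIONS --safe #-}
module Submission where

-- Only two kinds of facets are needed as neighbours: x_e ≥ 0 and the star inequalities x(δ(v)) ≤ 1.  Maximal
-- cliques of the conflict graph of the edges give facets, and a family of maximal cliques that covers every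
-- conflict and is minimal with this property is, together with all x_e ≥ 0, a minimal formulation; so every
-- x_e ≥ 0 lies in 𝓕₀, and so does the star inequality of v when the family can be chosen without the triangles
-- that compete with star v.
--
-- A facet f with a zero coefficient f_e is adjacent to x_e ≥ 0: delete e from the tight matchings.  If all
-- coefficients are positive and some vertex is covered by every tight matching, then f is a star inequality, whose
-- facet is a simplex.  Otherwise Gallai's argument (being missed together by no tight matching is transitive) shows
-- that a tight matching misses at most one non-isolated vertex and that f is constant, because f is determined up
-- to scaling by the functionals that are constant on the tight matchings.  A functional g that is constant on the
-- tight matchings covering v is then also constant on those missing v, if deg v ≥ 3: two of them, M and M', can
-- only differ in value by an alternating cycle through all neighbours of v, two of these neighbours are at even
-- distance on the cycle, and the near-perfect matchings of the cycle together with v force g to agree on both cycle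
-- edges there.  Hence f is adjacent to the star inequality of v.  Without a vertex of degree 3 the graph is an odd
-- cycle, where f is adjacent to a star inequality, or a triangle, where it is adjacent to x_e ≥ 0.

open import Defs
open import Data.Bool using (Bool; true; false; _∧_; not; if_then_else_)
open import Data.Bool.Properties using () renaming (_≟_ to _≟B_)
open import Data.Nat as ℕ using (ℕ; zero; suc)
import Data.Nat.Properties as ℕₚ
open import Data.Integer as ℤ using ()
import Data.Integer.Properties as ℤₚ
open import Data.Rational
open import Data.Rational.Properties
import Data.Rational.Unnormalised as ℚᵘ
import Data.Rational.Unnormalised.Properties as ℚᵘₚ
open import Data.Fin using (Fin; zero; suc; punchIn; splitAt; _↑ˡ_; _↑ʳ_; join)
open import Data.Fin.Properties using (any?; all?; splitAt-↑ˡ; splitAt-↑ʳ; join-splitAt)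
  renaming (_≟_ to _≟F_)
open import Data.List as List using (List; []; _∷_; lookup; length)
open import Data.List.Membership.Propositional using (find; lose) renaming (_∈_ to _∈ˡ_)
open import Data.List.Membership.Propositional.Properties
  using (∈-filter⁺; ∈-filter⁻; ∈-lookup; ∈-map⁺; ∈-++⁺ˡ; ∈-++⁺ʳ; ∈-allFin; ∈-cartesianProduct⁺)
open import Data.List.Properties using (length-removeAt)
open import Data.List.Relation.Unary.All as All using (All; []; _∷_)
import Data.List.Relation.Unary.All.Properties as Allₚ
open import Data.List.Relation.Unary.Any as Any using (Any; here; there)
import Data.List.Relation.Unary.Any.Properties as Anyₚ
open import Data.Maybe using (just; nothing)
open import Data.Product using (Σ; ∃; ∃-syntax; _×_; _,_; proj₁; proj₂)
open import Data.Sum using (_⊎_; inj₁; inj₂; [_,_]′)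
open import Data.Empty using (⊥; ⊥-elim)
open import Data.Unit using (⊤; tt)
open import Data.Vec.Functional using (insertAt)
open import Data.Vec.Functional.Properties using (insertAt-lookup; insertAt-punchIn)
open import Function using (_∘_; case_of_)
open import Level using (0ℓ)
open import Relation.Binary.PropositionalEquality
open import Relation.Nullary using (¬_; Dec; yes; no; does; contradiction)
open import Relation.Nullary.Decidable using (decidable-stable; ¬?; _×-dec_; _⊎-dec_; _→-dec_; map′; dec-true)
import Algebra.Properties.CommutativeMonoid.Sum +-0-commutativeMonoid as ∑
open import Tactic.RingSolver using (solve-∀)
import Tactic.RingSolver.Core.AlmostCommutativeRing as ACR

-- A facet enters only through its tight matchings. That it has dimension |E| - 1 is used in this
-- form: an affine functional constant on them is a multiple of the facet's own. That it is adjacent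
-- to `h` is proved in this form: a functional constant on the matchings tight for both is a
-- combination of the two. At a zero coefficient and for a star, a suitable multiple of `h` is
-- subtracted from the functional so that it becomes constant on all tight matchings of `f`, where
-- uniqueness applies. For a star this leaves the tight matchings that miss v to be controlled,
-- which is where the work lies. On the side of 𝓕₀ only integral points count. A family of maximal
-- cliques and bounds x_e ≥ 0 fails exactly when it does not cut off some -1_e or some 1_e + 1_e'
-- with e and e' in conflict, so minimality becomes a covering problem. Every facet, those in 𝓕₀
-- included, is given a neighbour in 𝓕₀, so membership of `f` in 𝓕₀ never has to be decided.

ℚ-ring : ACR.AlmostCommutativeRing 0ℓ 0ℓ
ℚ-ring = ACR.fromCommutativeRing +-*-commutativeRing λ x → isZero x
  where
  isZero : ∀ x → _
  isZero x with 0ℚ ≟ x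
  ... | yes p = just p
  ... | no _ = nothing

x-y≡0⇒x≡y : ∀ x y → x - y ≡ 0ℚ → x ≡ y
x-y≡0⇒x≡y x y eq = trans (lem x y) (trans (cong (_+ y) eq) (+-identityˡ y))
  where
  lem : ∀ x y → x ≡ (x - y) + y
  lem = solve-∀ ℚ-ring

x≢0∧xy≡0⇒y≡0 : ∀ {x y} → x ≢ 0ℚ → x * y ≡ 0ℚ → y ≡ 0ℚ
x≢0∧xy≡0⇒y≡0 {x} {y} x≢0 eq = begin
  y                ≡⟨ *-identityˡ y ⟨
  1ℚ * y           ≡⟨ cong (_* y) (*-inverseˡ x) ⟨
  (1/ x * x) * y   ≡⟨ *-assoc (1/ x) x y ⟩
  1/ x * (x * y)   ≡⟨ cong (1/ x *_) eq ⟩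
  1/ x * 0ℚ        ≡⟨ *-zeroʳ (1/ x) ⟩
  0ℚ ∎
  where
  open ≡-Reasoning
  instance
    _ : NonZero x
    _ = ≢-nonZero x≢0

-- Finite sums and dot products.

sumF≡∑ : ∀ {k} (f : Fin k → ℚ) → sumF f ≡ ∑.sum f
sumF≡∑ {zero} f = refl
sumF≡∑ {suc k} f = cong (f zero +_) (sumF≡∑ (f ∘ suc))

sumF-cong : ∀ {k} {f g : Fin k → ℚ} → (∀ i → f i ≡ g i) → sumF f ≡ sumF g
sumF-cong {zero} eq = refl
sumF-cong {suc k} eq = cong₂ _+_ (eq zero) (sumF-cong (eq ∘ suc))

sumF-zero : ∀ {k} {f : Fin k → ℚ} → (∀ i → f i ≡ 0ℚ) → sumF f ≡ 0ℚ
sumF-zero {zero} eq = refl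
sumF-zero {suc k} eq = cong₂ _+_ (eq zero) (sumF-zero (eq ∘ suc))

sumF-+ : ∀ {k} (f g : Fin k → ℚ) → sumF (λ i → f i + g i) ≡ sumF f + sumF g
sumF-+ {zero} f g = refl
sumF-+ {suc k} f g = trans (cong (f zero + g zero +_) (sumF-+ (f ∘ suc) (g ∘ suc)))
  (lem (f zero) (g zero) _ _)
  where
  lem : ∀ a b c d → (a + b) + (c + d) ≡ (a + c) + (b + d)
  lem = solve-∀ ℚ-ring

sumF-*ˡ : ∀ {k} c (f : Fin k → ℚ) → sumF (λ i → c * f i) ≡ c * sumF f
sumF-*ˡ {zero} c f = sym (*-zeroʳ c)
sumF-*ˡ {suc k} c f = trans (cong (c * f zero +_) (sumF-*ˡ c (f ∘ suc)))
  (sym (*-distribˡ-+ c (f zero) _))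

sumF-*ʳ : ∀ {k} c (f : Fin k → ℚ) → sumF (λ i → f i * c) ≡ sumF f * c
sumF-*ʳ c f = trans (sumF-cong (λ i → *-comm (f i) c)) (trans (sumF-*ˡ c f) (*-comm c _))

sumF-comm : ∀ {k m} (f : Fin k → Fin m → ℚ) →
  sumF (λ i → sumF (f i)) ≡ sumF (λ j → sumF (λ i → f i j))
sumF-comm {k} {m} f = begin
  sumF (λ i → sumF (f i))                ≡⟨ sumF-cong (λ i → sumF≡∑ (f i)) ⟩
  sumF (λ i → ∑.sum (f i))               ≡⟨ sumF≡∑ (λ i → ∑.sum (f i)) ⟩
  ∑.sum (λ i → ∑.sum (f i))              ≡⟨ ∑.∑-comm f ⟩
  ∑.sum (λ j → ∑.sum (λ i → f i j))      ≡⟨ sumF≡∑ (λ j → ∑.sum (λ i → f i j)) ⟨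
  sumF (λ j → ∑.sum (λ i → f i j))       ≡⟨ sumF-cong (λ j → sym (sumF≡∑ (λ i → f i j))) ⟩
  sumF (λ j → sumF (λ i → f i j))        ∎
  where open ≡-Reasoning

sumF-punchIn : ∀ {k} (f : Fin (suc k) → ℚ) i → sumF f ≡ f i + sumF (f ∘ punchIn i)
sumF-punchIn f i = trans (sumF≡∑ f)
  (trans (∑.sum-remove {i = i} f) (cong (f i +_) (sym (sumF≡∑ (f ∘ punchIn i)))))

sumF-mono : ∀ {k} {f g : Fin k → ℚ} → (∀ i → f i ≤ g i) → sumF f ≤ sumF g
sumF-mono {zero} le = ≤-refl
sumF-mono {suc k} le = +-mono-≤ (le zero) (sumF-mono (le ∘ suc))

sumF-nonneg : ∀ {k} {f : Fin k → ℚ} → (∀ i → 0ℚ ≤ f i) → 0ℚ ≤ sumF f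
sumF-nonneg {k} {f} le = subst (_≤ sumF f) (sumF-zero {k} (λ _ → refl)) (sumF-mono le)

sumF≤0⇒0 : ∀ {k} {f : Fin k → ℚ} → (∀ i → 0ℚ ≤ f i) → sumF f ≤ 0ℚ → ∀ i → f i ≡ 0ℚ
sumF≤0⇒0 {suc k} {f} nn le zero = ≤-antisym
  (≤-trans (subst (_≤ f zero + sumF (f ∘ suc)) (+-identityʳ _)
     (+-monoʳ-≤ (f zero) (sumF-nonneg (nn ∘ suc)))) le) (nn zero)
sumF≤0⇒0 {suc k} {f} nn le (suc i) = sumF≤0⇒0 (nn ∘ suc)
  (≤-trans (subst (_≤ f zero + sumF (f ∘ suc)) (+-identityˡ _)
     (+-monoˡ-≤ (sumF (f ∘ suc)) (nn zero))) le) i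

unit : ∀ {k} → Fin k → Vect k
unit i j with i ≟F j
... | yes _ = 1ℚ
... | no _ = 0ℚ

unit-refl : ∀ {k} (i : Fin k) → unit i i ≡ 1ℚ
unit-refl i with i ≟F i
... | yes _ = refl
... | no ne = contradiction refl ne

unit-≢ : ∀ {k} {i j : Fin k} → i ≢ j → unit i j ≡ 0ℚ
unit-≢ {i = i} {j} ne with i ≟F j
... | yes eq = contradiction eq ne
... | no _ = refl

sumF-single : ∀ {k} (f : Fin k → ℚ) i → (∀ j → i ≢ j → f j ≡ 0ℚ) → sumF f ≡ f i
sumF-single {suc k} f zero z = trans (cong (f zero +_) (sumF-zero (λ j → z (suc j) λ ()))) (+-identityʳ _)
sumF-single {suc k} f (suc i) z = trans (cong₂ _+_ (z zero λ ())
  (sumF-single (f ∘ suc) i (λ j ne → z (suc j) (λ { refl → ne refl })))) (+-identityˡ _)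

dot-unitʳ : ∀ {k} (f : Vect k) i → dot f (unit i) ≡ f i
dot-unitʳ f i = trans (sumF-single _ i (λ j ne → trans (cong (f j *_) (unit-≢ ne)) (*-zeroʳ (f j))))
  (trans (cong (f i *_) (unit-refl i)) (*-identityʳ (f i)))

dot-comm : ∀ {k} (f g : Vect k) → dot f g ≡ dot g f
dot-comm f g = sumF-cong (λ i → *-comm (f i) (g i))

dot-congˡ : ∀ {k} {f g : Vect k} → f ≗ᵥ g → ∀ x → dot f x ≡ dot g x
dot-congˡ eq x = sumF-cong (λ i → cong (_* x i) (eq i))

dot-congʳ : ∀ {k} {x y : Vect k} → x ≗ᵥ y → ∀ f → dot f x ≡ dot f y
dot-congʳ eq f = sumF-cong (λ i → cong (f i *_) (eq i))

dot-+ˡ : ∀ {k} (f g x : Vect k) → dot (λ e → f e + g e) x ≡ dot f x + dot g x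
dot-+ˡ {k} f g x = trans (sumF-cong (λ i → *-distribʳ-+ (x i) (f i) (g i))) (sumF-+ {k} _ _)

dot-*ˡ : ∀ {k} c (f x : Vect k) → dot (λ e → c * f e) x ≡ c * dot f x
dot-*ˡ {k} c f x = trans (sumF-cong (λ i → *-assoc c (f i) (x i))) (sumF-*ˡ {k} c _)

dot-+ʳ : ∀ {k} (f x y : Vect k) → dot f (λ e → x e + y e) ≡ dot f x + dot f y
dot-+ʳ {k} f x y = trans (sumF-cong (λ i → *-distribˡ-+ (f i) (x i) (y i))) (sumF-+ {k} _ _)

lincomb : ∀ {m k} → (Fin m → ℚ) → (Fin m → Vect k) → Vect k
lincomb c p e = sumF (λ i → c i * p i e)

dot-lincomb : ∀ {m k} (f : Vect k) (c : Fin m → ℚ) (p : Fin m → Vect k) →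
  dot f (lincomb c p) ≡ sumF (λ i → c i * dot f (p i))
dot-lincomb {m} {k} f c p = begin
  sumF (λ e → f e * sumF (λ i → c i * p i e))    ≡⟨ sumF-cong (λ e → sym (sumF-*ˡ {m} (f e) _)) ⟩
  sumF (λ e → sumF (λ i → f e * (c i * p i e)))  ≡⟨ sumF-comm {k} {m} _ ⟩
  sumF (λ i → sumF (λ e → f e * (c i * p i e)))
    ≡⟨ sumF-cong (λ i → trans (sumF-cong (λ e → lem (f e) (c i) (p i e))) (sumF-*ˡ {k} (c i) _)) ⟩
  sumF (λ i → c i * dot f (p i)) ∎
  where
  open ≡-Reasoning
  lem : ∀ a b c → a * (b * c) ≡ b * (a * c)
  lem = solve-∀ ℚ-ring

square-nonneg : ∀ q → 0ℚ ≤ q * q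
square-nonneg q with ≤-total 0ℚ q
... | inj₁ le = subst (_≤ q * q) (*-zeroʳ q) (*-monoˡ-≤-nonNeg q {{nonNegative le}} le)
... | inj₂ le = subst (_≤ q * q) (*-zeroʳ q) (*-monoˡ-≤-nonPos q {{nonPositive le}} le)

dot-self : ∀ {k} (x : Vect k) → dot x x ≡ 0ℚ → ∀ e → x e ≡ 0ℚ
dot-self x eq e with x e ≟ 0ℚ
... | yes z = z
... | no nz = x≢0∧xy≡0⇒y≡0 nz (sumF≤0⇒0 (λ i → square-nonneg (x i)) (≤-reflexive eq) e)

-- Linear and affine independence

LinIndep : ∀ {m k} → (Fin m → Vect k) → Set
LinIndep {m} p = (c : Fin m → ℚ) → (∀ e → lincomb c p e ≡ 0ℚ) → ∀ i → c i ≡ 0ℚ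

-- A certificate of rank-nullity: independent members of `A` and independent vectors orthogonal to
-- all of `A`, whose numbers add up to the dimension.
record Elimination {m k} (A : Fin m → Vect k) : Set where
  field
    rank corank : ℕ
    rank+corank : rank ℕ.+ corank ≡ k
    rank≤ : rank ℕ.≤ m
    pivot : Fin rank → Fin m
    basis : Fin corank → Vect k
    indepPivots : LinIndep (A ∘ pivot)
    indepBasis : LinIndep basis
    orthogonal : ∀ j i → dot (basis j) (A i) ≡ 0ℚ

-- The vectors are imposed as constraints one at a time, starting from the unit vectors. If the new
-- vector `a` is orthogonal to the current basis, nothing changes. Otherwise one basis vector that
-- is not orthogonal to `a` is spent on making the others orthogonal to it, and `a` becomes a pivot.
eliminate : ∀ {m k} (A : Fin m → Vect k) → Elimination A
eliminate {zero} {k} A = record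
  { rank = 0 ; corank = k ; rank+corank = refl ; rank≤ = ℕ.z≤n ; pivot = λ ()
  ; basis = unit ; indepPivots = λ _ _ () ; indepBasis = indep ; orthogonal = λ _ () }
  where
  indep : LinIndep unit
  indep c z i = trans (sym (trans (sumF-single _ i λ j ne → trans (cong (c j *_) (unit-≢ (ne ∘ sym))) (*-zeroʳ (c j)))
    (trans (cong (c i *_) (unit-refl i)) (*-identityʳ (c i))))) (z i)
eliminate {suc m} {k} A = step (eliminate (A ∘ suc))
  where
  a = A zero
  step : Elimination (A ∘ suc) → Elimination A
  step ih with any? (λ j → ¬? (dot (Elimination.basis ih j) a ≟ 0ℚ))
  ... | no none = record
    { rank = rank ; corank = corank ; rank+corank = rank+corank ; rank≤ = ℕₚ.m≤n⇒m≤1+n rank≤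
    ; pivot = suc ∘ pivot ; basis = basis
    ; indepPivots = indepPivots ; indepBasis = indepBasis
    ; orthogonal = λ { j zero → decidable-stable (_ ≟ 0ℚ) (λ nz → none (j , nz))
                     ; j (suc i) → orthogonal j i } }
    where open Elimination ih
  ... | yes (j₀ , nz) = go (Elimination.corank ih) refl (Elimination.basis ih) (Elimination.indepBasis ih)
                          (Elimination.orthogonal ih) (Elimination.rank+corank ih) j₀ nz
    where
    open Elimination ih using (rank; rank≤; pivot; indepPivots)
    go : ∀ s → s ≡ Elimination.corank ih → (B : Fin s → Vect k) → LinIndep B →
         (∀ j i → dot (B j) (A (suc i)) ≡ 0ℚ) → rank ℕ.+ s ≡ k →
         (j₀ : Fin s) → dot (B j₀) a ≢ 0ℚ → Elimination A
    go (suc s) _ B indB orth r+s j₀ nz = record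
      { rank = suc rank ; corank = s ; rank+corank = trans (sym (ℕₚ.+-suc rank s)) r+s
      ; rank≤ = ℕ.s≤s rank≤ ; pivot = pivot' ; basis = B'
      ; indepPivots = indP ; indepBasis = indB' ; orthogonal = orth' }
      where
      instance
        _ : NonZero (dot (B j₀) a)
        _ = ≢-nonZero nz
      t : Fin s → ℚ
      t j = dot (B (punchIn j₀ j)) a * 1/ dot (B j₀) a
      B' : Fin s → Vect k
      B' j e = B (punchIn j₀ j) e + (- t j) * B j₀ e
      pivot' : Fin (suc rank) → Fin (suc m)
      pivot' zero = zero
      pivot' (suc i) = suc (pivot i)

      dotB' : ∀ j x → dot (B' j) x ≡ dot (B (punchIn j₀ j)) x + (- t j) * dot (B j₀) x
      dotB' j x = trans (dot-+ˡ (B (punchIn j₀ j)) (λ e → (- t j) * B j₀ e) x) (cong (dot (B (punchIn j₀ j)) x +_) (dot-*ˡ (- t j) (B j₀) x))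
      orth' : ∀ j i → dot (B' j) (A i) ≡ 0ℚ
      orth' j zero = trans (dotB' j a) (trans (lem1 (dot (B (punchIn j₀ j)) a) (1/ dot (B j₀) a) (dot (B j₀) a))
        (trans (cong (λ z → dot (B (punchIn j₀ j)) a - dot (B (punchIn j₀ j)) a * z) (*-inverseˡ (dot (B j₀) a)))
          (lem2 (dot (B (punchIn j₀ j)) a))))
        where
        lem1 : ∀ x i y → x + (- (x * i)) * y ≡ x - x * (i * y)
        lem1 = solve-∀ ℚ-ring
        lem2 : ∀ x → x - x * 1ℚ ≡ 0ℚ
        lem2 = solve-∀ ℚ-ring
      orth' j (suc i) = trans (dotB' j _) (trans (cong₂ (λ x y → x + (- t j) * y) (orth _ i) (orth _ i)) (lem (t j)))
        where
        lem : ∀ x → 0ℚ + (- x) * 0ℚ ≡ 0ℚ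
        lem = solve-∀ ℚ-ring

      -- The discarded vector `B j₀` is orthogonal to the old pivots but not to `a`; pairing a
      -- relation with it kills the coefficient of `a`.
      indP : LinIndep (A ∘ pivot')
      indP c z = λ { zero → c0 ; (suc i) → indepPivots (c ∘ suc) rest i }
        where
        prod : c zero * dot (B j₀) a ≡ 0ℚ
        prod = begin
          c zero * dot (B j₀) a
            ≡⟨ +-identityʳ _ ⟨
          c zero * dot (B j₀) a + 0ℚ
            ≡⟨ cong (c zero * dot (B j₀) a +_) (sym (sumF-zero λ i → trans (cong (c (suc i) *_) (orth j₀ (pivot i))) (*-zeroʳ (c (suc i))))) ⟩
          sumF (λ i → c i * dot (B j₀) (A (pivot' i)))
            ≡⟨ dot-lincomb (B j₀) c (A ∘ pivot') ⟨
          dot (B j₀) (lincomb c (A ∘ pivot'))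
            ≡⟨ sumF-zero (λ e → trans (cong (B j₀ e *_) (z e)) (*-zeroʳ (B j₀ e))) ⟩
          0ℚ ∎
          where open ≡-Reasoning
        c0 : c zero ≡ 0ℚ
        c0 = x≢0∧xy≡0⇒y≡0 nz (trans (*-comm (dot (B j₀) a) (c zero)) prod)
        rest : ∀ e → lincomb (c ∘ suc) (A ∘ suc ∘ pivot) e ≡ 0ℚ
        rest e = trans (sym (+-identityˡ _)) (trans (cong (_+ lincomb (c ∘ suc) (A ∘ suc ∘ pivot) e)
          (sym (trans (cong (_* a e) c0) (*-zeroˡ (a e))))) (z e))

      indB' : LinIndep B'
      indB' c z j = trans (sym (insertAt-punchIn c j₀ w j)) (indB d dz (punchIn j₀ j))
        where
        -- The total multiple of `B j₀` contributed by the corrections. With it, a combination of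
        -- `B'` is read as a combination of `B`.
        w : ℚ
        w = sumF (λ j → c j * - t j)
        d : Fin (suc s) → ℚ
        d = insertAt c j₀ w
        dz : ∀ e → lincomb d B e ≡ 0ℚ
        dz e = begin
          sumF (λ i → d i * B i e)
            ≡⟨ sumF-punchIn (λ i → d i * B i e) j₀ ⟩
          d j₀ * B j₀ e + sumF (λ j → d (punchIn j₀ j) * B (punchIn j₀ j) e)
            ≡⟨ cong₂ _+_ (cong (_* B j₀ e) (insertAt-lookup c j₀ w))
                 (sumF-cong λ j → cong (_* B (punchIn j₀ j) e) (insertAt-punchIn c j₀ w j)) ⟩
          w * B j₀ e + sumF (λ j → c j * B (punchIn j₀ j) e)
            ≡⟨ cong (_+ sumF (λ j → c j * B (punchIn j₀ j) e)) (sym (sumF-*ʳ {s} (B j₀ e) _)) ⟩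
          sumF (λ j → (c j * - t j) * B j₀ e) + sumF (λ j → c j * B (punchIn j₀ j) e)
            ≡⟨ sumF-+ {s} _ _ ⟨
          sumF (λ j → (c j * - t j) * B j₀ e + c j * B (punchIn j₀ j) e)
            ≡⟨ sumF-cong (λ j → lem (c j) (t j) (B j₀ e) (B (punchIn j₀ j) e)) ⟩
          sumF (λ j → c j * B' j e)
            ≡⟨ z e ⟩
          0ℚ ∎
          where
          open ≡-Reasoning
          lem : ∀ c t x y → (c * - t) * x + c * y ≡ c * (y + (- t) * x)
          lem = solve-∀ ℚ-ring

-- Elimination is applied to the k rows of the matrix with columns `q i`. A vector orthogonal to all
-- rows is a linear relation between the columns, hence zero; so the corank is 0 and m is the rank
-- of k rows.
linIndep⇒≤ : ∀ {m k} (q : Fin m → Vect k) → LinIndep q → m ℕ.≤ k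
linIndep⇒≤ {m} {k} q ind = go (eliminate (λ e i → q i e))
  where
  go : Elimination (λ e i → q i e) → m ℕ.≤ k
  go record { rank = r ; corank = zero ; rank+corank = eq ; rank≤ = le } =
    subst (ℕ._≤ k) (trans (sym (ℕₚ.+-identityʳ r)) eq) le
  go record { corank = suc s ; basis = B ; indepBasis = indB ; orthogonal = orth } =
    contradiction (indB (unit zero) vanish zero) λ ()
    where
    b0 : ∀ i → B zero i ≡ 0ℚ
    b0 = ind (B zero) (λ e → orth zero e)
    vanish : ∀ e → lincomb (unit zero) B e ≡ 0ℚ
    vanish e = trans (sumF-single (λ j → unit zero j * B j e) zero λ j ne → trans (cong (_* B j e) (unit-≢ ne)) (*-zeroˡ (B j e)))
      (trans (cong (_* B zero e) (unit-refl (zero {s}))) (trans (*-identityˡ _) (b0 e)))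

infixr 5 _++F_
_++F_ : ∀ {A : Set} {m n} → (Fin m → A) → (Fin n → A) → Fin (m ℕ.+ n) → A
_++F_ {m = m} p q i = [ p , q ]′ (splitAt m i)

sumF-++ : ∀ {m n} (f : Fin (m ℕ.+ n) → ℚ) → sumF f ≡ sumF (λ i → f (i ↑ˡ n)) + sumF (λ j → f (m ↑ʳ j))
sumF-++ {zero} f = sym (+-identityˡ _)
sumF-++ {suc m} {n} f = trans (cong (f zero +_) (sumF-++ {m} (f ∘ suc))) (sym (+-assoc (f zero) _ _))

-- If p ⟂ c, then in a vanishing combination of p and c the c-part is orthogonal to itself.
orthogonal⇒+≤ : ∀ {m s k} (p : Fin m → Vect k) (c : Fin s → Vect k) → LinIndep p → LinIndep c →
  (∀ i j → dot (c j) (p i) ≡ 0ℚ) → m ℕ.+ s ℕ.≤ k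
orthogonal⇒+≤ {m} {s} {k} p c indp indc orth = linIndep⇒≤ (p ++F c) ind
  where
  ind : LinIndep (p ++F c)
  ind l z = λ i → subst (λ i → l i ≡ 0ℚ) (join-splitAt m s i) (pick (splitAt m i))
    where
    lp : Fin m → ℚ
    lp i = l (i ↑ˡ s)
    lc : Fin s → ℚ
    lc j = l (m ↑ʳ j)
    splitz : ∀ e → lincomb lp p e + lincomb lc c e ≡ 0ℚ
    splitz e = trans (sym (trans (sumF-++ {m} (λ i → l i * (p ++F c) i e)) (cong₂ _+_
        (sumF-cong λ i → cong (λ x → lp i * [ p , c ]′ x e) (splitAt-↑ˡ m i s))
        (sumF-cong λ j → cong (λ x → lc j * [ p , c ]′ x e) (splitAt-↑ʳ m s j))))) (z e)
    C = lincomb lc c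
    C⟂p : dot C (lincomb lp p) ≡ 0ℚ
    C⟂p = trans (dot-lincomb C lp p) (sumF-zero λ i → trans (cong (lp i *_)
      (trans (dot-comm C (p i)) (trans (dot-lincomb (p i) lc c)
        (sumF-zero λ j → trans (cong (lc j *_) (trans (dot-comm (p i) (c j)) (orth i j))) (*-zeroʳ (lc j))))))
      (*-zeroʳ (lp i)))
    C≡0 : ∀ e → C e ≡ 0ℚ
    C≡0 = dot-self C (trans (sym (+-identityˡ _)) (trans (cong (_+ dot C C) (sym C⟂p))
      (trans (sym (dot-+ʳ C _ C)) (sumF-zero λ e → trans (cong (C e *_) (splitz e)) (*-zeroʳ (C e))))))
    lp≡0 = indp lp (λ e → trans (sym (+-identityʳ _)) (trans (cong (lincomb lp p e +_) (sym (C≡0 e))) (splitz e)))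
    lc≡0 = indc lc C≡0
    pick : ∀ x → l (join m s x) ≡ 0ℚ
    pick (inj₁ i) = lp≡0 i
    pick (inj₂ j) = lc≡0 j

-- Homogenisation: affine independence and faces in one more dimension.

hom : ∀ {k} → Vect k → Vect (suc k)
hom x zero = 1ℚ
hom x (suc e) = x e

hyper : ∀ {k} → Ineq k → Vect (suc k)
hyper (f , f₀) zero = - f₀
hyper (f , f₀) (suc e) = f e

hyper-hom : ∀ {k} (i : Ineq k) x → dot (hyper i) (hom x) ≡ dot (proj₁ i) x - proj₂ i
hyper-hom (f , f₀) x = lem f₀ (dot f x)
  where
  lem : ∀ a b → - a * 1ℚ + b ≡ b - a
  lem = solve-∀ ℚ-ring

hyper-hom≡0 : ∀ {k} (i : Ineq k) {x} → dot (proj₁ i) x ≡ proj₂ i → dot (hyper i) (hom x) ≡ 0ℚ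
hyper-hom≡0 (f , f₀) {x} eq = trans (hyper-hom (f , f₀) x) (trans (cong (_- f₀) eq) (+-inverseʳ f₀))

difference-sum : ∀ {r} (c y : Fin r → ℚ) a →
  sumF (λ i → c i * (y i - a)) ≡ sumF (λ i → c i * y i) - sumF c * a
difference-sum {r} c y a = begin
  sumF (λ i → c i * (y i - a))                       ≡⟨ sumF-cong (λ i → lem (c i) (y i) a) ⟩
  sumF (λ i → c i * y i + c i * - a)                 ≡⟨ sumF-+ {r} _ _ ⟩
  sumF (λ i → c i * y i) + sumF (λ i → c i * - a)    ≡⟨ cong (sumF (λ i → c i * y i) +_) (sumF-*ʳ (- a) c) ⟩
  sumF (λ i → c i * y i) + sumF c * - a              ≡⟨ cong (sumF (λ i → c i * y i) +_) (neg-distribʳ-* (sumF c) a) ⟨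
  sumF (λ i → c i * y i) - sumF c * a                ∎
  where
  open ≡-Reasoning
  lem : ∀ c y a → c * (y - a) ≡ c * y + c * - a
  lem = solve-∀ ℚ-ring

affIndep⇒linIndep : ∀ {k} r (p : Fin r → Vect k) → AffIndep r p → LinIndep (hom ∘ p)
affIndep⇒linIndep zero p _ c z ()
affIndep⇒linIndep (suc r) p aff c z = λ { zero → c0 ; (suc i) → tail0 i }
  where
  S : ℚ
  S = sumF (c ∘ suc)
  sum0 : c zero + S ≡ 0ℚ
  sum0 = trans (cong₂ _+_ (sym (*-identityʳ (c zero))) (sumF-cong (λ i → sym (*-identityʳ (c (suc i)))))) (z zero)
  lem : ∀ c0 S P a → P - S * a ≡ (c0 * a + P) - (c0 + S) * a
  lem = solve-∀ ℚ-ring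
  tail0 : ∀ i → c (suc i) ≡ 0ℚ
  tail0 = aff (c ∘ suc) λ e → trans (difference-sum (c ∘ suc) (λ i → p (suc i) e) (p zero e))
    (trans (lem (c zero) S (sumF (λ i → c (suc i) * p (suc i) e)) (p zero e))
      (trans (cong₂ (λ x y → x - y * p zero e) (z (suc e)) sum0) (lem' (p zero e))))
    where
    lem' : ∀ x → 0ℚ - 0ℚ * x ≡ 0ℚ
    lem' = solve-∀ ℚ-ring
  c0 : c zero ≡ 0ℚ
  c0 = trans (sym (+-identityʳ (c zero))) (trans (cong (c zero +_) (sym (sumF-zero tail0))) sum0)

linIndep⇒affIndep : ∀ {k} r (p : Fin r → Vect k) → LinIndep (hom ∘ p) → AffIndep r p
linIndep⇒affIndep zero p _ = tt
linIndep⇒affIndep {k} (suc r) p ind l z i = ind c cz (suc i)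
  where
  S : ℚ
  S = sumF l
  c : Fin (suc r) → ℚ
  c zero = - S
  c (suc i) = l i
  cz : ∀ e → lincomb c (hom ∘ p) e ≡ 0ℚ
  cz zero = trans (cong (- S * 1ℚ +_) (trans (sumF-*ʳ 1ℚ l) refl)) (lem S)
    where
    lem : ∀ S → - S * 1ℚ + S * 1ℚ ≡ 0ℚ
    lem = solve-∀ ℚ-ring
  cz (suc e) = trans (lem S (p zero e) (sumF (λ i → l i * p (suc i) e)))
    (trans (sym (difference-sum l (λ i → p (suc i) e) (p zero e))) (z e))
    where
    lem : ∀ S a P → - S * a + P ≡ P - S * a
    lem = solve-∀ ℚ-ring

linIndep-prefix : ∀ {r d k} (p : Fin (r ℕ.+ d) → Vect k) → LinIndep p → LinIndep (λ i → p (i ↑ˡ d))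
linIndep-prefix {r} {d} p ind c z i = trans (sym (cong [ c , zeros ]′ (splitAt-↑ˡ r i d))) (ind l lz (i ↑ˡ d))
  where
  zeros : Fin d → ℚ
  zeros _ = 0ℚ
  l : Fin (r ℕ.+ d) → ℚ
  l = c ++F zeros
  lz : ∀ e → lincomb l p e ≡ 0ℚ
  lz e = trans (sumF-++ {r} (λ i → l i * p i e)) (trans (cong₂ _+_
    (trans (sumF-cong λ i → cong (λ y → [ c , zeros ]′ y * p (i ↑ˡ d) e) (splitAt-↑ˡ r i d)) (z e))
    (sumF-zero λ j → trans (cong (λ y → [ c , zeros ]′ y * p (r ↑ʳ j) e) (splitAt-↑ʳ r d j)) (*-zeroˡ (p (r ↑ʳ j) e))))
    (+-identityʳ 0ℚ))

-- The coefficient vectors that express `b` through `c` are themselves independent, because a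
-- relation between them carries over to `b`.
spanned⇒≤ : ∀ {m s k} (b : Fin m → Vect k) (c : Fin s → Vect k) → LinIndep b →
  (∀ j → ∃[ γ ] ∀ e → b j e ≡ lincomb γ c e) → m ℕ.≤ s
spanned⇒≤ {m} {s} b c ind spn = linIndep⇒≤ (λ j → proj₁ (spn j)) λ l z → ind l λ e → begin
  sumF (λ j → l j * b j e)
    ≡⟨ sumF-cong (λ j → trans (cong (l j *_) (proj₂ (spn j) e)) (sym (sumF-*ˡ {s} (l j) _))) ⟩
  sumF (λ j → sumF (λ i → l j * (proj₁ (spn j) i * c i e)))
    ≡⟨ sumF-comm {m} {s} _ ⟩
  sumF (λ i → sumF (λ j → l j * (proj₁ (spn j) i * c i e)))
    ≡⟨ sumF-cong (λ i → trans (sumF-cong λ j → sym (*-assoc (l j) (proj₁ (spn j) i) (c i e))) (sumF-*ʳ {m} (c i e) _)) ⟩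
  sumF (λ i → lincomb l (λ j → proj₁ (spn j)) i * c i e)
    ≡⟨ sumF-zero (λ i → trans (cong (_* c i e) (z i)) (*-zeroˡ (c i e))) ⟩
  0ℚ ∎
  where open ≡-Reasoning

-- The rank is computed from the annihilator. The finite sample `a` bounds it from below, since
-- whatever vanishes on the sample lies in the span of `c`; the s functionals `c`, vanishing on all
-- of `X`, bound it from above.
affRank-intro : ∀ {k m s r} (X : Vect k → Set) (a : Fin m → Vect k) (c : Fin s → Vect (suc k)) →
  (∀ j → X (a j)) → LinIndep c → (∀ x → X x → ∀ i → dot (c i) (hom x) ≡ 0ℚ) →
  (∀ g → (∀ j → dot g (hom (a j)) ≡ 0ℚ) → ∃[ γ ] ∀ e → g e ≡ lincomb γ c e) →
  r ℕ.+ s ≡ suc k → AffRank X r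
affRank-intro {k} {m} {s} {r} X a c aX indc van spn r+s = lower , upper
  where
  open Elimination (eliminate (hom ∘ a))
  corank≤s : corank ℕ.≤ s
  corank≤s = spanned⇒≤ basis c indepBasis (λ j → spn (basis j) (orthogonal j))
  r≤rank : r ℕ.≤ rank
  r≤rank = ℕₚ.+-cancelʳ-≤ s r rank
    (subst (ℕ._≤ rank ℕ.+ s) (trans rank+corank (sym r+s)) (ℕₚ.+-monoʳ-≤ rank corank≤s))
  lower : Σ (Fin r → Vect k) λ p → (∀ i → X (p i)) × AffIndep r p
  lower with ℕₚ.m≤n⇒∃[o]m+o≡n r≤rank
  ... | d , eq = go rank (sym eq) pivot indepPivots
    where
    go : ∀ n → n ≡ r ℕ.+ d → (σ : Fin n → Fin m) → LinIndep (hom ∘ a ∘ σ) →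
         Σ (Fin r → Vect k) λ p → (∀ i → X (p i)) × AffIndep r p
    go _ refl σ ind = (λ i → a (σ (i ↑ˡ d))) , (λ i → aX _) ,
      linIndep⇒affIndep r _ (linIndep-prefix (hom ∘ a ∘ σ) ind)
  upper : (p : Fin (suc r) → Vect k) → (∀ i → X (p i)) → ¬ AffIndep (suc r) p
  upper p pX aff = ℕₚ.<-irrefl refl (subst (suc r ℕ.+ s ℕ.≤_) (sym r+s)
    (orthogonal⇒+≤ (hom ∘ p) c (affIndep⇒linIndep (suc r) p aff) indc (λ i j → van (p i) (pX i) j)))

pair : ∀ {A : Set} → A → A → Fin 2 → A
pair x y zero = x
pair x y (suc zero) = y

lincomb-pair : ∀ {k} (l : Fin 2 → ℚ) (c d : Vect k) e →
  lincomb l (pair c d) e ≡ l zero * c e + l (suc zero) * d e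
lincomb-pair l c d e = cong (l zero * c e +_) (+-identityʳ _)

-- `X` contains k affinely independent points, so the functionals vanishing on it form a line in
-- dimension k + 1. Subtracting from `g` the multiple of `c` that agrees with it at `j` leaves a
-- vector that, if nonzero, would be independent of `c` and give k + 2 independent vectors.
annihilator-unique : ∀ {k} (X : Vect k → Set) (c g : Vect (suc k)) → AffRank X k →
  (∃[ j ] c j ≢ 0ℚ) →
  (∀ x → X x → dot c (hom x) ≡ 0ℚ) → (∀ x → X x → dot g (hom x) ≡ 0ℚ) →
  ∃[ t ] ∀ e → g e ≡ t * c e
annihilator-unique {k} X c g ((p , pX , aff) , _) (j , cj) cX gX = t , λ e → x-y≡0⇒x≡y _ _ (g'≡0 e)
  where
  instance
    _ : NonZero (c j)
    _ = ≢-nonZero cj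
  t : ℚ
  t = g j * 1/ c j
  g' : Vect (suc k)
  g' e = g e - t * c e
  g'j : g' j ≡ 0ℚ
  g'j = trans (cong (λ z → g j - z) (trans (*-assoc (g j) (1/ c j) (c j))
    (trans (cong (g j *_) (*-inverseˡ (c j))) (*-identityʳ (g j))))) (+-inverseʳ (g j))
  g'X : ∀ x → X x → dot g' (hom x) ≡ 0ℚ
  g'X x xX = begin
    dot g' (hom x)
      ≡⟨ dot-congˡ (λ e → lem (g e) t (c e)) (hom x) ⟩
    dot (λ e → g e + (- t) * c e) (hom x)
      ≡⟨ dot-+ˡ g (λ e → (- t) * c e) (hom x) ⟩
    dot g (hom x) + dot (λ e → (- t) * c e) (hom x)
      ≡⟨ cong₂ _+_ (gX x xX) (trans (dot-*ˡ (- t) c (hom x)) (trans (cong (- t *_) (cX x xX)) (*-zeroʳ (- t)))) ⟩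
    0ℚ ∎
    where
    open ≡-Reasoning
    lem : ∀ a t c → a - t * c ≡ a + (- t) * c
    lem = solve-∀ ℚ-ring
  g'≡0 : ∀ e → g' e ≡ 0ℚ
  g'≡0 e with g' e ≟ 0ℚ
  ... | yes z = z
  ... | no nz = contradiction
    (orthogonal⇒+≤ (hom ∘ p) (pair c g') (affIndep⇒linIndep k p aff) ind
      (λ { i zero → cX _ (pX i) ; i (suc zero) → g'X _ (pX i) }))
    (λ le → ℕₚ.<-irrefl refl (subst (ℕ._≤ suc k) (ℕₚ.+-comm k 2) le))
    where
    ind : LinIndep (pair c g')
    ind l z = λ { zero → l0 ; (suc zero) → l1 }
      where
      z' : ∀ e → l zero * c e + l (suc zero) * g' e ≡ 0ℚ
      z' e = trans (sym (lincomb-pair l c g' e)) (z e)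
      drop : ∀ {a b} → a + b ≡ 0ℚ → b ≡ 0ℚ → a ≡ 0ℚ
      drop {a} ab b = trans (sym (+-identityʳ a)) (trans (cong (a +_) (sym b)) ab)
      l0 : l zero ≡ 0ℚ
      l0 = x≢0∧xy≡0⇒y≡0 cj (trans (*-comm (c j) (l zero))
        (drop (z' j) (trans (cong (l (suc zero) *_) g'j) (*-zeroʳ (l (suc zero))))))
      l1 : l (suc zero) ≡ 0ℚ
      l1 = x≢0∧xy≡0⇒y≡0 nz (trans (*-comm (g' e) (l (suc zero)))
        (drop (trans (+-comm _ (l zero * c e)) (z' e)) (trans (cong (_* c e) l0) (*-zeroˡ (c e)))))

module _ (G : Graph) where

  -- Matchings

  E : Set
  E = Fin (nE G)

  V : Set
  V = Fin (nV G)

  Sub : Set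
  Sub = E → Bool

  infix 4 _∋_ _∈_ _∋?_ _∈?_

  _∋_ : E → V → Set
  e ∋ x = x ≡ proj₁ (ends G e) ⊎ x ≡ proj₂ (ends G e)

  _∋?_ : ∀ e x → Dec (e ∋ x)
  e ∋? x = (x ≟F _) ⊎-dec (x ≟F _)

  -- A record rather than the bare equation, so that e and M can be inferred from a proof of e ∈ M.
  record _∈_ (e : E) (M : Sub) : Set where
    constructor mem
    field holds : M e ≡ true
  open _∈_ public

  _∈?_ : ∀ e M → Dec (e ∈ M)
  e ∈? M = map′ mem holds (M e ≟B true)

  ∉⇒false : ∀ {e M} → ¬ e ∈ M → M e ≡ false
  ∉⇒false {e} {M} ne with M e in eq
  ... | true = contradiction (mem eq) ne
  ... | false = refl

  ∈-ext : ∀ {e M M'} → (e ∈ M → e ∈ M') → (e ∈ M' → e ∈ M) → M e ≡ M' e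
  ∈-ext {e} {M} {M'} f g with e ∈? M
  ... | yes p = trans (holds p) (sym (holds (f p)))
  ... | no np = trans (∉⇒false np) (sym (∉⇒false (np ∘ g)))

  false⇒∉ : ∀ {e M} → M e ≡ false → ¬ e ∈ M
  false⇒∉ eq (mem eq') = case trans (sym eq) eq' of λ ()

  other : ∀ {e x} → e ∋ x → ∃[ y ] e ∋ y × y ≢ x
  other {e} (inj₁ refl) = proj₂ (ends G e) , inj₂ refl , loopless G e ∘ sym
  other {e} (inj₂ refl) = proj₁ (ends G e) , inj₁ refl , loopless G e

  two-ends : ∀ {e x y z} → e ∋ x → e ∋ y → x ≢ y → e ∋ z → z ≡ x ⊎ z ≡ y
  two-ends (inj₁ refl) (inj₁ refl) ne _ = contradiction refl ne
  two-ends (inj₂ refl) (inj₂ refl) ne _ = contradiction refl ne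
  two-ends (inj₁ refl) (inj₂ refl) ne z = z
  two-ends (inj₂ refl) (inj₁ refl) ne (inj₁ p) = inj₂ p
  two-ends (inj₂ refl) (inj₁ refl) ne (inj₂ p) = inj₁ p

  no-third-end : ∀ {e x y z} → e ∋ x → e ∋ y → x ≢ y → z ≢ x → z ≢ y → ¬ e ∋ z
  no-third-end ex ey ne zx zy ez with two-ends ex ey ne ez
  ... | inj₁ p = zx p
  ... | inj₂ p = zy p

  edge-unique : ∀ {e e' x y} → x ≢ y → e ∋ x → e ∋ y → e' ∋ x → e' ∋ y → e ≡ e'
  edge-unique ne (inj₁ refl) (inj₁ refl) = contradiction refl ne
  edge-unique ne (inj₂ refl) (inj₂ refl) = contradiction refl ne
  edge-unique {e} {e'} ne (inj₁ refl) (inj₂ refl) (inj₁ p) (inj₁ q) = contradiction (trans p (sym q)) ne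
  edge-unique {e} {e'} ne (inj₁ refl) (inj₂ refl) (inj₁ p) (inj₂ q) = noParallel G e e' (inj₁ (p , q))
  edge-unique {e} {e'} ne (inj₁ refl) (inj₂ refl) (inj₂ p) (inj₁ q) = noParallel G e e' (inj₂ (p , q))
  edge-unique {e} {e'} ne (inj₁ refl) (inj₂ refl) (inj₂ p) (inj₂ q) = contradiction (trans p (sym q)) ne
  edge-unique {e} {e'} ne (inj₂ refl) (inj₁ refl) (inj₁ p) (inj₁ q) = contradiction (trans p (sym q)) ne
  edge-unique {e} {e'} ne (inj₂ refl) (inj₁ refl) (inj₁ p) (inj₂ q) = noParallel G e e' (inj₂ (q , p))
  edge-unique {e} {e'} ne (inj₂ refl) (inj₁ refl) (inj₂ p) (inj₁ q) = noParallel G e e' (inj₁ (q , p))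
  edge-unique {e} {e'} ne (inj₂ refl) (inj₁ refl) (inj₂ p) (inj₂ q) = contradiction (trans p (sym q)) ne

  record Matching (M : Sub) : Set where
    field meet : ∀ {e e' x} → e ∈ M → e' ∈ M → e ∋ x → e' ∋ x → e ≡ e'
  open Matching public

  isMatching⇒matching : ∀ {M} → IsMatching G M → Matching M
  isMatching⇒matching im .meet {e} {e'} {x} p q ex e'x with e ≟F e'
  ... | yes eq = eq
  ... | no ne with im e e' (holds p) (holds q) ne
  ... | ac , ad , bc , bd = ⊥-elim (clash ex e'x)
    where
    clash : e ∋ x → e' ∋ x → ⊥
    clash (inj₁ r) (inj₁ s) = ac (trans (sym r) s)
    clash (inj₁ r) (inj₂ s) = ad (trans (sym r) s)
    clash (inj₂ r) (inj₁ s) = bc (trans (sym r) s)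
    clash (inj₂ r) (inj₂ s) = bd (trans (sym r) s)

  matching⇒isMatching : ∀ {M} → Matching M → IsMatching G M
  matching⇒isMatching m e e' p q ne =
    (λ r → ne (meet m (mem p) (mem q) (inj₁ refl) (inj₁ r))) , (λ r → ne (meet m (mem p) (mem q) (inj₁ refl) (inj₂ r))) ,
    (λ r → ne (meet m (mem p) (mem q) (inj₂ refl) (inj₁ r))) , (λ r → ne (meet m (mem p) (mem q) (inj₂ refl) (inj₂ r)))

  Covers Misses : Sub → V → Set
  Covers M x = ∃[ e ] e ∈ M × e ∋ x
  Misses M x = ¬ Covers M x

  covers? : ∀ M x → Dec (Covers M x)
  covers? M x = any? λ e → (e ∈? M) ×-dec (e ∋? x)

  misses⇒∉ : ∀ {M x e} → Misses M x → e ∋ x → ¬ e ∈ M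
  misses⇒∉ mi ex em = mi (_ , em , ex)

  misses≢covers : ∀ {M x y} → Misses M x → Covers M y → x ≢ y
  misses≢covers mi cv refl = mi cv

  opaque
    add : E → Sub → Sub
    add e M e' with e ≟F e'
    ... | yes _ = true
    ... | no _ = M e'

    del : E → Sub → Sub
    del e M e' with e ≟F e'
    ... | yes _ = false
    ... | no _ = M e'

    add-self : ∀ {e M} → e ∈ add e M
    add-self {e} {M} = mem eq
      where
      eq : add e M e ≡ true
      eq with e ≟F e
      ... | yes _ = refl
      ... | no ne = contradiction refl ne

    add-⊇ : ∀ {e e' M} → e' ∈ M → e' ∈ add e M
    add-⊇ {e} {e'} {M} (mem p) = mem eq
      where
      eq : add e M e' ≡ true
      eq with e ≟F e'
      ... | yes _ = refl
      ... | no _ = p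

    add-inv : ∀ {e e' M} → e' ∈ add e M → e' ≡ e ⊎ e' ∈ M
    add-inv {e} {e'} (mem p) with e ≟F e'
    ... | yes q = inj₁ (sym q)
    ... | no _ = inj₂ (mem p)

    del-inv : ∀ {e e' M} → e' ∈ del e M → e' ≢ e × e' ∈ M
    del-inv {e} {e'} (mem p) with e ≟F e'
    ... | yes q = case p of λ ()
    ... | no ne = ne ∘ sym , mem p

    del-keep : ∀ {e e' M} → e' ≢ e → e' ∈ M → e' ∈ del e M
    del-keep {e} {e'} {M} ne (mem p) = mem eq
      where
      eq : del e M e' ≡ true
      eq with e ≟F e'
      ... | yes q = contradiction (sym q) ne
      ... | no _ = p

  del-self : ∀ {e M} → ¬ e ∈ del e M
  del-self p = proj₁ (del-inv p) refl

  del-⊆ : ∀ {e e' M} → e' ∈ del e M → e' ∈ M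
  del-⊆ = proj₂ ∘ del-inv

  matching-add : ∀ {e M} → Matching M → (∀ {x} → e ∋ x → Misses M x) → Matching (add e M)
  matching-add {e} {M} m mi .meet p q ex e'x with add-inv p | add-inv q
  ... | inj₁ refl | inj₁ refl = refl
  ... | inj₁ refl | inj₂ q' = contradiction (_ , q' , e'x) (mi ex)
  ... | inj₂ p' | inj₁ refl = contradiction (_ , p' , ex) (mi e'x)
  ... | inj₂ p' | inj₂ q' = meet m p' q' ex e'x

  matching-del : ∀ {e M} → Matching M → Matching (del e M)
  matching-del {e} {M} m .meet p q = meet m (del-⊆ p) (del-⊆ q)

  misses-add : ∀ {e M x} → Misses M x → ¬ e ∋ x → Misses (add e M) x
  misses-add mi ne (_ , p , ex) with add-inv p
  ... | inj₁ refl = ne ex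
  ... | inj₂ p' = mi (_ , p' , ex)

  misses-del : ∀ {e M x} → Misses M x → Misses (del e M) x
  misses-del mi (e , p , q) = mi (e , del-⊆ p , q)

  misses-del-self : ∀ {e M x} → Matching M → e ∈ M → e ∋ x → Misses (del e M) x
  misses-del-self {e} {M} m em ex (_ , p , e'x) with meet m em (del-⊆ p) ex e'x
  ... | refl = del-self p

  ∅ : Sub
  ∅ _ = false

  matching-∅ : Matching ∅
  matching-∅ .meet (mem ())

  incidence-∈ : ∀ {M e} → e ∈ M → incidence M e ≡ 1ℚ
  incidence-∈ {M} {e} (mem p) with M e
  ... | true = refl
  ... | false = case p of λ ()

  incidence-∉ : ∀ {M e} → ¬ e ∈ M → incidence M e ≡ 0ℚ
  incidence-∉ {M} {e} ne with M e in eq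
  ... | true = contradiction (mem eq) ne
  ... | false = refl

  incidence-cong : ∀ {M M' : Sub} → (∀ e → M e ≡ M' e) → incidence M ≗ᵥ incidence M'
  incidence-cong {M} {M'} eq e with M e | M' e | eq e
  ... | true | _ | refl = refl
  ... | false | _ | refl = refl

  wt : Vect (nE G) → Sub → ℚ
  wt g M = dot g (incidence M)

  wt-∅ : ∀ g → wt g ∅ ≡ 0ℚ
  wt-∅ g = sumF-zero (λ e → *-zeroʳ (g e))

  wt-add : ∀ {e M} g → ¬ e ∈ M → wt g (add e M) ≡ wt g M + g e
  wt-add {e} {M} g ne = trans (dot-congʳ pointwise g)
    (trans (dot-+ʳ g (incidence M) (unit e)) (cong (wt g M +_) (dot-unitʳ g e)))
    where
    pointwise : ∀ e' → incidence (add e M) e' ≡ incidence M e' + unit e e'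
    pointwise e' with e ≟F e'
    ... | yes refl = trans (incidence-∈ (add-self {e} {M})) (cong (_+ 1ℚ) (sym (incidence-∉ ne)))
    ... | no e≢ with e' ∈? M
    ... | yes p = trans (incidence-∈ (add-⊇ {e} p)) (cong (_+ 0ℚ) (sym (incidence-∈ p)))
    ... | no np = trans (incidence-∉ λ q → [ e≢ ∘ sym , np ]′ (add-inv {e} q))
                        (cong (_+ 0ℚ) (sym (incidence-∉ np)))

  wt-cong : ∀ {M M'} g → (∀ e → M e ≡ M' e) → wt g M ≡ wt g M'
  wt-cong g eq = dot-congʳ (incidence-cong eq) g

  wt-del : ∀ {e M} g → e ∈ M → wt g M ≡ wt g (del e M) + g e
  wt-del {e} {M} g em = trans (wt-cong g same) (wt-add g (del-self))
    where
    same : ∀ e' → M e' ≡ add e (del e M) e'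
    same e' = ∈-ext (λ p → case e' ≟F e of λ { (yes refl) → add-self ; (no ne) → add-⊇ (del-keep ne p) })
                    (λ p → case add-inv p of λ { (inj₁ refl) → em ; (inj₂ q) → del-⊆ q })

  -- Exchange of two matchings along an alternating path.

  size : ∀ {n} → (Fin n → Bool) → ℕ
  size {zero} M = 0
  size {suc n} M = (if M zero then 1 else 0) ℕ.+ size (M ∘ suc)

  size-mono : ∀ {n} {M N : Fin n → Bool} → (∀ e → M e ≡ true → N e ≡ true) → size M ℕ.≤ size N
  size-mono {zero} le = ℕ.z≤n
  size-mono {suc n} {M} {N} le with M zero | N zero | le zero
  ... | true | true | _ = ℕ.s≤s (size-mono (le ∘ suc))
  ... | true | false | r = case r refl of λ ()
  ... | false | true | _ = ℕₚ.m≤n⇒m≤1+n (size-mono (le ∘ suc))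
  ... | false | false | _ = size-mono (le ∘ suc)

  size-strict : ∀ {n} {M N : Fin n → Bool} → (∀ e → M e ≡ true → N e ≡ true) →
    ∀ e → M e ≡ false → N e ≡ true → size M ℕ.< size N
  size-strict {suc n} {M} {N} le zero p q rewrite p | q = ℕ.s≤s (size-mono (le ∘ suc))
  size-strict {suc n} {M} {N} le (suc e) p q with M zero | N zero | le zero
  ... | true | true | _ = ℕ.s≤s (size-strict (le ∘ suc) e p q)
  ... | true | false | r = case r refl of λ ()
  ... | false | true | _ = ℕₚ.m≤n⇒m≤1+n (size-strict (le ∘ suc) e p q)
  ... | false | false | _ = size-strict (le ∘ suc) e p q

  size-del : ∀ {e M} → e ∈ M → size (del e M) ℕ.< size M
  size-del {e} {M} em = size-strict (λ e' p → holds (del-⊆ {e} {e'} {M} (mem p))) e (∉⇒false (del-self {e} {M})) (holds em)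

  -- `preserved`, asked for every `g`, says that the edges of M and N are redistributed with
  -- multiplicity. `Goal` is a parameter because the recursion needs nothing about u and v once the
  -- path has stopped at one of them.
  record Switched (M N : Sub) (t : V) (Goal : Sub → Set) : Set where
    field
      M' N' : Sub
      matchM : Matching M'
      matchN : Matching N'
      preserved : ∀ g → wt g M' + wt g N' ≡ wt g M + wt g N
      M'⊆ : ∀ {e} → e ∈ M' → e ∈ M ⊎ e ∈ N
      N'⊆ : ∀ {e} → e ∈ N' → e ∈ M ⊎ e ∈ N
      missed : Misses M' t
      goal : Goal M'

  -- Exchanges M and N along the alternating path that starts at t; the path cannot
  -- end in both u and v, so one of them stays uncovered.
  switch : ∀ n {M N t u v} → size M ℕ.< n → Matching M → Matching N → u ≢ v →
    Misses N t → Misses M u → Misses M v →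
    Switched M N t (λ M' → Misses M' u ⊎ Misses M' v)
  switch (suc n) {M} {N} {t} {u} {v} (ℕ.s≤s lt) mM mN u≢v Nt Mu Mv with covers? M t
  ... | no nc = record
    { M' = M ; N' = N ; matchM = mM ; matchN = mN ; preserved = λ _ → refl
    ; M'⊆ = inj₁ ; N'⊆ = inj₂ ; missed = nc ; goal = inj₁ Mu }
  ... | yes (e , eM , et) with other et
  ... | x , ex , x≢t with covers? N x
  ... | no nc = record
    { M' = M₁ ; N' = add e N ; matchM = matching-del mM
    ; matchN = matching-add mN λ ez → case two-ends et ex (x≢t ∘ sym) ez of λ
        { (inj₁ refl) → Nt ; (inj₂ refl) → nc }
    ; preserved = λ g → trans (cong (wt g M₁ +_) (wt-add g (misses⇒∉ Nt et)))
        (trans (lem (wt g M₁) (wt g N) (g e)) (cong (_+ wt g N) (sym (wt-del g eM))))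
    ; M'⊆ = λ p → inj₁ (del-⊆ p)
    ; N'⊆ = λ p → case add-inv p of λ { (inj₁ refl) → inj₁ eM ; (inj₂ q) → inj₂ q }
    ; missed = misses-del-self mM eM et ; goal = inj₁ (misses-del Mu) }
    where
    M₁ = del e M
    lem : ∀ a b c → a + (b + c) ≡ (a + c) + b
    lem = solve-∀ ℚ-ring
  ... | yes (e' , e'N , e'x) with other e'x
  ... | y , e'y , y≢x = answer
    where
    M₁ = del e M
    N₁ = del e' N
    e'∌t : ¬ e' ∋ t
    e'∌t ez = Nt (e' , e'N , ez)

    -- The two deleted edges return on exchanged sides. There is room for them: t and x are missed
    -- by both M₁ and N₁, hence by everything built from their edges, and y is missed by M₁'.
    extend : ∀ {Goal₁ : Sub → Set} (S : Switched M₁ N₁ y Goal₁) w → Misses M w → w ≢ y →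
      Misses (Switched.M' S) w → Switched M N t (λ M' → Misses M' w)
    extend S w Mw w≢y M₁'w = record
      { M' = add e' M₁' ; N' = add e N₁'
      ; matchM = matching-add matchM λ ez → case two-ends e'x e'y (y≢x ∘ sym) ez of λ
          { (inj₁ refl) → via M'⊆ M₁x N₁x ; (inj₂ refl) → missed }
      ; matchN = matching-add matchN λ ez → case two-ends et ex (x≢t ∘ sym) ez of λ
          { (inj₁ refl) → via N'⊆ M₁t N₁t ; (inj₂ refl) → via N'⊆ M₁x N₁x }
      ; preserved = λ g → begin
          wt g (add e' M₁') + wt g (add e N₁')
            ≡⟨ cong₂ _+_ (wt-add g (misses⇒∉ missed e'y)) (wt-add g (misses⇒∉ (via N'⊆ M₁t N₁t) et)) ⟩
          (wt g M₁' + g e') + (wt g N₁' + g e)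
            ≡⟨ lem₁ (wt g M₁') (g e') (wt g N₁') (g e) ⟩
          (wt g M₁' + wt g N₁') + (g e' + g e)
            ≡⟨ cong (_+ (g e' + g e)) (preserved g) ⟩
          (wt g M₁ + wt g N₁) + (g e' + g e)
            ≡⟨ lem₂ (wt g M₁) (g e') (wt g N₁) (g e) ⟩
          (wt g M₁ + g e) + (wt g N₁ + g e')
            ≡⟨ cong₂ _+_ (wt-del g eM) (wt-del g e'N) ⟨
          wt g M + wt g N ∎
      ; M'⊆ = λ p → case add-inv p of λ { (inj₁ refl) → inj₂ e'N ; (inj₂ q) → back (M'⊆ q) }
      ; N'⊆ = λ p → case add-inv p of λ { (inj₁ refl) → inj₁ eM ; (inj₂ q) → back (N'⊆ q) }
      ; missed = misses-add (via M'⊆ M₁t N₁t) e'∌t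
      ; goal = misses-add M₁'w (no-third-end e'x e'y (y≢x ∘ sym) (misses≢covers Mw (e , eM , ex)) w≢y) }
      where
      open Switched S renaming (M' to M₁'; N' to N₁')
      open ≡-Reasoning
      lem₁ : ∀ a b c d → (a + b) + (c + d) ≡ (a + c) + (b + d)
      lem₁ = solve-∀ ℚ-ring
      lem₂ : ∀ a b c d → (a + c) + (b + d) ≡ (a + d) + (c + b)
      lem₂ = solve-∀ ℚ-ring
      M₁x : Misses M₁ x
      M₁x = misses-del-self mM eM ex
      M₁t : Misses M₁ t
      M₁t = misses-del-self mM eM et
      N₁x : Misses N₁ x
      N₁x = misses-del-self mN e'N e'x
      N₁t : Misses N₁ t
      N₁t = misses-del Nt
      via : ∀ {A} → (∀ {e} → e ∈ A → e ∈ M₁ ⊎ e ∈ N₁) → ∀ {z} → Misses M₁ z → Misses N₁ z → Misses A z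
      via sub p q (e , r , ez) = [ (λ r → p (e , r , ez)) , (λ r → q (e , r , ez)) ]′ (sub r)
      back : ∀ {e} → e ∈ M₁ ⊎ e ∈ N₁ → e ∈ M ⊎ e ∈ N
      back (inj₁ p) = inj₁ (del-⊆ p)
      back (inj₂ p) = inj₂ (del-⊆ p)

    weaken : ∀ {A B : Sub → Set} → (∀ {X} → A X → B X) → Switched M N t A → Switched M N t B
    weaken f S = record { Switched S hiding (goal) ; goal = f (Switched.goal S) }

    -- Used when the path arrives at u or v. It stops there because M misses that vertex, and the
    -- other of the two is not on it.
    trivial : Misses M₁ y → Switched M₁ N₁ y (λ _ → ⊤)
    trivial M₁y = record
      { M' = M₁ ; N' = N₁ ; matchM = matching-del mM ; matchN = matching-del mN
      ; preserved = λ _ → refl ; M'⊆ = inj₁ ; N'⊆ = inj₂ ; missed = M₁y ; goal = tt }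

    answer : Switched M N t (λ M' → Misses M' u ⊎ Misses M' v)
    answer with y ≟F u | y ≟F v
    ... | yes refl | _ = weaken (λ {X} → inj₂ {A = Misses X u}) (extend (trivial (misses-del Mu)) v Mv (u≢v ∘ sym) (misses-del Mv))
    ... | no _ | yes refl = weaken (λ {X} → inj₁ {B = Misses X v}) (extend (trivial (misses-del Mv)) u Mu u≢v (misses-del Mu))
    ... | no y≢u | no y≢v = finish (switch n (ℕₚ.<-≤-trans (size-del eM) lt)
            (matching-del mM) (matching-del mN) u≢v
            (misses-del-self mN e'N e'y) (misses-del Mu) (misses-del Mv))
      where
      finish : Switched M₁ N₁ y (λ M' → Misses M' u ⊎ Misses M' v) → Switched M N t (λ M' → Misses M' u ⊎ Misses M' v)
      finish S with Switched.goal S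
      ... | inj₁ p = weaken (λ {X} → inj₁ {B = Misses X v}) (extend S u Mu (y≢u ∘ sym) p)
      ... | inj₂ p = weaken (λ {X} → inj₂ {A = Misses X u}) (extend S v Mv (y≢v ∘ sym) p)

  cons : ∀ {n} → Bool → (Fin n → Bool) → Fin (suc n) → Bool
  cons b M zero = b
  cons b M (suc e) = M e

  allSubsets : ∀ n → List (Fin n → Bool)
  allSubsets zero = (λ ()) ∷ []
  allSubsets (suc n) = List.map (cons false) (allSubsets n) List.++ List.map (cons true) (allSubsets n)

  allSubsets-complete : ∀ {n} (M : Fin n → Bool) → ∃[ M' ] M' ∈ˡ allSubsets n × ∀ e → M e ≡ M' e
  allSubsets-complete {zero} M = (λ ()) , here refl , λ ()
  allSubsets-complete {suc n} M with allSubsets-complete (M ∘ suc) | M zero in eq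
  ... | M' , p , same | false = cons false M' , ∈-++⁺ˡ (∈-map⁺ _ p) , λ { zero → eq ; (suc e) → same e }
  ... | M' , p , same | true = cons true M' , ∈-++⁺ʳ _ (∈-map⁺ _ p) , λ { zero → eq ; (suc e) → same e }

  -- Tight matchings and facets

  -- The enumeration reaches every subset only up to pointwise equality, so a property to be
  -- searched for must be invariant under it.
  Respects : (Sub → Set) → Set
  Respects P = ∀ {M M'} → (∀ e → M e ≡ M' e) → P M → P M'

  enumerate : (P : Sub → Set) → (∀ M → Dec (P M)) → Respects P →
    ∃[ m ] Σ (Fin m → Sub) λ a → (∀ j → P (a j)) × (∀ M → P M → ∃[ j ] ∀ e → M e ≡ a j e)
  enumerate P P? resp = length L , lookup L , (λ j → proj₂ (∈-filter⁻ P? {xs = allSubsets (nE G)} (∈-lookup {xs = L} j))) , locate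
    where
    L = List.filter P? (allSubsets (nE G))
    locate : ∀ M → P M → ∃[ j ] ∀ e → M e ≡ lookup L j e
    locate M p with allSubsets-complete M
    ... | M' , M'∈ , same = Any.index q , λ e → trans (same e) (cong (λ X → X e) (Anyₚ.lookup-index q))
      where
      q : M' ∈ˡ L
      q = ∈-filter⁺ P? M'∈ (resp same p)

  search : (P : Sub → Set) → (∀ M → Dec (P M)) → Respects P → Dec (∃ P)
  search P P? resp with enumerate P P? resp
  ... | zero , _ , _ , complete = no λ (M , p) → case proj₁ (complete M p) of λ ()
  ... | suc m , a , sound , _ = yes (a zero , sound zero)

  ∈-resp : ∀ {e M M'} → (∀ e → M e ≡ M' e) → e ∈ M → e ∈ M'
  ∈-resp {e} same (mem p) = mem (trans (sym (same e)) p)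

  matching? : ∀ M → Dec (Matching M)
  matching? M = map′ to from
    (all? λ e → all? λ e' → all? λ x → (e ∈? M) →-dec ((e' ∈? M) →-dec ((e ∋? x) →-dec ((e' ∋? x) →-dec (e ≟F e')))))
    where
    to : (∀ e e' x → e ∈ M → e' ∈ M → e ∋ x → e' ∋ x → e ≡ e') → Matching M
    to f .meet = f _ _ _
    from : Matching M → ∀ e e' x → e ∈ M → e' ∈ M → e ∋ x → e' ∋ x → e ≡ e'
    from m _ _ _ = meet m

  matching-resp : Respects Matching
  matching-resp same m .meet p q = meet m (∈-resp (sym ∘ same) p) (∈-resp (sym ∘ same) q)

  Ineqᴳ : Set
  Ineqᴳ = Ineq (nE G)

  Valid : Ineqᴳ → Set
  Valid (f , f₀) = ∀ {M} → Matching M → wt f M ≤ f₀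

  record Tight (i : Ineqᴳ) (M : Sub) : Set where
    constructor tight
    field
      matching : Matching M
      attains : wt (proj₁ i) M ≡ proj₂ i
  open Tight public

  tight? : ∀ i M → Dec (Tight i M)
  tight? i M = map′ (λ { (m , a) → tight m a }) (λ t → matching t , attains t)
    (matching? M ×-dec (wt (proj₁ i) M ≟ proj₂ i))

  tight-resp : ∀ i → Respects (Tight i)
  tight-resp i same (tight m a) = tight (matching-resp same m) (trans (wt-cong (proj₁ i) (sym ∘ same)) a)

  ConstantOnTight : Ineqᴳ → Ineqᴳ → Set
  ConstantOnTight i (g , g₀) = ∀ {M} → Tight i M → wt g M ≡ g₀

  Multiple : Ineqᴳ → Ineqᴳ → Set
  Multiple (f , f₀) (g , g₀) = ∃[ t ] (∀ e → g e ≡ t * f e) × g₀ ≡ t * f₀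

  incidence∈polytope : ∀ {M} → Matching M → MatchingPolytope G (incidence M)
  incidence∈polytope {M} m = 1 , (λ _ → incidence M) , (λ _ → 1ℚ) ,
    (λ _ → M , matching⇒isMatching m , λ _ → refl) , (λ _ → nonNegative⁻¹ 1ℚ) , refl ,
    λ e → sym (trans (+-identityʳ _) (*-identityˡ _))

  conv-average : ∀ {r k} {x : Vect k} (p : Fin r → Vect k) (w : Fin r → ℚ) → sumF w ≡ 1ℚ →
    (∀ e → x e ≡ lincomb w p e) → ∀ g g₀ → dot g x - g₀ ≡ sumF (λ i → w i * (dot g (p i) - g₀))
  conv-average {x = x} p w w1 eq g g₀ = begin
    dot g x - g₀
      ≡⟨ cong₂ _-_ (trans (dot-congʳ eq g) (dot-lincomb g w p)) (trans (sym (*-identityˡ g₀)) (cong (_* g₀) (sym w1))) ⟩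
    sumF (λ i → w i * dot g (p i)) - sumF w * g₀
      ≡⟨ difference-sum w (λ i → dot g (p i)) g₀ ⟨
    sumF (λ i → w i * (dot g (p i) - g₀)) ∎
    where open ≡-Reasoning

  0≤p-q : ∀ {p q} → q ≤ p → 0ℚ ≤ p - q
  0≤p-q {p} {q} le = subst (_≤ p - q) (+-inverseʳ q) (+-monoˡ-≤ (- q) le)

  0≤p-q⇒q≤p : ∀ {p q} → 0ℚ ≤ p - q → q ≤ p
  0≤p-q⇒q≤p {p} {q} le = subst₂ _≤_ (+-identityˡ q) (lem p q) (+-monoˡ-≤ q le)
    where
    lem : ∀ p q → (p - q) + q ≡ p
    lem = solve-∀ ℚ-ring

  0≤p*q : ∀ {p q} → 0ℚ ≤ p → 0ℚ ≤ q → 0ℚ ≤ p * q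
  0≤p*q {p} {q} 0≤p 0≤q = subst (_≤ p * q) (*-zeroʳ p) (*-monoˡ-≤-nonNeg p {{nonNegative 0≤p}} 0≤q)

  slack-sum : ∀ {r k} {x : Vect k} (p : Fin r → Vect k) (w : Fin r → ℚ) → sumF w ≡ 1ℚ →
    (∀ e → x e ≡ lincomb w p e) → ∀ f f₀ → f₀ - dot f x ≡ sumF (λ i → w i * (f₀ - dot f (p i)))
  slack-sum {r} {x = x} p w w1 eq f f₀ = begin
    f₀ - dot f x                                        ≡⟨ lem₁ f₀ (dot f x) ⟩
    - 1ℚ * (dot f x - f₀)                               ≡⟨ cong (- 1ℚ *_) (conv-average p w w1 eq f f₀) ⟩
    - 1ℚ * sumF (λ i → w i * (dot f (p i) - f₀))        ≡⟨ sumF-*ˡ {r} (- 1ℚ) _ ⟨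
    sumF (λ i → - 1ℚ * (w i * (dot f (p i) - f₀)))      ≡⟨ sumF-cong (λ i → lem₂ (w i) (dot f (p i)) f₀) ⟩
    sumF (λ i → w i * (f₀ - dot f (p i)))               ∎
    where
    open ≡-Reasoning
    lem₁ : ∀ a b → a - b ≡ - 1ℚ * (b - a)
    lem₁ = solve-∀ ℚ-ring
    lem₂ : ∀ w a b → - 1ℚ * (w * (a - b)) ≡ w * (b - a)
    lem₂ = solve-∀ ℚ-ring

  valid⇒polytope : ∀ {i} → Valid i → ∀ x → MatchingPolytope G x → Satisfies i x
  valid⇒polytope {f , f₀} v x (r , p , w , pM , w≥0 , w1 , eq) =
    0≤p-q⇒q≤p (subst (0ℚ ≤_) (sym (slack-sum p w w1 eq f f₀))
      (sumF-nonneg λ i → 0≤p*q (w≥0 i) (0≤p-q (ok i))))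
    where
    ok : ∀ i → dot f (p i) ≤ f₀
    ok i with pM i
    ... | M , m , same = subst (_≤ f₀) (sym (dot-congʳ same f)) (v (isMatching⇒matching m))

  polytope⇒valid : ∀ {i} → (∀ x → MatchingPolytope G x → Satisfies i x) → Valid i
  polytope⇒valid v m = v _ (incidence∈polytope m)

  -- In a convex representation of a point of the face the weighted slacks are nonnegative with sum
  -- 0, so every matching of nonzero weight is tight.
  constant-on-face : ∀ {i} → Valid i → ∀ (g : Ineqᴳ) → ConstantOnTight i g →
    ∀ x → Face G i x → dot (proj₁ g) x ≡ proj₂ g
  constant-on-face {f , f₀} v (g , g₀) const x ((r , p , w , pM , w≥0 , w1 , eq) , fx) =
    x-y≡0⇒x≡y _ _ (trans (conv-average p w w1 eq g g₀) (sumF-zero term))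
    where
    ok : ∀ i → dot f (p i) ≤ f₀
    ok i with pM i
    ... | M , m , same = subst (_≤ f₀) (sym (dot-congʳ same f)) (v (isMatching⇒matching m))
    slack : ∀ i → w i * (f₀ - dot f (p i)) ≡ 0ℚ
    slack = sumF≤0⇒0 (λ i → 0≤p*q (w≥0 i) (0≤p-q (ok i)))
      (≤-reflexive (trans (sym (slack-sum p w w1 eq f f₀)) (trans (cong (λ z → f₀ - z) fx) (+-inverseʳ f₀))))
    term : ∀ i → w i * (dot g (p i) - g₀) ≡ 0ℚ
    term i with w i ≟ 0ℚ
    ... | yes z = trans (cong (_* (dot g (p i) - g₀)) z) (*-zeroˡ (dot g (p i) - g₀))
    ... | no nz with pM i
    ... | M , m , same = trans (cong (w i *_) (trans (cong (_- g₀) (trans (dot-congʳ same g) (const tightM))) (+-inverseʳ g₀))) (*-zeroʳ (w i))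
      where
      tightM : Tight (f , f₀) M
      tightM = tight (isMatching⇒matching m) (trans (sym (dot-congʳ same f))
        (sym (x-y≡0⇒x≡y _ _ (x≢0∧xy≡0⇒y≡0 nz (slack i)))))

  single : E → Sub
  single e = add e ∅

  ∈-∅ : ∀ {e} → ¬ e ∈ ∅
  ∈-∅ (mem ())

  ∈-single : ∀ {e e'} → e' ∈ single e → e' ≡ e
  ∈-single p with add-inv p
  ... | inj₁ q = q
  ... | inj₂ (mem ())

  matching-single : ∀ {e} → Matching (single e)
  matching-single = matching-add matching-∅ λ _ → λ ()

  wt-single : ∀ g e → wt g (single e) ≡ g e
  wt-single g e = trans (wt-add g ∈-∅) (trans (cong (_+ g e) (wt-∅ g)) (+-identityˡ (g e)))

  incidence-single : ∀ e → incidence (single e) ≗ᵥ unit e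
  incidence-single e e' = case e ≟F e' of λ
    { (yes refl) → trans (incidence-∈ add-self) (sym (unit-refl e))
    ; (no ne) → trans (incidence-∉ {M = single e} λ p → ne (sym (∈-single p))) (sym (unit-≢ ne)) }

  -- This is where full dimension of the polytope enters: the face of the zero functional contains
  -- the empty matching and all single edges, which are |E| + 1 affinely independent points.
  facet⇒nonzero : ∀ {i} → FacetDefining G i → ∃[ j ] hyper i j ≢ 0ℚ
  facet⇒nonzero {f , f₀} (_ , _ , (_ , upper)) with any? (λ j → ¬? (hyper (f , f₀) j ≟ 0ℚ))
  ... | yes found = found
  ... | no none = contradiction indep (upper p pFace)
    where
    zero-hyper : ∀ j → hyper (f , f₀) j ≡ 0ℚ
    zero-hyper j = decidable-stable (_ ≟ 0ℚ) λ nz → none (j , nz)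
    f₀≡0 : f₀ ≡ 0ℚ
    f₀≡0 = neg-injective (zero-hyper zero)
    q : Fin (suc (nE G)) → Sub
    q zero = ∅
    q (suc e) = single e
    p : Fin (suc (nE G)) → Vect (nE G)
    p j = incidence (q j)
    mq : ∀ j → Matching (q j)
    mq zero = matching-∅
    mq (suc e) = matching-single
    pFace : ∀ j → Face G (f , f₀) (p j)
    pFace j = incidence∈polytope (mq j) ,
      trans (sumF-zero λ e → trans (cong (_* p j e) (zero-hyper (suc e))) (*-zeroˡ (p j e))) (sym f₀≡0)
    indep : AffIndep (suc (nE G)) p
    indep l z e = trans (sym (dot-unitʳ l e)) (trans (sumF-cong λ i → cong (l i *_)
      (trans (unit-sym e i) (trans (sym (incidence-single i e)) (sym (+-identityʳ _))))) (z e))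
      where
      unit-sym : ∀ e i → unit e i ≡ unit i e
      unit-sym e i = case e ≟F i of λ
        { (yes refl) → refl ; (no ne) → trans (unit-≢ ne) (sym (unit-≢ (ne ∘ sym))) }

  -- The form in which the dimension of a facet is used from here on: any quantity found to be
  -- constant on the tight matchings determines `i` up to scaling.
  facet-unique : ∀ {i} → FacetDefining G i → ∀ g → ConstantOnTight i g → Multiple i g
  facet-unique {i@(f , f₀)} facet@(v , _ , rk) (g , g₀) const = finish
    (annihilator-unique (Face G i) (hyper i) (hyper (g , g₀)) rk (facet⇒nonzero facet)
      (λ x xF → hyper-hom≡0 i (proj₂ xF))
      (λ x xF → hyper-hom≡0 (g , g₀) (constant-on-face (polytope⇒valid {i} v) (g , g₀) const x xF)))
    where
    finish : ∃[ t ] (∀ j → hyper (g , g₀) j ≡ t * hyper i j) → Multiple i (g , g₀)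
    finish (t , eq) = t , (λ e → eq (suc e)) , neg-injective (trans (eq zero) (sym (neg-distribʳ-* t f₀)))

  functional : Vect (suc (nE G)) → Ineqᴳ
  functional g = g ∘ suc , - g zero

  functional-wt : ∀ g M → dot g (hom (incidence M)) ≡ 0ℚ → wt (g ∘ suc) M ≡ - g zero
  functional-wt g M eq = trans (lem (g zero) (wt (g ∘ suc) M)) (trans (cong (_- g zero) eq) (+-identityˡ _))
    where
    lem : ∀ a b → b ≡ (a * 1ℚ + b) - a
    lem = solve-∀ ℚ-ring

  -- The converse of `facet-unique`: a one-dimensional annihilator of the finitely many tight
  -- matchings gives a face of dimension |E| - 1.
  facet-intro : ∀ i → Valid i → ∃[ j ] hyper i j ≢ 0ℚ → ∃ (Tight i) →
    (∀ g → ConstantOnTight i g → Multiple i g) → FacetDefining G i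
  facet-intro i@(f , f₀) v (j , nz) (M₀ , t₀) unique =
    valid⇒polytope {i} v , (incidence M₀ , face t₀) , rk
    where
    face : ∀ {M} → Tight i M → Face G i (incidence M)
    face t = incidence∈polytope (matching t) , attains t
    rk : AffRank (Face G i) (nE G)
    rk with enumerate (Tight i) (tight? i) (tight-resp i)
    ... | m , a , sound , complete =
      affRank-intro (Face G i) (λ j → incidence (a j)) (λ (_ : Fin 1) → hyper i) (face ∘ sound)
        (λ { c z zero → x≢0∧xy≡0⇒y≡0 nz (trans (*-comm (hyper i j) (c zero)) (trans (sym (+-identityʳ _)) (z j))) })
        (λ x xF _ → hyper-hom≡0 i (proj₂ xF)) span (ℕₚ.+-comm (nE G) 1)
      where
      span : ∀ g → (∀ j → dot g (hom (incidence (a j))) ≡ 0ℚ) → ∃[ γ ] ∀ e → g e ≡ lincomb γ (λ (_ : Fin 1) → hyper i) e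
      span g vanish = finish (unique (functional g) λ {M} tM → let j , same = complete M tM in
        trans (wt-cong (g ∘ suc) same) (functional-wt g (a j) (vanish j)))
        where
        finish : Multiple i (functional g) → ∃[ γ ] ∀ e → g e ≡ lincomb γ (λ (_ : Fin 1) → hyper i) e
        finish (t , eq , eq₀) = (λ _ → t) , λ
          { zero → trans (neg-injective (trans eq₀ (lem t f₀))) (sym (+-identityʳ _))
          ; (suc e) → trans (eq e) (sym (+-identityʳ _)) }
          where
          lem : ∀ t a → t * a ≡ - (t * - a)
          lem = solve-∀ ℚ-ring

  Combination : Ineqᴳ → Ineqᴳ → Ineqᴳ → Set
  Combination (f , f₀) (h , h₀) (g , g₀) = ∃[ α ] ∃[ β ] (∀ e → g e ≡ α * f e + β * h e) × g₀ ≡ α * f₀ + β * h₀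

  Independent : Ineqᴳ → Ineqᴳ → Set
  Independent (f , f₀) (h , h₀) = ∀ α β → (∀ e → α * f e + β * h e ≡ 0ℚ) → α * f₀ + β * h₀ ≡ 0ℚ → α ≡ 0ℚ × β ≡ 0ℚ

  Adjacent : Ineqᴳ → Ineqᴳ → Set
  Adjacent i h = ∃[ r ] AffRank (λ x → Face G i x × Face G h x) r × suc r ≡ nE G

  -- The annihilator of the common tight matchings is the plane spanned by `i` and `h`, so the rank
  -- is |E| + 1 - 2. The edge makes |E| positive, so that this rank has the form demanded by
  -- `Adjacent`.
  adjacent-intro : ∀ i h → E → Independent i h →
    (∀ g → (∀ {M} → Tight i M → Tight h M → wt (proj₁ g) M ≡ proj₂ g) → Combination i h g) → Adjacent i h
  adjacent-intro i@(f , f₀) h@(h₁ , h₀) e₀ indep unique = build (nE G) refl e₀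
    where
    both : ∀ {M} → Tight i M × Tight h M → Face G i (incidence M) × Face G h (incidence M)
    both (t , t') = (incidence∈polytope (matching t) , attains t) , (incidence∈polytope (matching t') , attains t')
    lem : ∀ α a β b → α * - a + β * - b ≡ - (α * a + β * b)
    lem = solve-∀ ℚ-ring
    build : ∀ n → n ≡ nE G → Fin n → Adjacent i h
    build (suc r) eq _ with enumerate (λ M → Tight i M × Tight h M) (λ M → tight? i M ×-dec tight? h M)
      (λ same (t , t') → tight-resp i same t , tight-resp h same t')
    ... | m , a , sound , complete = r ,
      affRank-intro (λ x → Face G i x × Face G h x) (λ j → incidence (a j)) (pair (hyper i) (hyper h)) (both ∘ sound) ind
        (λ { x (xi , xh) zero → hyper-hom≡0 i (proj₂ xi) ; x (xi , xh) (suc zero) → hyper-hom≡0 h (proj₂ xh) })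
        span (trans (ℕₚ.+-comm r 2) (cong suc eq)) , eq
      where
      ind : LinIndep (pair (hyper i) (hyper h))
      ind c z = λ { zero → proj₁ both0 ; (suc zero) → proj₂ both0 }
        where
        z' : ∀ e → c zero * hyper i e + c (suc zero) * hyper h e ≡ 0ℚ
        z' e = trans (sym (lincomb-pair c (hyper i) (hyper h) e)) (z e)
        both0 = indep (c zero) (c (suc zero)) (z' ∘ suc)
          (neg-injective (trans (sym (lem (c zero) f₀ (c (suc zero)) h₀)) (z' zero)))
      span : ∀ g → (∀ j → dot g (hom (incidence (a j))) ≡ 0ℚ) → ∃[ γ ] ∀ e → g e ≡ lincomb γ (pair (hyper i) (hyper h)) e
      span g vanish = finish (unique (functional g) λ {M} tM t'M → let j , same = complete M (tM , t'M) in
        trans (wt-cong (g ∘ suc) same) (functional-wt g (a j) (vanish j)))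
        where
        finish : Combination i h (functional g) → ∃[ γ ] ∀ e → g e ≡ lincomb γ (pair (hyper i) (hyper h)) e
        finish (α , β , eqs , eq₀) = pair α β , λ
          { zero → trans (neg-injective (trans eq₀ (lem' α f₀ β h₀))) (sym (lincomb-pair (pair α β) (hyper i) (hyper h) zero))
          ; (suc e) → trans (eqs e) (sym (lincomb-pair (pair α β) (hyper i) (hyper h) (suc e))) }
          where
          lem' : ∀ α a β b → α * a + β * b ≡ - (α * - a + β * - b)
          lem' = solve-∀ ℚ-ring

  -- Minimal formulations

  -- An edge conflicts with itself. Covering all conflicts thus also puts every edge into some
  -- clique, which bounds its coordinate by 1.
  Conflict : E → E → Set
  Conflict e e' = ∃[ x ] e ∋ x × e' ∋ x

  conflict? : ∀ e e' → Dec (Conflict e e')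
  conflict? e e' = any? λ x → (e ∋? x) ×-dec (e' ∋? x)

  conflict-refl : ∀ {e} → Conflict e e
  conflict-refl = _ , inj₁ refl , inj₁ refl

  conflict-sym : ∀ {e e'} → Conflict e e' → Conflict e' e
  conflict-sym (x , p , q) = x , q , p

  Clique : Sub → Set
  Clique K = ∀ {e e'} → e ∈ K → e' ∈ K → Conflict e e'

  record MaxClique (K : Sub) : Set where
    field
      clique : Clique K
      maximal : ∀ {e} → ¬ e ∈ K → ∃[ e' ] e' ∈ K × ¬ Conflict e e'
  open MaxClique public

  nonnegIneq : E → Ineqᴳ
  nonnegIneq e = (λ e' → - unit e e') , 0ℚ

  cliqueIneq : Sub → Ineqᴳ
  cliqueIneq K = incidence K , 1ℚ

  nonnegIneq-dot : ∀ e x → dot (proj₁ (nonnegIneq e)) x ≡ - x e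
  nonnegIneq-dot e x = trans (sumF-single (λ e' → - unit e e' * x e') e λ j ne → trans (cong (λ z → - z * x j) (unit-≢ ne)) (*-zeroˡ (x j)))
    (trans (cong (λ z → - z * x e) (unit-refl e)) (lem (x e)))
    where
    lem : ∀ x → - 1ℚ * x ≡ - x
    lem = solve-∀ ℚ-ring

  0≤1 : 0ℚ ≤ 1ℚ
  0≤1 = nonNegative⁻¹ 1ℚ

  0≤incidence : ∀ (M : Sub) e → 0ℚ ≤ incidence M e
  0≤incidence M e with M e
  ... | true = 0≤1
  ... | false = ≤-refl

  -≤0 : ∀ {q} → 0ℚ ≤ q → - q ≤ 0ℚ
  -≤0 = neg-antimono-≤

  nonneg-valid : ∀ e → Valid (nonnegIneq e)
  nonneg-valid e {M} _ = subst (_≤ 0ℚ) (sym (nonnegIneq-dot e (incidence M))) (-≤0 (0≤incidence M e))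

  nonneg-tight : ∀ {e M} → Matching M → ¬ e ∈ M → Tight (nonnegIneq e) M
  nonneg-tight {e} {M} m ne = tight m (trans (nonnegIneq-dot e (incidence M)) (cong -_ (incidence-∉ ne)))

  nonneg-facet : ∀ e → FacetDefining G (nonnegIneq e)
  nonneg-facet e = facet-intro (nonnegIneq e) (nonneg-valid e)
    (suc e , λ z → case trans (cong -_ (sym (unit-refl e))) z of λ ())
    (∅ , nonneg-tight {e} matching-∅ ∈-∅) unique
    where
    unique : ∀ g → ConstantOnTight (nonnegIneq e) g → Multiple (nonnegIneq e) g
    unique (g , g₀) const = - g e , eq , trans g₀≡0 (sym (*-zeroʳ (- g e)))
      where
      g₀≡0 : g₀ ≡ 0ℚ
      g₀≡0 = trans (sym (const (nonneg-tight {e} matching-∅ ∈-∅))) (wt-∅ g)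
      lem : ∀ x → x ≡ - x * - 1ℚ
      lem = solve-∀ ℚ-ring
      eq : ∀ e' → g e' ≡ - g e * - unit e e'
      eq e' = case e ≟F e' of λ
        { (yes refl) → trans (lem (g e)) (cong (λ z → - g e * - z) (sym (unit-refl e)))
        ; (no ne) → trans (sym (wt-single g e')) (trans (const (nonneg-tight matching-single (ne ∘ ∈-single)))
            (trans g₀≡0 (trans (sym (*-zeroʳ (- g e))) (cong (λ z → - g e * - z) (sym (unit-≢ ne)))))) }

  clique-meets : ∀ {K M e} → Clique K → Matching M → e ∈ K → e ∈ M → wt (incidence K) M ≡ 1ℚ
  clique-meets {K} {M} {e} c m eK eM = trans (sumF-single (λ e' → incidence K e' * incidence M e') e zeros)
    (cong₂ _*_ (incidence-∈ eK) (incidence-∈ eM))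
    where
    zeros : ∀ e' → e ≢ e' → incidence K e' * incidence M e' ≡ 0ℚ
    zeros e' ne with e' ∈? K | e' ∈? M
    ... | no p | _ = trans (cong (_* incidence M e') (incidence-∉ p)) (*-zeroˡ (incidence M e'))
    ... | yes _ | no q = trans (cong (incidence K e' *_) (incidence-∉ q)) (*-zeroʳ (incidence K e'))
    ... | yes p | yes q with c eK p
    ... | x , ex , e'x = contradiction (meet m eM q ex e'x) ne

  clique-avoids : ∀ {K M} → (∀ e → e ∈ K → ¬ e ∈ M) → wt (incidence K) M ≡ 0ℚ
  clique-avoids {K} {M} av = sumF-zero λ e → case e ∈? K of λ
    { (yes p) → trans (cong (incidence K e *_) (incidence-∉ (av e p))) (*-zeroʳ (incidence K e))
    ; (no np) → trans (cong (_* incidence M e) (incidence-∉ np)) (*-zeroˡ (incidence M e)) }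

  clique-valid : ∀ {K} → Clique K → Valid (cliqueIneq K)
  clique-valid {K} c {M} m with any? (λ e → (e ∈? K) ×-dec (e ∈? M))
  ... | yes (e , eK , eM) = ≤-reflexive (clique-meets c m eK eM)
  ... | no none = subst (_≤ 1ℚ) (sym (clique-avoids λ e p q → none (e , p , q))) 0≤1

  clique-tight : ∀ {K M e} → Clique K → Matching M → e ∈ K → e ∈ M → Tight (cliqueIneq K) M
  clique-tight c m eK eM = tight m (clique-meets c m eK eM)

  -- Let g be constant on the tight matchings. The single edges of `K` are tight, which fixes g on
  -- `K`. An edge outside `K` can be added to some single edge of `K` by maximality, and the pair is
  -- still tight, so g vanishes there.
  clique-facet : ∀ {K} → E → MaxClique K → FacetDefining G (cliqueIneq K)
  clique-facet {K} e₀ mc = facet-intro (cliqueIneq K) (clique-valid (clique mc)) (zero , λ ())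
    (inhabited (e₀ ∈? K)) unique
    where
    inhabited : Dec (e₀ ∈ K) → ∃ (Tight (cliqueIneq K))
    inhabited (yes p) = single e₀ , clique-tight (clique mc) matching-single p add-self
    inhabited (no np) with maximal mc np
    ... | e , eK , _ = single e , clique-tight (clique mc) matching-single eK add-self
    unique : ∀ g → ConstantOnTight (cliqueIneq K) g → Multiple (cliqueIneq K) g
    unique (g , g₀) const = g₀ , eq , sym (*-identityʳ g₀)
      where
      inside : ∀ {e} → e ∈ K → g e ≡ g₀
      inside {e} p = trans (sym (wt-single g e)) (const (clique-tight (clique mc) matching-single p add-self))
      eq : ∀ e → g e ≡ g₀ * incidence K e
      eq e with e ∈? K
      ... | yes p = trans (inside p) (trans (sym (*-identityʳ g₀)) (cong (g₀ *_) (sym (incidence-∈ p))))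
      ... | no np with maximal mc np
      ... | e' , e'K , nc = trans (trans (lem (g e) (wt g (single e'))) (cong₂ _-_ total (trans (wt-single g e') (inside e'K))))
          (trans (+-inverseʳ g₀) (trans (sym (*-zeroʳ g₀)) (cong (g₀ *_) (sym (incidence-∉ np)))))
        where
        lem : ∀ a b → a ≡ (b + a) - b
        lem = solve-∀ ℚ-ring
        e∉ : ¬ e ∈ single e'
        e∉ p = nc (subst (λ z → Conflict z e') (sym (∈-single p)) conflict-refl)
        total : wt g (single e') + g e ≡ g₀
        total = trans (sym (wt-add g e∉)) (const (clique-tight (clique mc)
          (matching-add matching-single λ { {x} ex (_ , p , e'x) → nc (x , ex , subst (_∋ x) (∈-single p) e'x) }) e'K (add-⊇ add-self)))

  -- Inequalities are kept symbolic so that what they cover is decidable and can be pruned.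
  data Gen : Set where
    nonneg : E → Gen
    clq : Sub → Gen

  ineq : Gen → Ineqᴳ
  ineq (nonneg e) = nonnegIneq e
  ineq (clq K) = cliqueIneq K

  IsNonneg : E → Gen → Set
  IsNonneg e (nonneg e') = e ≡ e'
  IsNonneg e (clq _) = ⊥

  HasPair : E → E → Gen → Set
  HasPair e e' (nonneg _) = ⊥
  HasPair e e' (clq K) = e ∈ K × e' ∈ K

  isNonneg? : ∀ e g → Dec (IsNonneg e g)
  isNonneg? e (nonneg e') = e ≟F e'
  isNonneg? e (clq _) = no λ ()

  hasPair? : ∀ e e' g → Dec (HasPair e e' g)
  hasPair? e e' (nonneg _) = no λ ()
  hasPair? e e' (clq K) = (e ∈? K) ×-dec (e' ∈? K)

  record Complete (Gs : List Gen) : Set where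
    constructor complete
    field
      nonnegs : ∀ e → Any (IsNonneg e) Gs
      pairs : ∀ e e' → Conflict e e' → Any (HasPair e e') Gs
  open Complete public

  Missing : List Gen → Set
  Missing Gs = (∃[ e ] ¬ Any (IsNonneg e) Gs) ⊎ (∃[ e ] ∃[ e' ] Conflict e e' × ¬ Any (HasPair e e') Gs)

  complete⊎missing : ∀ Gs → Complete Gs ⊎ Missing Gs
  complete⊎missing Gs with any? (λ e → ¬? (Any.any? (isNonneg? e) Gs))
  ... | yes m = inj₂ (inj₁ m)
  ... | no nm with any? (λ e → any? λ e' → conflict? e e' ×-dec ¬? (Any.any? (hasPair? e e') Gs))
  ... | yes m = inj₂ (inj₂ m)
  ... | no nm' = inj₁ (complete
    (λ e → decidable-stable (Any.any? (isNonneg? e) Gs) λ n → nm (e , n))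
    (λ e e' c → decidable-stable (Any.any? (hasPair? e e') Gs) λ n → nm' (e , e' , c , n)))

  missing⇒¬complete : ∀ {Gs} → Missing Gs → ¬ Complete Gs
  missing⇒¬complete (inj₁ (e , n)) c = n (nonnegs c e)
  missing⇒¬complete (inj₂ (e , e' , cf , n)) c = n (pairs c e e' cf)

  complete? : ∀ Gs → Dec (Complete Gs)
  complete? Gs = [ yes , no ∘ missing⇒¬complete ]′ (complete⊎missing Gs)

  All-removeAt : ∀ {A : Set} {P : A → Set} {xs} → All P xs → ∀ i → All P (List.removeAt xs i)
  All-removeAt (p ∷ ps) zero = ps
  All-removeAt (p ∷ ps) (suc i) = p ∷ All-removeAt ps i

  removeAt-map : ∀ {A B : Set} (f : A → B) xs i →
    ∃[ j ] List.removeAt (List.map f xs) i ≡ List.map f (List.removeAt xs j)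
  removeAt-map f (x ∷ xs) zero = zero , refl
  removeAt-map f (x ∷ xs) (suc i) with removeAt-map f xs i
  ... | j , eq = suc j , cong (f x ∷_) eq

  -- One entry is removed at a time for as long as `Q` survives; the length is the measure. The
  -- outcome is irredundancy under single removals, as a minimal formulation requires.
  prune : ∀ {A : Set} {P : A → Set} {Q : List A → Set} → (∀ L → Dec (Q L)) → ∀ n L → length L ≡ n → All P L → Q L →
    ∃[ L' ] All P L' × Q L' × (∀ i → ¬ Q (List.removeAt L' i))
  prune Q? n L len ps q with any? (λ i → Q? (List.removeAt L i))
  ... | no none = L , ps , q , λ i q' → none (i , q')
  prune Q? zero [] len ps q | yes (() , _)
  prune Q? (suc n) L len ps q | yes (i , q') =
    prune Q? n (List.removeAt L i) (trans (length-removeAt L i) (cong ℕ.pred len)) (All-removeAt ps i) q'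

  GoodGen : (Sub → Set) → Gen → Set
  GoodGen Good (nonneg e) = ⊤
  GoodGen Good (clq K) = MaxClique K × Good K

  gen-valid : ∀ {Good} g → GoodGen Good g → Valid (ineq g)
  gen-valid (nonneg e) _ = nonneg-valid e
  gen-valid (clq K) (mc , _) = clique-valid (clique mc)

  gen-facet : ∀ {Good} → E → ∀ g → GoodGen Good g → FacetDefining G (ineq g)
  gen-facet e₀ (nonneg e) _ = nonneg-facet e
  gen-facet e₀ (clq K) (mc , _) = clique-facet e₀ mc

  conv-map : ∀ {k} {S T : Vect k → Set} → (∀ y → S y → T y) → ∀ x → Conv S x → Conv T x
  conv-map f x (r , p , w , ps , rest) = r , p , w , (λ i → f _ (ps i)) , rest

  matchingVector⇒integral : ∀ {y} → MatchingVector G y → Integral y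
  matchingVector⇒integral (M , _ , same) e with M e | same e
  ... | true | eq = ℤ.+ 1 , eq
  ... | false | eq = ℤ.+ 0 , eq

  matchingVector⇒satisfies : ∀ {i y} → Valid i → MatchingVector G y → Satisfies i y
  matchingVector⇒satisfies {f , f₀} v (M , m , same) = subst (_≤ f₀) (sym (dot-congʳ same f)) (v (isMatching⇒matching m))

  /1-cancel-≤ : ∀ z z' → z / 1 ≤ z' / 1 → z ℤ.≤ z'
  /1-cancel-≤ z z' le = subst₂ ℤ._≤_ (ℤₚ.*-identityʳ z) (ℤₚ.*-identityʳ z')
    (ℚᵘₚ.drop-*≤* (ℚᵘₚ.≤-respʳ-≃ (toℚᵘ-fromℚᵘ (ℚᵘ.mkℚᵘ z' 0)) (ℚᵘₚ.≤-respˡ-≃ (toℚᵘ-fromℚᵘ (ℚᵘ.mkℚᵘ z 0)) (toℚᵘ-mono-≤ le))))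

  integral-0-1 : ∀ {q} → ∃[ z ] q ≡ z / 1 → 0ℚ ≤ q → q ≤ 1ℚ → q ≡ 0ℚ ⊎ q ≡ 1ℚ
  integral-0-1 (z , refl) lo hi with z | /1-cancel-≤ (ℤ.+ 0) z lo | /1-cancel-≤ z (ℤ.+ 1) hi
  ... | ℤ.+ 0 | _ | _ = inj₁ refl
  ... | ℤ.+ 1 | _ | _ = inj₂ refl
  ... | ℤ.+ suc (suc n) | _ | ℤ.+≤+ (ℕ.s≤s ())
  ... | ℤ.-[1+ n ] | () | _

  dot-mono : ∀ {k} {f g y : Vect k} → (∀ e → 0ℚ ≤ y e) → (∀ e → f e ≤ g e) → dot f y ≤ dot g y
  dot-mono {y = y} y≥0 le = sumF-mono λ e → *-monoʳ-≤-nonNeg (y e) {{nonNegative (y≥0 e)}} (le e)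

  dot-unitˡ : ∀ {k} e (y : Vect k) → dot (unit e) y ≡ y e
  dot-unitˡ e y = trans (dot-comm (unit e) y) (dot-unitʳ y e)

  clique-pair-≤ : ∀ {K e e' y} → (∀ e → 0ℚ ≤ y e) → e ∈ K → e' ∈ K → e ≢ e' → y e + y e' ≤ dot (incidence K) y
  clique-pair-≤ {K} {e} {e'} {y} y≥0 p p' ne = subst (_≤ dot (incidence K) y)
    (trans (dot-+ˡ (unit e) (unit e') y) (cong₂ _+_ (dot-unitˡ e y) (dot-unitˡ e' y))) (dot-mono y≥0 le)
    where
    le : ∀ j → unit e j + unit e' j ≤ incidence K j
    le j with e ≟F j | e' ≟F j
    ... | yes refl | yes refl = contradiction refl ne
    ... | yes refl | no _ = ≤-reflexive (sym (incidence-∈ p))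
    ... | no _ | yes refl = ≤-reflexive (sym (incidence-∈ p'))
    ... | no _ | no _ = 0≤incidence K j

  clique-single-≤ : ∀ {K e y} → (∀ e → 0ℚ ≤ y e) → e ∈ K → y e ≤ dot (incidence K) y
  clique-single-≤ {K} {e} {y} y≥0 p = subst (_≤ dot (incidence K) y) (dot-unitˡ e y) (dot-mono y≥0 le)
    where
    le : ∀ j → unit e j ≤ incidence K j
    le j with e ≟F j
    ... | yes refl = ≤-reflexive (sym (incidence-∈ p))
    ... | no _ = 0≤incidence K j

  1≰0 : ¬ 1ℚ ≤ 0ℚ
  1≰0 (*≤* (ℤ.+≤+ ()))

  2≰1 : ¬ 1ℚ + 1ℚ ≤ 1ℚ
  2≰1 (*≤* (ℤ.+≤+ (ℕ.s≤s ())))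

  -- Nonnegativity and the cliques covering single edges make y a 0/1 vector; a clique through two
  -- conflicting edges forbids that both be 1.
  integral⇒matchingVector : ∀ {Gs y} → Complete Gs → Integral y → All (λ g → Satisfies (ineq g) y) Gs → MatchingVector G y
  integral⇒matchingVector {Gs} {y} c int sat = M , matching⇒isMatching m , same
    where
    y≥0 : ∀ e → 0ℚ ≤ y e
    y≥0 e with find (nonnegs c e)
    ... | nonneg e , g∈ , refl = subst (0ℚ ≤_) (lem (y e))
        (neg-antimono-≤ (subst (_≤ 0ℚ) (nonnegIneq-dot e y) (All.lookup sat g∈)))
      where
      lem : ∀ a → - (- a) ≡ a
      lem = solve-∀ ℚ-ring
    covered : ∀ {e e'} → Conflict e e' → ∃[ K ] e ∈ K × e' ∈ K × dot (incidence K) y ≤ 1ℚ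
    covered {e} {e'} cf with find (pairs c e e' cf)
    ... | clq K , g∈ , p , p' = K , p , p' , All.lookup sat g∈
    y≤1 : ∀ e → y e ≤ 1ℚ
    y≤1 e with covered (conflict-refl {e})
    ... | K , p , _ , le = ≤-trans (clique-single-≤ y≥0 p) le
    M : Sub
    M e with y e ≟ 1ℚ
    ... | yes _ = true
    ... | no _ = false
    same : y ≗ᵥ incidence M
    same e with y e ≟ 1ℚ
    ... | yes p = p
    ... | no np = [ (λ z → z) , (λ p → contradiction p np) ]′ (integral-0-1 (int e) (y≥0 e) (y≤1 e))
    one : ∀ {e} → e ∈ M → y e ≡ 1ℚ
    one p = trans (same _) (incidence-∈ p)
    m : Matching M
    m .meet {e} {e'} {x} p p' ex e'x with e ≟F e'
    ... | yes eq = eq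
    ... | no ne with covered (x , ex , e'x)
    ... | K , q , q' , le = contradiction
      (subst (_≤ 1ℚ) (cong₂ _+_ (one p) (one p')) (≤-trans (clique-pair-≤ y≥0 q q' ne) le)) 2≰1

  unit-integral : ∀ {k} (e e' : Fin k) → unit e e' ≡ 0ℚ ⊎ unit e e' ≡ 1ℚ
  unit-integral e e' with e ≟F e'
  ... | yes _ = inj₂ refl
  ... | no _ = inj₁ refl

  Escapes : List Gen → Set
  Escapes R = ∃[ y ] Integral y × Polyhedron (List.map ineq R) y × ¬ MatchingPolytope G y

  escape : ∀ {Good Gs R} → All (GoodGen Good) Gs → Complete Gs → Missing R → Escapes R
  escape {Good} {Gs} {R} good c (inj₁ (e , none)) = y , int , Allₚ.map⁺ (All.tabulate sat) , out
    where
    y : Vect (nE G)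
    -- Violates only x_e ≥ 0: clique inequalities have nonnegative coefficients.
    y e' = - unit e e'
    int : Integral y
    int e' with unit-integral e e'
    ... | inj₁ eq = ℤ.+ 0 , cong -_ eq
    ... | inj₂ eq = ℤ.-[1+ 0 ] , cong -_ eq
    dot-y : ∀ f → dot f y ≡ - f e
    dot-y f = trans (dot-comm f y) (nonnegIneq-dot e f)
    sat : ∀ {g} → g ∈ˡ R → Satisfies (ineq g) y
    sat {nonneg e'} g∈ = ≤-reflexive (trans (nonnegIneq-dot e' y) (cong (λ z → - - z)
      (unit-≢ λ eq → none (lose g∈ eq))))
    sat {clq K} g∈ = subst (_≤ 1ℚ) (sym (dot-y (incidence K))) (≤-trans (-≤0 (0≤incidence K e)) 0≤1)
    out : ¬ MatchingPolytope G y
    out yP = 1≰0 (subst (_≤ 0ℚ) (trans (nonnegIneq-dot e y) (cong (λ z → - - z) (unit-refl e)))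
      (valid⇒polytope {nonnegIneq e} (nonneg-valid e) y yP))
  escape {Good} {Gs} {R} good c (inj₂ (e , e' , cf , none)) = y , int , Allₚ.map⁺ (All.tabulate sat) , out
    where
    y : Vect (nE G)
    -- Violates only cliques containing both e and e'. For e = e' this is twice a unit vector, which
    -- treats an edge lying in no clique in the same way.
    y j = unit e j + unit e' j
    int : Integral y
    int j with unit-integral e j | unit-integral e' j
    ... | inj₁ p | inj₁ q = ℤ.+ 0 , cong₂ _+_ p q
    ... | inj₁ p | inj₂ q = ℤ.+ 1 , cong₂ _+_ p q
    ... | inj₂ p | inj₁ q = ℤ.+ 1 , cong₂ _+_ p q
    ... | inj₂ p | inj₂ q = ℤ.+ 2 , cong₂ _+_ p q
    dot-y : ∀ f → dot f y ≡ f e + f e'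
    dot-y f = trans (dot-+ʳ f (unit e) (unit e')) (cong₂ _+_ (dot-unitʳ f e) (dot-unitʳ f e'))
    0≤unit : ∀ (a j : E) → 0ℚ ≤ unit a j
    0≤unit a j with unit-integral a j
    ... | inj₁ p = ≤-reflexive (sym p)
    ... | inj₂ p = subst (0ℚ ≤_) (sym p) 0≤1
    sat : ∀ {g} → g ∈ˡ R → Satisfies (ineq g) y
    sat {nonneg j} g∈ = subst (_≤ 0ℚ) (sym (nonnegIneq-dot j y)) (-≤0 (+-mono-≤ (0≤unit e j) (0≤unit e' j)))
    sat {clq K} g∈ = subst (_≤ 1ℚ) (sym (dot-y (incidence K))) (bound (e ∈? K) (e' ∈? K))
      where
      bound : Dec (e ∈ K) → Dec (e' ∈ K) → incidence K e + incidence K e' ≤ 1ℚ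
      bound (yes p) (yes q) = contradiction (lose g∈ (p , q)) none
      bound (yes p) (no q) = ≤-reflexive (cong₂ _+_ (incidence-∈ p) (incidence-∉ q))
      bound (no p) (yes q) = ≤-reflexive (cong₂ _+_ (incidence-∉ p) (incidence-∈ q))
      bound (no p) (no q) = subst (_≤ 1ℚ) (sym (cong₂ _+_ (incidence-∉ p) (incidence-∉ q))) 0≤1
    out : ¬ MatchingPolytope G y
    out yP with find (pairs c e e' cf)
    ... | clq K , g∈ , p , q with All.lookup good g∈
    ... | mc , _ = 2≰1 (subst (_≤ 1ℚ) (trans (dot-y (incidence K)) (cong₂ _+_ (incidence-∈ p) (incidence-∈ q)))
      (valid⇒polytope {cliqueIneq K} (clique-valid (clique mc)) y yP))

  minimal-formulation : ∀ {Good Gs} → E → All (GoodGen Good) Gs → Complete Gs →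
    (∀ i → ¬ Complete (List.removeAt Gs i)) → MinimalFormulation G (List.map ineq Gs)
  minimal-formulation {Good} {Gs} e₀ good c min =
    Allₚ.map⁺ (All.map (λ {g} → gen-facet {Good} e₀ g) good) ,
    (λ x → conv-map {S = MatchingVector G} {T = λ y → Integral y × Polyhedron (List.map ineq Gs) y} (λ y yM → matchingVector⇒integral {y} yM , poly {y = y} good yM) x ,
           conv-map {S = λ y → Integral y × Polyhedron (List.map ineq Gs) y} {T = MatchingVector G} (λ y yI → integral⇒matchingVector {y = y} c (proj₁ yI) (Allₚ.map⁻ (proj₂ yI))) x) ,
    irredundant
    where
    poly : ∀ {Hs y} → All (GoodGen Good) Hs → MatchingVector G y → Polyhedron (List.map ineq Hs) y
    poly gs yM = Allₚ.map⁺ (All.map (λ {g} p → matchingVector⇒satisfies {ineq g} (gen-valid {Good} g p) yM) gs)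
    irredundant : ∀ i → (∀ y → Integral y → MatchingPolytope G y → Polyhedron (List.removeAt (List.map ineq Gs) i) y) ×
      (∃[ y ] Integral y × Polyhedron (List.removeAt (List.map ineq Gs) i) y × ¬ MatchingPolytope G y)
    irredundant i with removeAt-map ineq Gs i
    ... | j , eq rewrite eq =
      (λ y _ yP → Allₚ.map⁺ (All.map (λ {g} p → valid⇒polytope {ineq g} (gen-valid {Good} g p) y yP) (All-removeAt good j))) ,
      [ (λ cj → contradiction cj (min j)) , escape good c ]′ (complete⊎missing (List.removeAt Gs j))

  PairCover : (Sub → Set) → Set
  PairCover Good = ∀ e e' → Conflict e e' → ∃[ K ] MaxClique K × Good K × e ∈ K × e' ∈ K

  record Formulation (Good : Sub → Set) : Set where
    field
      gens : List Gen
      allGood : All (GoodGen Good) gens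
      isComplete : Complete gens
      isMinimal : MinimalFormulation G (List.map ineq gens)

  formulation : ∀ {Good} → E → PairCover Good → Formulation Good
  formulation {Good} e₀ cover = build (prune {P = GoodGen Good} complete? _ gens₀ refl good₀ complete₀)
    where
    pick : ∀ p → ∃[ g ] GoodGen Good g × (Conflict (proj₁ p) (proj₂ p) → HasPair (proj₁ p) (proj₂ p) g)
    pick (e , e') with conflict? e e'
    ... | yes cf = let K , mc , gd , p , q = cover e e' cf in clq K , (mc , gd) , λ _ → p , q
    -- A pair without conflict needs no clique; `nonneg e` is a filler that is good in any case.
    ... | no ncf = nonneg e , tt , λ cf → ncf cf
    edges = List.allFin (nE G)
    left = List.map nonneg edges
    allPairs = List.cartesianProduct edges edges
    right = List.map (λ p → proj₁ (pick p)) allPairs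
    gens₀ = left List.++ right
    good₀ : All (GoodGen Good) gens₀
    good₀ = Allₚ.++⁺ {xs = left} (Allₚ.map⁺ (All.tabulate {xs = edges} λ _ → tt))
      (Allₚ.map⁺ (All.tabulate {xs = allPairs} λ {p} _ → proj₁ (proj₂ (pick p))))
    complete₀ : Complete gens₀
    complete₀ = complete
      (λ e → Anyₚ.++⁺ˡ (Anyₚ.map⁺ (lose (∈-allFin e) refl)))
      (λ e e' cf → Anyₚ.++⁺ʳ left (Anyₚ.map⁺ (lose {P = λ p → HasPair e e' (proj₁ (pick p))}
        (∈-cartesianProduct⁺ (∈-allFin e) (∈-allFin e')) (proj₂ (proj₂ (pick (e , e'))) cf))))
    build : ∃[ L ] All (GoodGen Good) L × Complete L × (∀ i → ¬ Complete (List.removeAt L i)) → Formulation Good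
    build (L , good , c , min) = record
      { gens = L ; allGood = good ; isComplete = c ; isMinimal = minimal-formulation {Good} e₀ good c min }

  -- Completeness asks for every x_e ≥ 0, so none of them is lost in pruning.
  nonneg-InF₀ : ∀ {Good} → Formulation Good → ∀ e → InF₀ G (nonnegIneq e)
  nonneg-InF₀ F e = List.map ineq gens , isMinimal , Anyₚ.map⁺ (Any.map (λ {g} → same {g}) (nonnegs isComplete e))
    where
    open Formulation F
    same : ∀ {g} → IsNonneg e g → SameIneq (nonnegIneq e) (ineq g)
    same {nonneg _} refl = (λ _ → refl) , refl

  clique-InF₀ : ∀ {Good} → Formulation Good → ∀ {e e'} → Conflict e e' →
    ∃[ K ] MaxClique K × Good K × e ∈ K × e' ∈ K × InF₀ G (cliqueIneq K)
  clique-InF₀ F {e} {e'} cf with find (pairs (Formulation.isComplete F) e e' cf)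
  ... | clq K , g∈ , p , q with All.lookup (Formulation.allGood F) g∈
  ... | mc , gd = K , mc , gd , p , q ,
    List.map ineq (Formulation.gens F) , Formulation.isMinimal F , Anyₚ.map⁺ (lose g∈ ((λ _ → refl) , refl))

  InF₀-resp : ∀ {K K'} → (∀ e → K e ≡ K' e) → InF₀ G (cliqueIneq K) → InF₀ G (cliqueIneq K')
  InF₀-resp same (L , min , a) = L , min , Any.map (λ (p , q) → (λ e → trans (incidence-cong (sym ∘ same) e) (p e)) , q) a

  -- Greedy extension. An edge is rejected because of a member of the current clique, and that
  -- member stays in all later cliques.
  extend-clique : ∀ (es : List E) {K} → Clique K →
    ∃[ K' ] Clique K' × (∀ {e} → e ∈ K → e ∈ K') × (∀ {e} → e ∈ˡ es → ¬ e ∈ K' → ∃[ e' ] e' ∈ K' × ¬ Conflict e e')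
  extend-clique [] {K} c = K , c , (λ p → p) , λ ()
  extend-clique (e ∷ es) {K} c with any? (λ e' → (e' ∈? K) ×-dec ¬? (conflict? e e'))
  ... | yes (e' , e'K , nc) = let K' , c' , sub , mx = extend-clique es c in
    K' , c' , sub , λ { (here refl) _ → e' , sub e'K , nc ; (there p) → mx p }
  ... | no none = let K' , c' , sub , mx = extend-clique es c₁ in
    K' , c' , (λ p → sub (add-⊇ p)) , λ { (here refl) ne → contradiction (sub add-self) ne ; (there p) → mx p }
    where
    conf : ∀ {e'} → e' ∈ K → Conflict e e'
    conf {e'} p = decidable-stable (conflict? e e') λ nc → none (e' , p , nc)
    c₁ : Clique (add e K)
    c₁ p q with add-inv p | add-inv q
    ... | inj₁ refl | inj₁ refl = conflict-refl
    ... | inj₁ refl | inj₂ q' = conf q'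
    ... | inj₂ p' | inj₁ refl = conflict-sym (conf p')
    ... | inj₂ p' | inj₂ q' = c p' q'

  maxClique-containing : ∀ {e e'} → Conflict e e' → ∃[ K ] MaxClique K × e ∈ K × e' ∈ K
  maxClique-containing {e} {e'} cf = let K , c , sub , mx = extend-clique (List.allFin (nE G)) c₀ in
    K , record { clique = c ; maximal = mx (∈-allFin _) } , sub (add-self) , sub (add-⊇ add-self)
    where
    c₀ : Clique (add e (single e'))
    c₀ p q with add-inv p | add-inv q
    ... | inj₁ refl | inj₁ refl = conflict-refl
    ... | inj₁ refl | inj₂ q' rewrite ∈-single q' = cf
    ... | inj₂ p' | inj₁ refl rewrite ∈-single p' = conflict-sym cf
    ... | inj₂ p' | inj₂ q' rewrite ∈-single p' | ∈-single q' = conflict-refl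

  standardFormulation : E → Formulation (λ _ → ⊤)
  standardFormulation e₀ = formulation e₀ λ e e' cf →
    let K , mc , p , q = maxClique-containing cf in K , mc , tt , p , q

  opaque
    star : V → Sub
    star v e = does (e ∋? v)

    ∈-star : ∀ {v e} → e ∋ v → e ∈ star v
    ∈-star {v} {e} p = mem (dec-true (e ∋? v) p)

    star-∋ : ∀ {v e} → e ∈ star v → e ∋ v
    star-∋ {v} {e} (mem p) = witness (e ∋? v) p
      where
      witness : ∀ {A : Set} (d : Dec A) → does d ≡ true → A
      witness (yes a) _ = a

  star-clique : ∀ {v} → Clique (star v)
  star-clique p q = _ , star-∋ p , star-∋ q

  -- The only maximal cliques containing both ea = va and eb = vb are star v and, if ab is an edge, the triangle
  -- vab.  The hypothesis allows the triangle to be left out: its other two conflicts are covered by star a and star b.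
  star-InF₀ : ∀ {v a b ea eb} → MaxClique (star v) → ea ∋ v → ea ∋ a → eb ∋ v → eb ∋ b →
    a ≢ v → b ≢ v → a ≢ b →
    (∀ {e} → ¬ e ∋ v → e ∋ a → e ∋ b → MaxClique (star a) × MaxClique (star b)) →
    InF₀ G (cliqueIneq (star v))
  star-InF₀ {v} {a} {b} {ea} {eb} maxv eav eaa ebv ebb a≢v b≢v a≢b closing =
    let K , _ , good , p , q , inF₀ = clique-InF₀ (formulation ea cover) (v , eav , ebv) in
    InF₀-resp (λ e → sym (good p q e)) inF₀
    where
    Good : Sub → Set
    Good K = ea ∈ K → eb ∈ K → ∀ e → star v e ≡ K e
    good-a : Good (star a)
    good-a _ eb∈ = contradiction (star-∋ eb∈) (no-third-end ebv ebb (b≢v ∘ sym) a≢v a≢b)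
    good-b : Good (star b)
    good-b ea∈ _ = contradiction (star-∋ ea∈) (no-third-end eav eaa (a≢v ∘ sym) b≢v (a≢b ∘ sym))
    end : ∀ {e w ew} → ew ∋ v → ew ∋ w → w ≢ v → ¬ e ∋ v → Conflict e ew → e ∋ w
    end {e} ewv eww w≢v n (x , ex , ewx) with two-ends ewv eww (w≢v ∘ sym) ewx
    ... | inj₁ refl = contradiction ex n
    ... | inj₂ refl = ex
    Result : E → E → Set
    Result e e' = ∃[ K ] MaxClique K × Good K × e ∈ K × e' ∈ K
    -- A clique through an edge that avoids v contains `ea` only if the edge ends in a, and `eb`
    -- only if it ends in b. So any maximal clique is good unless the edge is ab, where the star at
    -- the shared end serves.
    off : ∀ {e e'} → ¬ e ∋ v → Conflict e e' → Result e e'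
    off {e} {e'} n cf@(x , ex , e'x) with e ∋? a | e ∋? b
    ... | yes pa | yes pb = case two-ends pa pb a≢b ex of λ
      { (inj₁ refl) → star a , proj₁ (closing n pa pb) , good-a , ∈-star ex , ∈-star e'x
      ; (inj₂ refl) → star b , proj₂ (closing n pa pb) , good-b , ∈-star ex , ∈-star e'x }
    ... | no na | _ = let K , mc , p , q = maxClique-containing cf in
      K , mc , (λ ea∈ _ → contradiction (end eav eaa a≢v n (clique mc p ea∈)) na) , p , q
    ... | yes _ | no nb = let K , mc , p , q = maxClique-containing cf in
      K , mc , (λ _ eb∈ → contradiction (end ebv ebb b≢v n (clique mc p eb∈)) nb) , p , q
    cover : PairCover Good
    cover e e' cf with e ∋? v | e' ∋? v
    ... | yes p | yes q = star v , maxv , (λ _ _ _ → refl) , ∈-star p , ∈-star q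
    ... | no n | _ = off n cf
    ... | yes _ | no n = let K , mc , gd , p , q = off n (conflict-sym cf) in K , mc , gd , q , p

  -- Facets adjacent to a generator for elementary reasons.

  facet-valid : ∀ {i} → FacetDefining G i → Valid i
  facet-valid {i} (v , _) = polytope⇒valid {i} v

  wt-+ : ∀ f g M → wt (λ e → f e + g e) M ≡ wt f M + wt g M
  wt-+ f g M = dot-+ˡ f g (incidence M)

  wt-* : ∀ c f M → wt (λ e → c * f e) M ≡ c * wt f M
  wt-* c f M = dot-*ˡ c f (incidence M)

  wt-unit : ∀ e M → wt (unit e) M ≡ incidence M e
  wt-unit e M = dot-unitˡ e (incidence M)

  -- Once β = 0, the relation says that α annihilates the nonzero functional of a facet.
  independent-intro : ∀ {i h} → FacetDefining G i →
    (∀ α β → (∀ e → α * proj₁ i e + β * proj₁ h e ≡ 0ℚ) → α * proj₂ i + β * proj₂ h ≡ 0ℚ → β ≡ 0ℚ) → Independent i h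
  independent-intro {i} {h} facet β-zero α β eqs eq₀ = x≢0∧xy≡0⇒y≡0 nz (trans (*-comm (hyper i j) α) (prod j)) , β≡0
    where
    β≡0 : β ≡ 0ℚ
    β≡0 = β-zero α β eqs eq₀
    j = proj₁ (facet⇒nonzero facet)
    nz = proj₂ (facet⇒nonzero facet)
    drop : ∀ a b → a + β * b ≡ 0ℚ → a ≡ 0ℚ
    drop a b eq = trans (lem a b) (trans (cong (λ z → (a + β * b) - z * b) β≡0) (trans (cong (_- 0ℚ * b) eq) (lem' b)))
      where
      lem : ∀ a b → a ≡ (a + β * b) - β * b
      lem a b = lem₀ a β b
        where
        lem₀ : ∀ a β b → a ≡ (a + β * b) - β * b
        lem₀ = solve-∀ ℚ-ring
      lem' : ∀ b → 0ℚ - 0ℚ * b ≡ 0ℚ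
      lem' = solve-∀ ℚ-ring
    prod : ∀ j → α * hyper i j ≡ 0ℚ
    prod zero = trans (sym (neg-distribʳ-* α (proj₂ i))) (cong -_ (drop (α * proj₂ i) (proj₂ h) eq₀))
    prod (suc e) = drop (α * proj₁ i e) (proj₁ h e) (eqs e)

  -- Deleting an edge of coefficient 0 keeps a matching tight.
  zero-coefficient : ∀ {i} → FacetDefining G i → ∀ e → proj₁ i e ≡ 0ℚ → Adjacent i (nonnegIneq e)
  zero-coefficient {i@(f , f₀)} facet e fe = adjacent-intro i (nonnegIneq e) e
    (independent-intro {i} {nonnegIneq e} facet λ α β eqs _ → neg-injective (trans
      (trans (lem₁ α β) (cong₂ (λ x y → α * x + β * - y) (sym fe) (sym (unit-refl e)))) (eqs e)))
    unique
    where
    lem₁ : ∀ α β → - β ≡ α * 0ℚ + β * - 1ℚ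
    lem₁ = solve-∀ ℚ-ring
    unique : ∀ g → (∀ {M} → Tight i M → Tight (nonnegIneq e) M → wt (proj₁ g) M ≡ proj₂ g) → Combination i (nonnegIneq e) g
    unique (g , g₀) const = finish (facet-unique facet (g' , g₀) const')
      where
      g' : Vect (nE G)
      -- Erasing the e-coordinate of g makes its weight insensitive to the deletion of e.
      g' j = g j + (- g e) * unit e j
      wt-g' : ∀ M → wt g' M ≡ wt g M + (- g e) * incidence M e
      wt-g' M = trans (wt-+ g (λ j → (- g e) * unit e j) M)
        (cong (wt g M +_) (trans (wt-* (- g e) (unit e) M) (cong (- g e *_) (wt-unit e M))))
      const' : ConstantOnTight i (g' , g₀)
      const' {M} t with e ∈? M
      ... | no ne = trans (wt-g' M) (trans (cong (λ z → wt g M + (- g e) * z) (incidence-∉ ne))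
          (trans (lem (wt g M) (g e)) (const t (nonneg-tight (matching t) ne))))
        where
        lem : ∀ a b → a + (- b) * 0ℚ ≡ a
        lem = solve-∀ ℚ-ring
      ... | yes p = trans (wt-g' M) (trans (cong₂ (λ y z → y + (- g e) * z) (wt-del g p) (incidence-∈ p))
          (trans (lem (wt g (del e M)) (g e)) (const t' (nonneg-tight (matching t') del-self))))
        where
        lem : ∀ a b → (a + b) + (- b) * 1ℚ ≡ a
        lem = solve-∀ ℚ-ring
        t' : Tight i (del e M)
        t' = tight (matching-del (matching t)) (trans (trans (sym (+-identityʳ _)) (trans (cong (wt f (del e M) +_) (sym fe)) (sym (wt-del f p)))) (attains t))
      finish : Multiple i (g' , g₀) → Combination i (nonnegIneq e) (g , g₀)
      finish (t , eq , eq₀) = t , - g e ,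
        (λ j → trans (lem (g j) (g e) (unit e j)) (cong (_+ (- g e) * - unit e j) (eq j))) ,
        trans eq₀ (lem' (t * f₀) (g e))
        where
        lem : ∀ a b u → a ≡ (a + (- b) * u) + (- b) * - u
        lem = solve-∀ ℚ-ring
        lem' : ∀ a b → a ≡ a + (- b) * 0ℚ
        lem' = solve-∀ ℚ-ring

  all-equal⇒1 : ∀ {n} (e : Fin n) → (∀ j → j ≡ e) → 1 ≡ n
  all-equal⇒1 {suc zero} e eq = refl
  all-equal⇒1 {suc (suc n)} e eq = case trans (eq zero) (sym (eq (suc zero))) of λ ()

  p<p+q : ∀ {p q} → 0ℚ < q → p < p + q
  p<p+q {p} {q} 0<q = subst (_< p + q) (+-identityʳ p) (+-monoʳ-< p 0<q)

  -- A negative coefficient puts the face inside x_e = 0, so that e is the only edge.  The polytope is then a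
  -- segment, and the empty intersection of its two facets has dimension -1 = |E| - 2.
  negative-coefficient : ∀ {i} → FacetDefining G i → (∀ j → proj₁ i j ≢ 0ℚ) → ∀ e → proj₁ i e < 0ℚ →
    ∃[ K ] InF₀ G (cliqueIneq K) × Adjacent i (cliqueIneq K)
  negative-coefficient {i@(f , f₀)} facet nz e neg =
    let K , _ , _ , _ , _ , inF₀ = clique-InF₀ (standardFormulation e) (conflict-refl {e}) in
    K , inF₀ , 0 , (((λ ()) , (λ ()) , tt) , λ p both _ → disjoint K (both zero)) , all-equal⇒1 e only
    where
    -- Deleting e from a tight matching would raise the weight above f₀.
    avoids : ∀ {M} → Tight i M → ¬ e ∈ M
    avoids {M} t p = <⇒≱ (subst (_< wt f (del e M)) (trans (sym (wt-del f p)) (attains t)) less)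
      (facet-valid {i} facet (matching-del (matching t)))
      where
      less : wt f (del e M) + f e < wt f (del e M)
      less = subst (wt f (del e M) + f e <_) (+-identityʳ _) (+-monoʳ-< (wt f (del e M)) neg)
      <⇒≱ : ∀ {p q} → p < q → ¬ q ≤ p
      <⇒≱ p<q q≤p = <-irrefl refl (<-≤-trans p<q q≤p)
    mult : Multiple i (unit e , 0ℚ)
    mult = facet-unique facet (unit e , 0ℚ) λ {M} t → trans (wt-unit e M) (incidence-∉ (avoids t))
    t = proj₁ mult
    t≢0 : t ≢ 0ℚ
    t≢0 z = case trans (sym (unit-refl e)) (trans (proj₁ (proj₂ mult) e) (trans (cong (_* f e) z) (*-zeroˡ (f e)))) of λ ()
    only : ∀ j → j ≡ e
    only j with e ≟F j
    ... | yes eq = sym eq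
    ... | no ne = contradiction (x≢0∧xy≡0⇒y≡0 t≢0 (trans (sym (proj₁ (proj₂ mult) j)) (unit-≢ ne))) (nz j)
    f₀≡0 : f₀ ≡ 0ℚ
    f₀≡0 = x≢0∧xy≡0⇒y≡0 t≢0 (sym (proj₂ (proj₂ mult)))
    dot-e : ∀ g x → dot g x ≡ g e * x e
    dot-e g x = sumF-single (λ j → g j * x j) e λ j ne → contradiction (sym (only j)) ne
    disjoint : ∀ K {x} → Face G i x × Face G (cliqueIneq K) x → ⊥
    disjoint K {x} ((_ , fx) , (_ , kx)) = case trans (sym kx) (trans (dot-e (incidence K) x)
        (trans (cong (incidence K e *_) xe) (*-zeroʳ (incidence K e)))) of λ ()
      where
      xe : x e ≡ 0ℚ
      xe = x≢0∧xy≡0⇒y≡0 (nz e) (trans (sym (dot-e f x)) (trans fx f₀≡0))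

  -- If every tight matching meets the clique S, then S is the whole edge set, and the face is a simplex.
  clique-case : ∀ {i} → FacetDefining G i → (∀ j → proj₁ i j ≢ 0ℚ) → ∀ {S} → Clique S →
    (∀ {M} → Tight i M → ∃[ e ] e ∈ S × e ∈ M) → ∀ e → Adjacent i (nonnegIneq e)
  clique-case {i@(f , f₀)} facet nz {S} cl meets e = adjacent-intro i (nonnegIneq e) e
    (independent-intro {i} {nonnegIneq e} facet β-zero) unique
    where
    mult : Multiple i (cliqueIneq S)
    mult = facet-unique facet (cliqueIneq S) λ t → let e' , p , q = meets t in clique-meets cl (matching t) p q
    t = proj₁ mult
    t≢0 : t ≢ 0ℚ
    t≢0 z = case trans (proj₂ (proj₂ mult)) (trans (cong (_* f₀) z) (*-zeroˡ f₀)) of λ ()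
    all∈ : ∀ j → j ∈ S
    all∈ j = decidable-stable (j ∈? S) λ ne →
      nz j (x≢0∧xy≡0⇒y≡0 t≢0 (trans (sym (proj₁ (proj₂ mult) j)) (incidence-∉ ne)))
    tf : ∀ j → 1ℚ ≡ t * f j
    tf j = trans (sym (incidence-∈ (all∈ j))) (proj₁ (proj₂ mult) j)
    f≡f₀ : ∀ j → f j ≡ f₀
    f≡f₀ j = x-y≡0⇒x≡y _ _ (x≢0∧xy≡0⇒y≡0 t≢0 (trans (lem t (f j) f₀)
      (trans (cong₂ _-_ (sym (tf j)) (sym (proj₂ (proj₂ mult)))) (+-inverseʳ 1ℚ))))
      where
      lem : ∀ t a b → t * (a - b) ≡ t * a - t * b
      lem = solve-∀ ℚ-ring
    tight-single : ∀ j → Tight i (single j)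
    tight-single j = tight matching-single (trans (wt-single f j) (f≡f₀ j))
    β-zero : ∀ α β → (∀ j → α * f j + β * - unit e j ≡ 0ℚ) → α * f₀ + β * 0ℚ ≡ 0ℚ → β ≡ 0ℚ
    β-zero α β eqs eq₀ = neg-injective (trans (trans (lem α (f e) β) (cong₂ (λ x y → (α * f e + β * - x) - y) (sym (unit-refl e)) αf))
      (trans (cong (_- 0ℚ) (eqs e)) refl))
      where
      lem : ∀ α a β → - β ≡ (α * a + β * - 1ℚ) - α * a
      lem = solve-∀ ℚ-ring
      lem' : ∀ a β → a ≡ a + β * 0ℚ
      lem' = solve-∀ ℚ-ring
      αf : α * f e ≡ 0ℚ
      αf = trans (cong (α *_) (f≡f₀ e)) (trans (lem' (α * f₀) β) eq₀)
    unique : ∀ g → (∀ {M} → Tight i M → Tight (nonnegIneq e) M → wt (proj₁ g) M ≡ proj₂ g) → Combination i (nonnegIneq e) g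
    -- The tight single edges other than e give g the value g₀ = g₀ t f_j there; the discrepancy at
    -- e is absorbed by x_e ≥ 0.
    unique (g , g₀) const = g₀ * t , g₀ - g e , eq , trans (lem₀ g₀) (trans (cong (g₀ *_) (proj₂ (proj₂ mult))) (lem₁ g₀ t f₀ (g e)))
      where
      lem₀ : ∀ a → a ≡ a * 1ℚ
      lem₀ = solve-∀ ℚ-ring
      lem₁ : ∀ g t f b → g * (t * f) ≡ (g * t) * f + (g - b) * 0ℚ
      lem₁ = solve-∀ ℚ-ring
      lem₂ : ∀ g t f b → g * (t * f) ≡ (g * t) * f + (g - b) * - 0ℚ
      lem₂ = solve-∀ ℚ-ring
      lem₃ : ∀ g b → b ≡ g * 1ℚ + (g - b) * - 1ℚ
      lem₃ = solve-∀ ℚ-ring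
      eq : ∀ j → g j ≡ (g₀ * t) * f j + (g₀ - g e) * - unit e j
      eq j = case e ≟F j of λ
        { (no ne) → trans (sym (wt-single g j)) (trans (const (tight-single j) (nonneg-tight matching-single (ne ∘ ∈-single)))
            (trans (trans (lem₀ g₀) (cong (g₀ *_) (tf j))) (trans (lem₂ g₀ t (f j) (g e))
              (cong (λ z → (g₀ * t) * f j + (g₀ - g e) * - z) (sym (unit-≢ ne))))))
        ; (yes refl) → trans (lem₃ g₀ (g e)) (cong₂ _+_ (trans (cong (g₀ *_) (tf e)) (sym (*-assoc g₀ t (f e))))
            (cong (λ z → (g₀ - g e) * - z) (sym (unit-refl e)))) }

  -- Gallai's argument

  -- Weights are rational while the parity argument counts in ℕ; this embedding carries the counts
  -- across.
  fromℕ : ℕ → ℚ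
  fromℕ zero = 0ℚ
  fromℕ (suc n) = 1ℚ + fromℕ n

  fromℕ-+ : ∀ m n → fromℕ (m ℕ.+ n) ≡ fromℕ m + fromℕ n
  fromℕ-+ zero n = sym (+-identityˡ (fromℕ n))
  fromℕ-+ (suc m) n = trans (cong (1ℚ +_) (fromℕ-+ m n)) (sym (+-assoc 1ℚ (fromℕ m) (fromℕ n)))

  0≤fromℕ : ∀ n → 0ℚ ≤ fromℕ n
  0≤fromℕ zero = ≤-refl
  0≤fromℕ (suc n) = +-mono-≤ 0≤1 (0≤fromℕ n)

  0≢1+fromℕ : ∀ n → 0ℚ ≢ 1ℚ + fromℕ n
  0≢1+fromℕ n eq = 1≰0 (subst (1ℚ ≤_) (sym eq) (subst (_≤ 1ℚ + fromℕ n) (+-identityʳ 1ℚ) (+-monoʳ-≤ 1ℚ (0≤fromℕ n))))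

  fromℕ-injective : ∀ m n → fromℕ m ≡ fromℕ n → m ≡ n
  fromℕ-injective zero zero eq = refl
  fromℕ-injective zero (suc n) eq = contradiction eq (0≢1+fromℕ n)
  fromℕ-injective (suc m) zero eq = contradiction (sym eq) (0≢1+fromℕ m)
  fromℕ-injective (suc m) (suc n) eq = cong suc (fromℕ-injective m n
    (trans (lem (fromℕ m)) (trans (cong (_- 1ℚ) eq) (sym (lem (fromℕ n))))))
    where
    lem : ∀ a → a ≡ (1ℚ + a) - 1ℚ
    lem = solve-∀ ℚ-ring

  halve : ∀ a b {m n} → m ℕ.≤ 1 → n ℕ.≤ 1 → (a ℕ.+ a) ℕ.+ m ≡ (b ℕ.+ b) ℕ.+ n → a ≡ b
  halve zero zero _ _ _ = refl
  halve zero (suc b) le _ refl rewrite ℕₚ.+-suc b b = case le of λ { (ℕ.s≤s ()) }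
  halve (suc a) zero _ le refl rewrite ℕₚ.+-suc a a = case le of λ { (ℕ.s≤s ()) }
  halve (suc a) (suc b) l l' eq rewrite ℕₚ.+-suc a a | ℕₚ.+-suc b b =
    cong suc (halve a b l l' (ℕₚ.suc-injective (ℕₚ.suc-injective eq)))

  indicator : Bool → ℚ
  indicator true = 1ℚ
  indicator false = 0ℚ

  wt-size : ∀ S M → wt (incidence S) M ≡ fromℕ (size (λ e → S e ∧ M e))
  wt-size S M = go S M
    where
    go : ∀ {k} (S M : Fin k → Bool) → dot (incidence S) (incidence M) ≡ fromℕ (size (λ e → S e ∧ M e))
    go {zero} S M = refl
    go {suc k} S M with S zero | M zero
    ... | true | true = cong (1ℚ +_) (go (S ∘ suc) (M ∘ suc))
    ... | true | false = trans (+-identityˡ _) (go (S ∘ suc) (M ∘ suc))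
    ... | false | true = trans (+-identityˡ _) (go (S ∘ suc) (M ∘ suc))
    ... | false | false = trans (+-identityˡ _) (go (S ∘ suc) (M ∘ suc))

  module _ (C : V → Bool) where

    -- Testing one end suffices, since only vertex sets with `Closed` are considered.
    inside : Sub
    inside e = C (proj₁ (ends G e))

    Closed : Set
    Closed = ∀ e → C (proj₁ (ends G e)) ≡ C (proj₂ (ends G e))

    -- Double counting: the incidence of an edge with all stars is the sum of the unit vectors at
    -- its two ends, and both ends of an edge lie on the same side of `C`.
    degree-sum : Closed → ∀ M → sumF (λ x → indicator (C x) * wt (incidence (star x)) M) ≡
      wt (incidence inside) M + wt (incidence inside) M
    degree-sum closed M = begin
      sumF (λ x → indicator (C x) * wt (incidence (star x)) M)
        ≡⟨ sumF-cong (λ x → cong (indicator (C x) *_) (dot-comm (incidence (star x)) (incidence M))) ⟩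
      sumF (λ x → indicator (C x) * dot (incidence M) (incidence (star x)))
        ≡⟨ dot-lincomb (incidence M) (λ x → indicator (C x)) (λ x → incidence (star x)) ⟨
      dot (incidence M) (lincomb (λ x → indicator (C x)) (λ x → incidence (star x)))
        ≡⟨ dot-comm (incidence M) _ ⟩
      wt (lincomb (λ x → indicator (C x)) (λ x → incidence (star x))) M
        ≡⟨ dot-congˡ twice (incidence M) ⟩
      wt (λ e → incidence inside e + incidence inside e) M
        ≡⟨ wt-+ (incidence inside) (incidence inside) M ⟩
      wt (incidence inside) M + wt (incidence inside) M ∎
      where
      open ≡-Reasoning
      incidence-inside : ∀ e → indicator (C (proj₁ (ends G e))) ≡ incidence inside e
      incidence-inside e with C (proj₁ (ends G e))
      ... | true = refl
      ... | false = refl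
      star-unit : ∀ e x → incidence (star x) e ≡ unit (proj₁ (ends G e)) x + unit (proj₂ (ends G e)) x
      star-unit e x with e ∋? x
      ... | no n = trans (incidence-∉ (n ∘ star-∋)) (sym (cong₂ _+_ (unit-≢ (n ∘ inj₁ ∘ sym)) (unit-≢ (n ∘ inj₂ ∘ sym))))
      ... | yes p@(inj₁ refl) = trans (incidence-∈ (∈-star p)) (sym (cong₂ _+_ (unit-refl (proj₁ (ends G e))) (unit-≢ (loopless G e ∘ sym))))
      ... | yes p@(inj₂ refl) = trans (incidence-∈ (∈-star p)) (sym (cong₂ _+_ (unit-≢ (loopless G e)) (unit-refl (proj₂ (ends G e)))))
      twice : ∀ e → lincomb (λ x → indicator (C x)) (λ x → incidence (star x)) e ≡ incidence inside e + incidence inside e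
      twice e = trans (sumF-cong λ x → cong (indicator (C x) *_) (star-unit e x))
        (trans (dot-+ʳ (λ x → indicator (C x)) (unit (proj₁ (ends G e))) (unit (proj₂ (ends G e))))
          (cong₂ _+_ (trans (dot-unitʳ (indicator ∘ C) (proj₁ (ends G e))) (incidence-inside e))
            (trans (dot-unitʳ (indicator ∘ C) (proj₂ (ends G e))) (trans (cong indicator (sym (closed e))) (incidence-inside e)))))

    wt-star-covered : ∀ {M x} → Matching M → Covers M x → wt (incidence (star x)) M ≡ 1ℚ
    wt-star-covered m (e , p , q) = clique-meets star-clique m (∈-star q) p

    wt-star-missed : ∀ {M x} → Misses M x → wt (incidence (star x)) M ≡ 0ℚ
    wt-star-missed mi = clique-avoids λ e p q → mi (e , q , star-∋ p)

    -- 2 |M ∩ E(C)| + #(missed vertices of C) = |C|, so the parity of |C| determines |M ∩ E(C)|.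
    missed-count : Closed → ∀ {M} → Matching M →
      (∀ {x y} → C x ≡ true → C y ≡ true → Misses M x → Misses M y → x ≡ y) →
      ∃[ m ] m ℕ.≤ 1 × sumF (λ x → indicator (C x)) ≡ (wt (incidence inside) M + wt (incidence inside) M) + fromℕ m
    missed-count closed {M} mM atMostOne = finish (any? λ x → (C x ≟B true) ×-dec ¬? (covers? M x))
      where
      W = wt (incidence inside) M
      term : V → ℚ
      term x = indicator (C x) * (1ℚ - wt (incidence (star x)) M)
      total : sumF (λ x → indicator (C x)) ≡ (W + W) + sumF term
      total = begin
        sumF (λ x → indicator (C x))
          ≡⟨ sumF-cong (λ x → lem (indicator (C x)) (wt (incidence (star x)) M)) ⟩
        sumF (λ x → indicator (C x) * wt (incidence (star x)) M + term x)
          ≡⟨ sumF-+ (λ x → indicator (C x) * wt (incidence (star x)) M) term ⟩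
        sumF (λ x → indicator (C x) * wt (incidence (star x)) M) + sumF term
          ≡⟨ cong (_+ sumF term) (degree-sum closed M) ⟩
        (W + W) + sumF term ∎
        where
        open ≡-Reasoning
        lem : ∀ c d → c ≡ c * d + c * (1ℚ - d)
        lem = solve-∀ ℚ-ring
      covered-term : ∀ {x} → Covers M x → term x ≡ 0ℚ
      covered-term {x} cv = trans (cong (λ z → indicator (C x) * (1ℚ - z)) (wt-star-covered mM cv)) (*-zeroʳ (indicator (C x)))
      finish : Dec (∃[ x ] C x ≡ true × ¬ Covers M x) →
        ∃[ m ] m ℕ.≤ 1 × sumF (λ x → indicator (C x)) ≡ (W + W) + fromℕ m
      finish (no none) = 0 , ℕ.z≤n , trans total (cong ((W + W) +_) (sumF-zero zeros))
        where
        zeros : ∀ x → term x ≡ 0ℚ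
        zeros x with C x in eq
        ... | false = *-zeroˡ (1ℚ - wt (incidence (star x)) M)
        ... | true = trans (cong (λ z → 1ℚ * (1ℚ - z)) (wt-star-covered mM
          (decidable-stable (covers? M x) λ nc → none (x , eq , nc)))) refl
      finish (yes (x , Cx , nc)) = 1 , ℕ.s≤s ℕ.z≤n , trans total (cong ((W + W) +_)
        (trans (sumF-single term x zeros) at))
        where
        at : term x ≡ fromℕ 1
        at = cong₂ (λ c w → indicator c * (1ℚ - w)) Cx (wt-star-missed nc)
        zeros : ∀ y → x ≢ y → term y ≡ 0ℚ
        zeros y ne with covers? M y
        ... | yes cv = covered-term cv
        ... | no nc' with C y in eq
        ... | false = *-zeroˡ (1ℚ - wt (incidence (star y)) M)
        ... | true = contradiction (atMostOne Cx eq nc (nc')) ne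

  -- In `same` both vertices are required to be ends of edges, because isolated vertices are missed
  -- by every matching.
  record Balanced (i : Ineqᴳ) : Set where
    field
      equal : ∀ e e' → proj₁ i e ≡ proj₁ i e'
      same : ∀ {M e e' x y} → Tight i M → e ∋ x → e' ∋ y → Misses M x → Misses M y → x ≡ y

  module _ {i : Ineqᴳ} (facet : FacetDefining G i) (pos : ∀ e → 0ℚ < proj₁ i e) where

    private
      f = proj₁ i
      f₀ = proj₂ i

    nonzero : ∀ e → f e ≢ 0ℚ
    nonzero e eq = <-irrefl (sym eq) (pos e)

    no-augment : ∀ {M e} → Tight i M → ¬ (∀ {x} → e ∋ x → Misses M x)
    no-augment {M} {e} t mi = <-irrefl refl (<-≤-trans
      (subst₂ _<_ (attains t) (sym (wt-add f (misses⇒∉ (mi (inj₁ refl)) (inj₁ refl)))) (p<p+q {wt f M} (pos e)))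
      (facet-valid {i} facet (matching-add (matching t) mi)))

    Same : V → V → Set
    Same x y = ∀ {M} → Tight i M → Misses M x → Misses M y → x ≡ y

    same-adjacent : ∀ {e x y} → e ∋ x → e ∋ y → Same x y
    same-adjacent {e} {x} {y} ex ey {M} t mx my with x ≟F y
    ... | yes eq = eq
    ... | no ne = ⊥-elim (no-augment t λ ez → case two-ends ex ey ne ez of λ
      { (inj₁ refl) → mx ; (inj₂ refl) → my })

    -- If a tight M missed both u and v, switching it with N from t would give M' missing t and one
    -- of u, v. The weights of M' and N' add up to 2 f₀ and neither exceeds f₀, so M' is tight and
    -- one of the two assumptions applies to it.
    same-trans : ∀ {u t v} → ∃[ N ] Tight i N × Misses N t → Same u t → Same t v → Same u v
    same-trans {u} {t} {v} (N , tN , Nt) ut tv {M} tM Mu Mv with u ≟F v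
    ... | yes eq = eq
    ... | no ne = finish (switch (suc (size M)) ℕₚ.≤-refl (matching tM) (matching tN) ne Nt Mu Mv)
      where
      finish : Switched M N t (λ M' → Misses M' u ⊎ Misses M' v) → u ≡ v
      finish S = [ (λ m → let eq = ut tM' m missed in trans eq (tv tM (subst (Misses M) eq Mu) Mv))
                 , (λ m → let eq = tv tM' missed m in trans (ut tM Mu (subst (Misses M) (sym eq) Mv)) eq) ]′ goal
        where
        open Switched S
        squeeze : ∀ {a b c} → a + b ≡ c + c → a ≤ c → b ≤ c → a ≡ c
        squeeze {a} {b} {c} eq a≤c b≤c = ≤-antisym a≤c (0≤p-q⇒q≤p (subst (0ℚ ≤_)
          (trans (lem₁ a b c) (trans (cong (λ z → (z - b) - c + (c + c - z)) eq) (trans (lem₂ b c) (trans (cong (λ z → z - b - c) (sym eq)) (lem₃ a b c))))) (0≤p-q b≤c)))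
          where
          lem₁ : ∀ a b c → c - b ≡ ((a + b) - b) - c + (c + c - (a + b))
          lem₁ = solve-∀ ℚ-ring
          lem₂ : ∀ b c → ((c + c) - b) - c + (c + c - (c + c)) ≡ (c + c) - b - c
          lem₂ = solve-∀ ℚ-ring
          lem₃ : ∀ a b c → (a + b) - b - c ≡ a - c
          lem₃ = solve-∀ ℚ-ring
        tM' : Tight i M'
        tM' = tight matchM (squeeze (trans (preserved f) (cong₂ _+_ (attains tM) (attains tN)))
          (facet-valid {i} facet matchM) (facet-valid {i} facet matchN))

    same-sym : ∀ {x y} → Same x y → Same y x
    same-sym s t my mx = sym (s t mx my)

    misses-resp : ∀ {x M M'} → (∀ e → M e ≡ M' e) → Misses M x → Misses M' x
    misses-resp same mi (e , p , q) = mi (e , ∈-resp (sym ∘ same) p , q)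

    missable? : ∀ v → Dec (∃[ M ] Tight i M × Misses M v)
    missable? v = search (λ M → Tight i M × Misses M v) (λ M → tight? i M ×-dec ¬? (covers? M v))
      (λ same (t , mi) → tight-resp i same t , misses-resp same mi)

    same? : ∀ x y → Dec (Same x y)
    same? x y with x ≟F y
    ... | yes eq = yes λ _ _ _ → eq
    ... | no ne with search (λ M → Tight i M × Misses M x × Misses M y)
        (λ M → tight? i M ×-dec (¬? (covers? M x) ×-dec ¬? (covers? M y)))
        (λ same (t , mx , my) → tight-resp i same t , misses-resp same mx , misses-resp same my)
    ... | yes (M , t , mx , my) = no λ s → ne (s t mx my)
    ... | no none = yes λ t mx my → contradiction (_ , t , mx , my) none

    -- Adjacent vertices are related by `Same`, so the class C of v₀ is closed under edges. A tight
    -- matching misses at most one vertex of C, hence the number of its edges inside C is constant.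
    -- By uniqueness the indicator of these edges is a multiple of f; as f vanishes nowhere, all
    -- edges lie inside C and f is constant.
    balanced : E → (∀ v → ∃[ M ] Tight i M × Misses M v) → Balanced i
    balanced e₀ missable = record { equal = λ e e' → trans (value e) (sym (value e')) ; same = all-same }
      where
      v₀ : V
      v₀ = proj₁ (ends G e₀)
      C : V → Bool
      C x = does (same? v₀ x)
      C⇒ : ∀ {x} → C x ≡ true → Same v₀ x
      C⇒ {x} eq with same? v₀ x
      ... | yes s = s
      ⇒C : ∀ {x} → Same v₀ x → C x ≡ true
      ⇒C {x} s = dec-true (same? v₀ x) s
      step : ∀ {e x y} → e ∋ x → e ∋ y → C x ≡ true → C y ≡ true
      step {x = x} ex ey c = ⇒C (same-trans (missable x) (C⇒ c) (same-adjacent ex ey))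
      closed : Closed C
      closed e with C (proj₁ (ends G e)) in p | C (proj₂ (ends G e)) in q
      ... | true | true = refl
      ... | false | false = refl
      ... | true | false = trans (sym (step {e} (inj₁ refl) (inj₂ refl) p)) q
      ... | false | true = trans (sym p) (step {e} (inj₂ refl) (inj₁ refl) q)
      in-class : ∀ {M} → Tight i M → ∀ {x y} → C x ≡ true → C y ≡ true → Misses M x → Misses M y → x ≡ y
      in-class t cx cy mx my = same-trans (missable v₀) (same-sym (C⇒ cx)) (C⇒ cy) t mx my
      M₀ = proj₁ (missable v₀)
      t₀ = proj₁ (proj₂ (missable v₀))
      W : Sub → ℚ
      W = wt (incidence (inside C))
      constant : ∀ {M} → Tight i M → W M ≡ W M₀
      constant {M} t = finish (missed-count C closed (matching t) (in-class t)) (missed-count C closed (matching t₀) (in-class t₀))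
        where
        Count : Sub → Set
        Count M = ∃[ m ] m ℕ.≤ 1 × sumF (λ x → indicator (C x)) ≡ (W M + W M) + fromℕ m
        num : Sub → ℕ
        num M = size (λ e → inside C e ∧ M e)
        cast : ∀ M m → (W M + W M) + fromℕ m ≡ fromℕ ((num M ℕ.+ num M) ℕ.+ m)
        cast M m = trans (cong (λ z → (z + z) + fromℕ m) (wt-size (inside C) M))
          (trans (cong (_+ fromℕ m) (sym (fromℕ-+ (num M) (num M)))) (sym (fromℕ-+ (num M ℕ.+ num M) m)))
        finish : Count M → Count M₀ → W M ≡ W M₀
        finish (m , m≤1 , eq) (n , n≤1 , eq') = trans (wt-size (inside C) M) (trans (cong fromℕ
          (halve (num M) (num M₀) m≤1 n≤1 (fromℕ-injective _ _
            (trans (sym (cast M m)) (trans (sym eq) (trans eq' (cast M₀ n))))))) (sym (wt-size (inside C) M₀)))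
      mult : Multiple i (incidence (inside C) , W M₀)
      mult = facet-unique facet (incidence (inside C) , W M₀) constant
      t = proj₁ mult
      e₀∈ : e₀ ∈ inside C
      e₀∈ = mem (⇒C λ _ _ _ → refl)
      tf₀ : 1ℚ ≡ t * f e₀
      tf₀ = trans (sym (incidence-∈ e₀∈)) (proj₁ (proj₂ mult) e₀)
      t≢0 : t ≢ 0ℚ
      t≢0 z = case trans tf₀ (trans (cong (_* f e₀) z) (*-zeroˡ (f e₀))) of λ ()
      all∈ : ∀ e → e ∈ inside C
      all∈ e = decidable-stable (e ∈? inside C) λ ne →
        nonzero e (x≢0∧xy≡0⇒y≡0 t≢0 (trans (sym (proj₁ (proj₂ mult) e)) (incidence-∉ ne)))
      value : ∀ e → f e ≡ f e₀
      value e = x-y≡0⇒x≡y _ _ (x≢0∧xy≡0⇒y≡0 t≢0 (trans (lem t (f e) (f e₀))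
        (trans (cong₂ _-_ (trans (sym (proj₁ (proj₂ mult) e)) (incidence-∈ (all∈ e))) (sym tf₀)) (+-inverseʳ 1ℚ))))
        where
        lem : ∀ t a b → t * (a - b) ≡ t * a - t * b
        lem = solve-∀ ℚ-ring
      end∈C : ∀ {e x} → e ∋ x → C x ≡ true
      end∈C {e} ex = step {e} (inj₁ refl) ex (holds (all∈ e))
      all-same : ∀ {M e e' x y} → Tight i M → e ∋ x → e' ∋ y → Misses M x → Misses M y → x ≡ y
      all-same t ex ey = in-class t (end∈C ex) (end∈C ey)

  -- Adjacency to star inequalities

  record Link (M : Sub) (x y : V) : Set where
    constructor link
    field
      {edge} : E
      edge∈ : edge ∈ M
      left : edge ∋ x
      right : edge ∋ y
      distinct : x ≢ y

  link-sym : ∀ {M x y} → Link M x y → Link M y x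
  link-sym (link p l r ne) = link p r l (ne ∘ sym)

  link-unique : ∀ {M x y z} → Matching M → Link M x y → Link M x z → y ≡ z
  link-unique m (link p l r ne) (link p' l' r' ne') with meet m p p' l l'
  ... | refl = case two-ends l' r' ne' r of λ { (inj₁ eq) → contradiction (sym eq) ne ; (inj₂ eq) → eq }

  data Alt (M M' : Sub) : ℕ → V → V → Set where
    nil : ∀ {x} → Alt M M' 0 x x
    snoc : ∀ {n x y z y'} → Alt M M' n x y → Link M y z → Link M' z y' → Alt M M' (suc n) x y'

  module _ {M M' : Sub} (m : Matching M) (m' : Matching M') where

    uncons : ∀ {n x y} → Alt M M' (suc n) x y → ∃[ z ] ∃[ a ] Link M x z × Link M' z a × Alt M M' n a y
    uncons {zero} (snoc nil l l') = _ , _ , l , l' , nil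
    uncons {suc n} (snoc p l l') with uncons p
    ... | z , a , k , k' , q = z , a , k , k' , snoc q l l'

    alt-trans : ∀ {k n x y z} → Alt M M' k x y → Alt M M' n y z → ∃[ j ] Alt M M' j x z
    alt-trans p nil = _ , p
    alt-trans p (snoc q l l') = _ , snoc (proj₂ (alt-trans p q)) l l'

    -- The two ends of an even walk lie on the same side of their cycle.
    alt-parity : ∀ n {x y} → Alt M M' n x y → ¬ Link M x y
    alt-parity zero nil l = Link.distinct l refl
    alt-parity (suc zero) (snoc nil l l') k with link-unique m l k
    ... | refl = Link.distinct l' refl
    alt-parity (suc (suc n)) p k with uncons p
    ... | z , a , l , l' , snoc q r r' with link-unique m l k
    ... | refl with link-unique m' l' (link-sym r')
    ... | refl = alt-parity n q (link-sym r)

    -- Backward steps are forced by the matchings, so of two walks with the same end the shorter is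
    -- a final part of the longer.
    alt-backward : ∀ {k n u u' x} → Alt M M' k u x → Alt M M' n u' x →
      (∃[ j ] Alt M M' j u u') ⊎ (∃[ j ] Alt M M' j u' u)
    alt-backward nil q = inj₂ (_ , q)
    alt-backward p@(snoc _ _ _) nil = inj₁ (_ , p)
    alt-backward (snoc p l l') (snoc q k k') with link-unique m' (link-sym l') (link-sym k')
    ... | refl with link-unique m (link-sym l) (link-sym k)
    ... | refl = alt-backward p q

    alt-forward : ∀ k n {u x x'} → Alt M M' k u x → Alt M M' n u x' →
      (∃[ j ] Alt M M' j x x') ⊎ (∃[ j ] Alt M M' j x' x)
    alt-forward zero n nil q = inj₁ (_ , q)
    alt-forward (suc k) zero p nil = inj₂ (_ , p)
    alt-forward (suc k) (suc n) p q with uncons p | uncons q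
    ... | z , a , l , l' , p' | z' , a' , r , r' , q' with link-unique m l r
    ... | refl with link-unique m' l' r'
    ... | refl = alt-forward k n p' q'

    -- Odd distance along the alternating path or cycle, leaving w by its M-edge and arriving by an
    -- M-edge.
    Opposite : V → V → Set
    Opposite w w' = ∃[ x ] (∃[ n ] Alt M M' n w x) × Link M x w'

    -- On an alternating cycle two vertices opposite to w₁ lie on the same side.
    no-three-opposite : ∀ {w₁ w₂ w₃} → Opposite w₁ w₂ → Opposite w₁ w₃ → Opposite w₂ w₃ → ⊥
    no-three-opposite (x₂ , (n₂ , p₂) , l₂) (x₃ , (n₃ , p₃) , l₃) (x , (n , p) , l)
      with link-unique m (link-sym l₃) (link-sym l)
    ... | refl with alt-backward p₃ p
    ... | inj₂ (j , q) = let j' , r = alt-trans q p₂ in alt-parity j' r (link-sym l₂)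
    ... | inj₁ (j , q) with alt-forward j n₂ q p₂
    ... | inj₁ (j' , r) = alt-parity j' r (link-sym l₂)
    ... | inj₂ (j' , r) = alt-parity j' r l₂

  record Claw (v : V) : Set where
    field
      {e₁ e₂ e₃} : E
      e₁∋ : e₁ ∋ v
      e₂∋ : e₂ ∋ v
      e₃∋ : e₃ ∋ v
      e₁≢e₂ : e₁ ≢ e₂
      e₁≢e₃ : e₁ ≢ e₃
      e₂≢e₃ : e₂ ≢ e₃

  claw? : ∀ v → Dec (Claw v)
  claw? v = map′
    (λ (_ , _ , _ , p , q , r , a , b , c) → record
      { e₁∋ = p ; e₂∋ = q ; e₃∋ = r ; e₁≢e₂ = a ; e₁≢e₃ = b ; e₂≢e₃ = c })
    (λ c → let open Claw c in _ , _ , _ , e₁∋ , e₂∋ , e₃∋ , e₁≢e₂ , e₁≢e₃ , e₂≢e₃)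
    (any? λ a → any? λ b → any? λ c → (a ∋? v) ×-dec ((b ∋? v) ×-dec ((c ∋? v) ×-dec
      (¬? (a ≟F b) ×-dec (¬? (a ≟F c) ×-dec ¬? (b ≟F c))))))

  other-distinct : ∀ {e e' v w w'} → e ∋ v → e ∋ w → w ≢ v → e' ∋ v → e' ∋ w' → e ≢ e' → w ≢ w'
  other-distinct ev ew w≢v e'v e'w ne refl = ne (edge-unique (w≢v ∘ sym) ev ew e'v e'w)

  conflict-end : ∀ {e e' v w} → e' ∋ v → e' ∋ w → w ≢ v → ¬ e ∋ v → Conflict e e' → e ∋ w
  conflict-end e'v e'w w≢v n (x , ex , e'x) with two-ends e'v e'w (w≢v ∘ sym) e'x
  ... | inj₁ refl = contradiction ex n
  ... | inj₂ refl = ex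

  star-max₂ : ∀ {v a b e₁ e₂} → e₁ ∋ v → e₁ ∋ a → a ≢ v → e₂ ∋ v → e₂ ∋ b → b ≢ v →
    (∀ {e} → ¬ e ∋ v → e ∋ a → ¬ e ∋ b) → MaxClique (star v)
  star-max₂ {v} {a} {b} {e₁} {e₂} e₁v e₁a a≢v e₂v e₂b b≢v open-ended = record { clique = star-clique ; maximal = avoid }
    where
    avoid : ∀ {e} → ¬ e ∈ star v → ∃[ e' ] e' ∈ star v × ¬ Conflict e e'
    avoid {e} ne with conflict? e e₁ | conflict? e e₂
    ... | no n | _ = e₁ , ∈-star e₁v , n
    ... | _ | no n = e₂ , ∈-star e₂v , n
    ... | yes c | yes c' = contradiction (conflict-end e₂v e₂b b≢v (ne ∘ ∈-star) c')
      (open-ended (ne ∘ ∈-star) (conflict-end e₁v e₁a a≢v (ne ∘ ∈-star) c))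

  -- An edge avoiding v but in conflict with all three edges of the claw would have three ends.
  claw-max : ∀ {v} → Claw v → MaxClique (star v)
  claw-max {v} cl with other (Claw.e₁∋ cl) | other (Claw.e₂∋ cl) | other (Claw.e₃∋ cl)
  ... | a , e₁a , a≢v | b , e₂b , b≢v | c , e₃c , c≢v = record { clique = star-clique ; maximal = avoid }
    where
    open Claw cl
    a≢b = other-distinct e₁∋ e₁a a≢v e₂∋ e₂b e₁≢e₂
    a≢c = other-distinct e₁∋ e₁a a≢v e₃∋ e₃c e₁≢e₃
    b≢c = other-distinct e₂∋ e₂b b≢v e₃∋ e₃c e₂≢e₃
    avoid : ∀ {e} → ¬ e ∈ star v → ∃[ e' ] e' ∈ star v × ¬ Conflict e e'
    avoid {e} ne with conflict? e e₁ | conflict? e e₂ | conflict? e e₃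
    ... | no n | _ | _ = e₁ , ∈-star e₁∋ , n
    ... | _ | no n | _ = e₂ , ∈-star e₂∋ , n
    ... | _ | _ | no n = e₃ , ∈-star e₃∋ , n
    ... | yes p | yes q | yes r = contradiction (conflict-end e₃∋ e₃c c≢v (ne ∘ ∈-star) r)
      (no-third-end (conflict-end e₁∋ e₁a a≢v (ne ∘ ∈-star) p) (conflict-end e₂∋ e₂b b≢v (ne ∘ ∈-star) q)
        a≢b (a≢c ∘ sym) (b≢c ∘ sym))

  -- If two of the leaves are not adjacent, no triangle competes with the star; otherwise the
  -- centre and the leaves of the claw span a K₄, and every leaf is again the centre of a claw.
  claw-InF₀ : ∀ {v} → Claw v → InF₀ G (cliqueIneq (star v))
  claw-InF₀ {v} cl with other (Claw.e₁∋ cl) | other (Claw.e₂∋ cl) | other (Claw.e₃∋ cl)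
  ... | a , e₁a , a≢v | b , e₂b , b≢v | c , e₃c , c≢v = decide (closing? a b) (closing? a c) (closing? b c)
    where
    open Claw cl
    a≢b = other-distinct e₁∋ e₁a a≢v e₂∋ e₂b e₁≢e₂
    a≢c = other-distinct e₁∋ e₁a a≢v e₃∋ e₃c e₁≢e₃
    b≢c = other-distinct e₂∋ e₂b b≢v e₃∋ e₃c e₂≢e₃
    Closing : V → V → Set
    Closing x y = ∃[ e ] ¬ e ∋ v × e ∋ x × e ∋ y
    closing? : ∀ x y → Dec (Closing x y)
    closing? x y = any? λ e → ¬? (e ∋? v) ×-dec ((e ∋? x) ×-dec (e ∋? y))
    ∌-≢ : ∀ {e e' x} → e ∋ x → ¬ e' ∋ x → e ≢ e'
    ∌-≢ p n refl = n p
    decide : Dec (Closing a b) → Dec (Closing a c) → Dec (Closing b c) → InF₀ G (cliqueIneq (star v))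
    decide (no n) _ _ = star-InF₀ (claw-max cl) e₁∋ e₁a e₂∋ e₂b a≢v b≢v a≢b
      λ nv p q → contradiction (_ , nv , p , q) n
    decide _ (no n) _ = star-InF₀ (claw-max cl) e₁∋ e₁a e₃∋ e₃c a≢v c≢v a≢c
      λ nv p q → contradiction (_ , nv , p , q) n
    decide _ _ (no n) = star-InF₀ (claw-max cl) e₂∋ e₂b e₃∋ e₃c b≢v c≢v b≢c
      λ nv p q → contradiction (_ , nv , p , q) n
    decide (yes (ab , ab∌v , ab∋a , ab∋b)) (yes (ac , ac∌v , ac∋a , ac∋c)) (yes (bc , bc∌v , bc∋b , bc∋c)) =
      star-InF₀ (claw-max cl) e₁∋ e₁a e₂∋ e₂b a≢v b≢v a≢b λ _ _ _ → claw-max claw-a , claw-max claw-b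
      where
      ab∌c : ¬ ab ∋ c
      ab∌c = no-third-end ab∋a ab∋b a≢b (a≢c ∘ sym) (b≢c ∘ sym)
      claw-a : Claw a
      claw-a = record { e₁∋ = e₁a ; e₂∋ = ab∋a ; e₃∋ = ac∋a ; e₁≢e₂ = ∌-≢ e₁∋ ab∌v ; e₁≢e₃ = ∌-≢ e₁∋ ac∌v
                      ; e₂≢e₃ = ∌-≢ ac∋c ab∌c ∘ sym }
      claw-b : Claw b
      claw-b = record { e₁∋ = e₂b ; e₂∋ = ab∋b ; e₃∋ = bc∋b ; e₁≢e₂ = ∌-≢ e₂∋ ab∌v ; e₁≢e₃ = ∌-≢ e₂∋ bc∌v
                      ; e₂≢e₃ = ∌-≢ bc∋c ab∌c ∘ sym }

  -- Tight matchings that miss a given vertex, for balanced facets.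

  module _ {i : Ineqᴳ} (facet : FacetDefining G i) (pos : ∀ e → 0ℚ < proj₁ i e) (bal : Balanced i) where

    open Balanced bal

    private
      f = proj₁ i
      f₀ = proj₂ i

    swap-wt : ∀ {M a b} g → b ∈ M → ¬ a ∈ del b M → wt g (add a (del b M)) + g b ≡ wt g M + g a
    swap-wt {M} {a} {b} g p n = trans (cong (_+ g b) (wt-add g n)) (trans (lem (wt g (del b M)) (g a) (g b))
      (cong (_+ g a) (sym (wt-del g p))))
      where
      lem : ∀ x y z → (x + y) + z ≡ (x + z) + y
      lem = solve-∀ ℚ-ring

    -- All coefficients are equal, so trading one edge for another keeps the weight.
    swap-tight : ∀ {M a b} → Tight i M → b ∈ M → (∀ {x} → a ∋ x → Misses (del b M) x) → Tight i (add a (del b M))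
    swap-tight {M} {a} {b} t p mi = tight (matching-add (matching-del (matching t)) mi)
      (trans (cancel (trans (swap-wt f p (misses⇒∉ (mi (inj₁ refl)) (inj₁ refl))) (cong (wt f M +_) (equal a b)))) (attains t))
      where
      cancel : ∀ {x y z} → x + z ≡ y + z → x ≡ y
      cancel {x} {y} {z} eq = trans (lem x z) (trans (cong (_- z) eq) (sym (lem y z)))
        where
        lem : ∀ x z → x ≡ (x + z) - z
        lem = solve-∀ ℚ-ring

    partner : ∀ {M e v w} → Tight i M → Misses M v → e ∋ v → e ∋ w → w ≢ v → ∃[ m ] m ∈ M × m ∋ w
    partner {M} {e} {v} {w} t mv ev ew w≢v = decidable-stable (covers? M w) λ nc →
      no-augment facet pos t λ ez → case two-ends ev ew (w≢v ∘ sym) ez of λ { (inj₁ refl) → mv ; (inj₂ refl) → nc }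

    ConstantOnMissing : V → Set
    ConstantOnMissing v = ∀ g s → (∀ {M} → Tight i M → Covers M v → wt g M ≡ s) →
      ∀ {M M'} → Tight i M → Tight i M' → Misses M v → Misses M' v → wt g M ≡ wt g M'

    -- The tight matchings on the star facet are those covering v. If g is g₀ on them and k on those
    -- missing v, then g - (g₀ - k) χ is k on all tight matchings. Evaluating a relation at M₀,
    -- which misses v, gives independence.
    star-adjacent : ∀ {v} → (∃[ M ] Tight i M × Misses M v) → ConstantOnMissing v → E → Adjacent i (cliqueIneq (star v))
    star-adjacent {v} (M₀ , t₀ , mv₀) constant e₀ = adjacent-intro i (cliqueIneq (star v)) e₀
      (independent-intro {i} {cliqueIneq (star v)} facet β-zero) unique
      where
      χ : Vect (nE G)
      χ = incidence (star v)
      χ-covers : ∀ {M} → Tight i M → Covers M v → wt χ M ≡ 1ℚ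
      χ-covers t (e , p , q) = clique-meets star-clique (matching t) (∈-star q) p
      χ-misses : ∀ {M} → Misses M v → wt χ M ≡ 0ℚ
      χ-misses mi = clique-avoids λ e p q → mi (e , q , star-∋ p)
      β-zero : ∀ α β → (∀ e → α * f e + β * χ e ≡ 0ℚ) → α * f₀ + β * 1ℚ ≡ 0ℚ → β ≡ 0ℚ
      β-zero α β eqs eq₀ = trans (lem β) (trans (sym (+-identityˡ (β * 1ℚ))) (trans (cong (_+ β * 1ℚ) (sym αf₀)) eq₀))
        where
        lem : ∀ b → b ≡ b * 1ℚ
        lem = solve-∀ ℚ-ring
        lem' : ∀ a b → a ≡ a + b * 0ℚ
        lem' = solve-∀ ℚ-ring
        αf₀ : α * f₀ ≡ 0ℚ
        αf₀ = begin
          α * f₀                                   ≡⟨ lem' (α * f₀) β ⟩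
          α * f₀ + β * 0ℚ                          ≡⟨ cong₂ (λ x y → α * x + β * y) (sym (attains t₀)) (sym (χ-misses mv₀)) ⟩
          α * wt f M₀ + β * wt χ M₀                ≡⟨ cong₂ _+_ (wt-* α f M₀) (wt-* β χ M₀) ⟨
          wt (λ e → α * f e) M₀ + wt (λ e → β * χ e) M₀
                                                   ≡⟨ wt-+ (λ e → α * f e) (λ e → β * χ e) M₀ ⟨
          wt (λ e → α * f e + β * χ e) M₀          ≡⟨ sumF-zero (λ e → trans (cong (_* incidence M₀ e) (eqs e)) (*-zeroˡ (incidence M₀ e))) ⟩
          0ℚ                                       ∎
          where open ≡-Reasoning
      unique : ∀ g → (∀ {M} → Tight i M → Tight (cliqueIneq (star v)) M → wt (proj₁ g) M ≡ proj₂ g) →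
        Combination i (cliqueIneq (star v)) g
      unique (g , g₀) const = finish (facet-unique facet (g' , k) const')
        where
        covering : ∀ {M} → Tight i M → Covers M v → wt g M ≡ g₀
        covering t cv = const t (tight (matching t) (χ-covers t cv))
        k β : ℚ
        k = wt g M₀
        β = g₀ - k
        g' : Vect (nE G)
        g' e = g e + (- β) * χ e
        wt-g' : ∀ M → wt g' M ≡ wt g M + (- β) * wt χ M
        wt-g' M = trans (wt-+ g (λ e → (- β) * χ e) M) (cong (wt g M +_) (wt-* (- β) χ M))
        const' : ConstantOnTight i (g' , k)
        const' {M} t with covers? M v
        ... | yes cv = trans (wt-g' M) (trans (cong₂ (λ x y → x + (- β) * y) (covering t cv) (χ-covers t cv)) (lem g₀ k))
          where
          lem : ∀ a b → a + (- (a - b)) * 1ℚ ≡ b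
          lem = solve-∀ ℚ-ring
        ... | no nc = trans (wt-g' M) (trans (cong₂ (λ x y → x + (- β) * y) (constant g g₀ covering t t₀ nc mv₀) (χ-misses nc)) (lem k β))
          where
          lem : ∀ a b → a + (- b) * 0ℚ ≡ a
          lem = solve-∀ ℚ-ring
        finish : Multiple i (g' , k) → Combination i (cliqueIneq (star v)) (g , g₀)
        finish (α , eq , eq₀) = α , β , (λ e → trans (lem (g e) β (χ e)) (cong (_+ β * χ e) (eq e))) ,
          trans (lem' g₀ k) (cong (_+ β * 1ℚ) eq₀)
          where
          lem : ∀ a b c → a ≡ (a + (- b) * c) + b * c
          lem = solve-∀ ℚ-ring
          lem' : ∀ a b → a ≡ b + (a - b) * 1ℚ
          lem' = solve-∀ ℚ-ring

    module _ {v : V} (g : Vect (nE G)) (s : ℚ) (covering : ∀ {M} → Tight i M → Covers M v → wt g M ≡ s) where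

      -- Replacing the M-edge m at w by e = vw gives a tight matching that covers v.
      rotate : ∀ {M e m w} → Tight i M → Misses M v → e ∋ v → e ∋ w → w ≢ v → m ∈ M → m ∋ w →
        wt g M + g e ≡ s + g m
      rotate {M} {e} {m} {w} t mv ev ew w≢v p mw = trans (sym (swap-wt g p (misses⇒∉ (free ev) ev)))
        (cong (_+ g m) (covering (swap-tight t p free) (e , add-self , ev)))
        where
        free : ∀ {x} → e ∋ x → Misses (del m M) x
        free ez = case two-ends ev ew (w≢v ∘ sym) ez of λ
          { (inj₁ refl) → misses-del mv ; (inj₂ refl) → misses-del-self (matching t) p mw }

      cancelʳ : ∀ {x y z} → x + z ≡ y + z → x ≡ y
      cancelʳ {x} {y} {z} eq = trans (lem x z) (trans (cong (_- z) eq) (sym (lem y z)))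
        where
        lem : ∀ x z → x ≡ (x + z) - z
        lem = solve-∀ ℚ-ring

      -- By `rotate` the weight of a tight matching missing v depends only on the value of g at its
      -- edge at w, for any fixed neighbour w of v.
      same-partner : ∀ {M M' e m m' w} → Tight i M → Tight i M' → Misses M v → Misses M' v →
        e ∋ v → e ∋ w → w ≢ v → m ∈ M → m ∋ w → m' ∈ M' → m' ∋ w → g m ≡ g m' → wt g M ≡ wt g M'
      same-partner {e = e} t t' mv mv' ev ew w≢v p q p' q' eq =
        cancelʳ {z = g e} (trans (rotate t mv ev ew w≢v p q) (trans (cong (s +_) eq) (sym (rotate t' mv' ev ew w≢v p' q'))))

      module _ {M M' e e' m₂ w w'} (t : Tight i M) (t' : Tight i M') (mv : Misses M v) (mv' : Misses M' v)
        (ev : e ∋ v) (ew : e ∋ w) (w≢v : w ≢ v) (e'v : e' ∋ v) (e'w' : e' ∋ w') (w'≢v : w' ≢ v)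
        (m₂∈ : m₂ ∈ M) (m₂w' : m₂ ∋ w') where

        -- N arises from M by putting in e = vw and shifting along the walk, so that z is now
        -- uncovered. `m₂∈N` keeps the M-edge at w' for a comparison with M when the cycle closes,
        -- and `z-end` makes `same` applicable to z.
        record State (N : Sub) (z : V) : Set where
          field
            tightN : Tight i N
            e∈N : e ∈ N
            missesz : Misses N z
            z-end : ∃[ a ] a ∋ z
            reached : Opposite (matching t) (matching t') w z
            z≢w' : z ≢ w'
            N⊆ : ∀ {a} → a ∈ N → a ∈ M ⊎ a ∈ M' ⊎ a ≡ e
            m₂∈N : m₂ ∈ N

        remaining : Sub → Sub
        remaining N a = M' a ∧ not (N a)

        remaining⇒ : ∀ {N a} → remaining N a ≡ true → a ∈ M' × ¬ a ∈ N
        remaining⇒ {N} {a} eq with M' a in p | N a in q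
        ... | true | false = mem p , false⇒∉ q

        ⇒remaining : ∀ {N a} → a ∈ M' → ¬ a ∈ N → remaining N a ≡ true
        ⇒remaining {N} {a} (mem p) n rewrite p | ∉⇒false n = refl

        -- Follows the M/M' alternating cycle from w, moving the uncovered vertex z of a tight matching through v w.
        -- Passing w' in the even position forces g to agree on both cycle edges at w', and closing the cycle
        -- without meeting w' gives a tight matching that agrees with M' at w and with M at w'.
        walk : ∀ n N z → size (remaining N) ℕ.< n → State N z →
          wt g M ≡ wt g M' ⊎ Opposite (matching t) (matching t') w w'
        walk (suc n) N z (ℕ.s≤s lt) st = from (covers? M' z)
          where
          open State st
          z≢v : z ≢ v
          z≢v = misses≢covers missesz (e , e∈N , ev)
          Result : Set
          Result = wt g M ≡ wt g M' ⊎ Opposite (matching t) (matching t') w w'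
          onward : ∀ {a x} → a ∈ M' → a ∋ z → a ∋ x → x ≢ z → x ≢ w → Result
          from : Dec (Covers M' z) → Result
          -- M' would miss the two non-isolated vertices z and v, so the walk cannot end here.
          from (no nc) = contradiction (same t' (proj₂ z-end) ev nc mv') z≢v
          from (yes (a , a∈ , az)) with other az
          ... | x , ax , x≢z with x ≟F w
          ... | no x≢w = onward a∈ az ax x≢z x≢w
          ... | yes refl = inj₁ (trans
            (same-partner t tN' mv misses'' e'v e'w' w'≢v m₂∈ m₂w' (add-⊇ (del-keep m₂≢e m₂∈N)) m₂w' refl)
            (same-partner tN' t' misses'' mv' ev ew w≢v add-self ax a∈ ax refl))
            where
            free : ∀ {y} → a ∋ y → Misses (del e N) y
            free ay = case two-ends az ax (x≢z ∘ sym) ay of λ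
              { (inj₁ refl) → misses-del missesz ; (inj₂ refl) → misses-del-self (matching tightN) e∈N ew }
            tN' : Tight i (add a (del e N))
            tN' = swap-tight tightN e∈N free
            misses'' : Misses (add a (del e N)) v
            misses'' = misses-add (misses-del-self (matching tightN) e∈N ev) λ av → mv' (a , a∈ , av)
            m₂≢e : m₂ ≢ e
            m₂≢e refl = mv (e , m₂∈ , ev)
          onward {a} {x} a∈ az ax x≢z x≢w with covers? N x
          ... | no nc = ⊥-elim (no-augment facet pos tightN λ ay → case two-ends az ax (x≢z ∘ sym) ay of λ
            { (inj₁ refl) → missesz ; (inj₂ refl) → nc })
          ... | yes (b , b∈ , bx) = step (N⊆ b∈)
            where
            x≢v : x ≢ v
            x≢v = misses≢covers mv' (a , a∈ , ax) ∘ sym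
            e∌x : ¬ e ∋ x
            e∌x = no-third-end ev ew (w≢v ∘ sym) x≢v x≢w
            b≢e : b ≢ e
            b≢e refl = e∌x bx
            a∉N : ¬ a ∈ N
            a∉N = misses⇒∉ missesz az
            b∉M' : ¬ b ∈ M'
            b∉M' p with meet (matching t') p a∈ bx ax
            ... | refl = a∉N b∈
            N' : Sub
            N' = add a (del b N)
            free : ∀ {y} → a ∋ y → Misses (del b N) y
            free ay = case two-ends az ax (x≢z ∘ sym) ay of λ
              { (inj₁ refl) → misses-del missesz ; (inj₂ refl) → misses-del-self (matching tightN) b∈ bx }
            tN' : Tight i N'
            tN' = swap-tight tightN b∈ free
            e∈N' : e ∈ N'
            e∈N' = add-⊇ (del-keep (b≢e ∘ sym) e∈N)
            -- N and N' are both tight and cover v by e, so both have g-weight s, and they differ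
            -- only in a and b.
            ga≡gb : g a ≡ g b
            ga≡gb = cancelʳ {z = s} (trans (+-comm (g a) s) (trans (cong (_+ g a) (sym (covering tightN (e , e∈N , ev))))
              (trans (sym (swap-wt g b∈ (misses⇒∉ (free az) az)))
                (trans (cong (_+ g b) (covering tN' (e , e∈N' , ev))) (+-comm s (g b))))))
            smaller : size (remaining N') ℕ.< size (remaining N)
            smaller = size-strict
              (λ c p → let c∈ , n = remaining⇒ {N'} p in ⇒remaining c∈ λ q →
                n (add-⊇ (del-keep (λ { refl → b∉M' c∈ }) q)))
              a (cong₂ (λ x y → x ∧ not y) (holds a∈) (holds (add-self {a} {del b N}))) (⇒remaining {N} a∈ a∉N)
            step : b ∈ M ⊎ b ∈ M' ⊎ b ≡ e → Result
            step (inj₂ (inj₁ p)) = contradiction p b∉M'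
            step (inj₂ (inj₂ p)) = contradiction p b≢e
            step (inj₁ b∈M) with x ≟F w'
            ... | yes refl = inj₁ (same-partner t t' mv mv' e'v e'w' w'≢v b∈M bx a∈ ax (sym ga≡gb))
            ... | no x≢w' with other bx
            ... | y , by , y≢x = next (y ≟F w')
              where
              reached' : Opposite (matching t) (matching t') w y
              reached' = let x₀ , (k , p) , l = reached in
                x , (_ , snoc p l (link a∈ az ax (x≢z ∘ sym))) , link b∈M bx by (y≢x ∘ sym)
              y≢z : y ≢ z
              y≢z = misses≢covers missesz (b , b∈ , by) ∘ sym
              next : Dec (y ≡ w') → Result
              next (yes refl) = inj₂ reached'
              next (no y≢w') = walk n N' y (ℕₚ.<-≤-trans smaller lt) record
                { tightN = tN' ; e∈N = e∈N'
                ; missesz = misses-add (misses-del-self (matching tightN) b∈ by) (no-third-end az ax (x≢z ∘ sym) y≢z y≢x)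
                ; z-end = b , by ; reached = reached' ; z≢w' = y≢w'
                ; N⊆ = λ p → case add-inv p of λ { (inj₁ refl) → inj₂ (inj₁ a∈) ; (inj₂ q) → N⊆ (del-⊆ q) }
                ; m₂∈N = add-⊇ (del-keep (λ { refl → no-third-end bx by (y≢x ∘ sym) (x≢w' ∘ sym) (y≢w' ∘ sym) m₂w' }) m₂∈N) }

        -- The first shift replaces the M-edge wz by vw. If z is already w', the two vertices are
        -- opposite at distance one.
        start : w ≢ w' → wt g M ≡ wt g M' ⊎ Opposite (matching t) (matching t') w w'
        start w≢w' with partner t mv ev ew w≢v
        ... | m , m∈ , mw with other mw
        ... | z , mz , z≢w with z ≟F w'
        ... | yes refl = inj₂ (w , (0 , nil) , link m∈ mw mz (z≢w ∘ sym))
        ... | no z≢w' = walk _ (add e (del m M)) z ℕₚ.≤-refl record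
          { tightN = swap-tight t m∈ free ; e∈N = add-self
          ; missesz = misses-add (misses-del-self (matching t) m∈ mz)
              (no-third-end ev ew (w≢v ∘ sym) (misses≢covers mv (m , m∈ , mz) ∘ sym) z≢w)
          ; z-end = m , mz ; reached = w , (0 , nil) , link m∈ mw mz (z≢w ∘ sym) ; z≢w' = z≢w'
          ; N⊆ = λ p → case add-inv p of λ { (inj₁ refl) → inj₂ (inj₂ refl) ; (inj₂ q) → inj₁ (del-⊆ q) }
          ; m₂∈N = add-⊇ (del-keep (λ { refl → no-third-end mw mz (z≢w ∘ sym) (w≢w' ∘ sym) (z≢w' ∘ sym) m₂w' }) m₂∈) }
          where
          free : ∀ {x} → e ∋ x → Misses (del m M) x
          free ez = case two-ends ev ew (w≢v ∘ sym) ez of λ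
            { (inj₁ refl) → misses-del mv ; (inj₂ refl) → misses-del-self (matching t) m∈ mw }

    claw-constant : ∀ {v} → Claw v → ConstantOnMissing v
    claw-constant {v} cl g s covering {M} {M'} t t' mv mv'
      with other (Claw.e₁∋ cl) | other (Claw.e₂∋ cl) | other (Claw.e₃∋ cl)
    ... | a , e₁a , a≢v | b , e₂b , b≢v | c , e₃c , c≢v =
      combine (run e₁∋ e₁a a≢v e₂∋ e₂b b≢v e₁≢e₂) (run e₁∋ e₁a a≢v e₃∋ e₃c c≢v e₁≢e₃) (run e₂∋ e₂b b≢v e₃∋ e₃c c≢v e₂≢e₃)
      where
      open Claw cl
      Opp : V → V → Set
      Opp = Opposite (matching t) (matching t')
      run : ∀ {e e' w w'} → e ∋ v → e ∋ w → w ≢ v → e' ∋ v → e' ∋ w' → w' ≢ v → e ≢ e' → wt g M ≡ wt g M' ⊎ Opp w w'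
      run ev ew w≢v e'v e'w' w'≢v ne = let m₂ , m₂∈ , m₂w' = partner t mv e'v e'w' w'≢v in
        start g s covering t t' mv mv' ev ew w≢v e'v e'w' w'≢v m₂∈ m₂w' (other-distinct ev ew w≢v e'v e'w' ne)
      combine : wt g M ≡ wt g M' ⊎ Opp a b → wt g M ≡ wt g M' ⊎ Opp a c → wt g M ≡ wt g M' ⊎ Opp b c → wt g M ≡ wt g M'
      combine (inj₁ eq) _ _ = eq
      combine _ (inj₁ eq) _ = eq
      combine _ _ (inj₁ eq) = eq
      combine (inj₂ p) (inj₂ q) (inj₂ r) = ⊥-elim (no-three-opposite (matching t) (matching t') p q r)

    Neighbour : Set
    Neighbour = ∃[ h ] InF₀ G h × Adjacent i h

    -- Let e₀ = vw. A tight matching missing w must cover v, necessarily by a second edge e₁ = vb,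
    -- so v has exactly the neighbours w and b. The cases are whether w and b are adjacent.
    no-claw-case : (∀ v → ∃[ M ] Tight i M × Misses M v) → (∀ v → ¬ Claw v) → E → Neighbour
    no-claw-case missable no-claw e₀ with missable (proj₂ (ends G e₀))
    ... | M , t , mw with partner t mw (inj₂ refl) (inj₁ refl) (loopless G e₀)
    ... | e₁ , e₁∈ , e₁v with other e₁v
    ... | b , e₁b , b≢v = decide (any? λ e → (e ∋? w) ×-dec (e ∋? b))
      where
      v w : V
      v = proj₁ (ends G e₀)
      w = proj₂ (ends G e₀)
      v≢w : v ≢ w
      v≢w = loopless G e₀
      e₁≢e₀ : e₁ ≢ e₀
      e₁≢e₀ refl = mw (e₀ , e₁∈ , inj₂ refl)
      w≢b : w ≢ b
      w≢b = misses≢covers mw (e₁ , e₁∈ , e₁b)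
      third : ∀ {x a b c} → a ∋ x → b ∋ x → c ∋ x → a ≢ b → c ≡ a ⊎ c ≡ b
      third {x} {a} {b} {c} p q r ne with c ≟F a | c ≟F b
      ... | yes eq | _ = inj₁ eq
      ... | no _ | yes eq = inj₂ eq
      ... | no n | no n' = contradiction record
        { e₁∋ = p ; e₂∋ = q ; e₃∋ = r ; e₁≢e₂ = ne ; e₁≢e₃ = n ∘ sym ; e₂≢e₃ = n' ∘ sym } (no-claw x)
      decide : Dec (∃[ e ] e ∋ w × e ∋ b) → Neighbour
      decide (no n) = cliqueIneq (star v) ,
        star-InF₀ (star-max₂ (inj₁ refl) (inj₂ refl) (v≢w ∘ sym) e₁v e₁b b≢v λ _ p q → n (_ , p , q))
          (inj₁ refl) (inj₂ refl) e₁v e₁b (v≢w ∘ sym) b≢v w≢b (λ _ p q → contradiction (_ , p , q) n) ,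
        star-adjacent (missable v) constant e₀
        where
        constant : ConstantOnMissing v
        constant g s covering {M₁} {M₂} t₁ t₂ mv₁ mv₂
          with partner t₁ mv₁ (inj₁ refl) (inj₂ refl) (v≢w ∘ sym) | partner t₂ mv₂ (inj₁ refl) (inj₂ refl) (v≢w ∘ sym)
        ... | m₁ , p₁ , q₁ | m₂ , p₂ , q₂ = same-partner g s covering {e = e₀} t₁ t₂ mv₁ mv₂
          (inj₁ refl) (inj₂ refl) (v≢w ∘ sym) p₁ q₁ p₂ q₂ (cong g m₁≡m₂)
          where
          -- At w there is only one edge besides e₀, and a matching missing v cannot use e₀.
          m₁≡m₂ : m₁ ≡ m₂
          m₁≡m₂ with third {a = e₀} {b = m₁} {c = m₂} (inj₂ refl) q₁ q₂ (λ { refl → mv₁ (e₀ , p₁ , inj₁ refl) })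
          ... | inj₁ refl = ⊥-elim (mv₂ (e₀ , p₂ , inj₁ refl))
          ... | inj₂ eq = sym eq
      decide (yes (e₂ , e₂w , e₂b)) = nonnegIneq e₀ , nonneg-InF₀ (standardFormulation e₀) e₀ ,
        clique-case facet (nonzero facet pos) triangle meets e₀
        where
        e₀≢e₂ : e₀ ≢ e₂
        e₀≢e₂ refl = no-third-end {e₀} (inj₁ refl) (inj₂ refl) v≢w b≢v (w≢b ∘ sym) e₂b
        S : Sub
        S = add e₀ (add e₁ (single e₂))
        e₀∈S : e₀ ∈ S
        e₀∈S = add-self
        e₁∈S : e₁ ∈ S
        e₁∈S = add-⊇ add-self
        e₂∈S : e₂ ∈ S
        e₂∈S = add-⊇ (add-⊇ add-self)
        S⇒ : ∀ {e} → e ∈ S → e ≡ e₀ ⊎ e ≡ e₁ ⊎ e ≡ e₂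
        S⇒ p with add-inv p
        ... | inj₁ eq = inj₁ eq
        ... | inj₂ q with add-inv q
        ... | inj₁ eq = inj₂ (inj₁ eq)
        ... | inj₂ r = inj₂ (inj₂ (∈-single r))
        triangle : Clique S
        triangle p q with S⇒ p | S⇒ q
        ... | inj₁ refl | inj₁ refl = conflict-refl
        ... | inj₁ refl | inj₂ (inj₁ refl) = v , inj₁ refl , e₁v
        ... | inj₁ refl | inj₂ (inj₂ refl) = w , inj₂ refl , e₂w
        ... | inj₂ (inj₁ refl) | inj₁ refl = v , e₁v , inj₁ refl
        ... | inj₂ (inj₁ refl) | inj₂ (inj₁ refl) = conflict-refl
        ... | inj₂ (inj₁ refl) | inj₂ (inj₂ refl) = b , e₁b , e₂b
        ... | inj₂ (inj₂ refl) | inj₁ refl = w , e₂w , inj₂ refl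
        ... | inj₂ (inj₂ refl) | inj₂ (inj₁ refl) = b , e₂b , e₁b
        ... | inj₂ (inj₂ refl) | inj₂ (inj₂ refl) = conflict-refl
        -- If v is covered, it is by e₀ or e₁. Otherwise its neighbour w is covered, by e₀ or e₂.
        meets : ∀ {M} → Tight i M → ∃[ e ] e ∈ S × e ∈ M
        meets {M} t with covers? M v
        ... | yes (c , c∈ , cv) with third {a = e₀} {b = e₁} (inj₁ refl) e₁v cv (e₁≢e₀ ∘ sym)
        ... | inj₁ refl = c , e₀∈S , c∈
        ... | inj₂ refl = c , e₁∈S , c∈
        meets {M} t | no nc with partner {e = e₀} t nc (inj₁ refl) (inj₂ refl) (v≢w ∘ sym)
        ... | c , c∈ , cw with third {a = e₀} {b = e₂} (inj₂ refl) e₂w cw e₀≢e₂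
        ... | inj₁ refl = c , e₀∈S , c∈
        ... | inj₂ refl = c , e₂∈S , c∈

    balanced-case : (∀ v → ∃[ M ] Tight i M × Misses M v) → E → Neighbour
    balanced-case missable e₀ with any? claw?
    ... | yes (v , cl) = cliqueIneq (star v) , claw-InF₀ cl , star-adjacent (missable v) (claw-constant cl) e₀
    ... | no none = no-claw-case missable (λ v cl → none (v , cl)) e₀

  -- Conclusion by cases on the signs of the coefficients.

  -- Without edges the face would have rank 0, yet it contains a point.
  facet⇒edge : ∀ {i} → FacetDefining G i → E
  facet⇒edge {i} (_ , (x , xF) , rk) = go (nE G) rk
    where
    go : ∀ n → AffRank (Face G i) n → Fin n
    go zero (_ , upper) = ⊥-elim (upper (λ _ → x) (λ _ → xF) λ _ _ ())
    go (suc n) _ = zero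

  facet-neighbour : ∀ i → FacetDefining G i → ∃[ h ] InF₀ G h × Adjacent i h
  facet-neighbour i facet with any? (λ e → proj₁ i e ≟ 0ℚ)
  ... | yes (e , z) = nonnegIneq e , nonneg-InF₀ (standardFormulation e) e , zero-coefficient {i} facet e z
  ... | no nz with any? (λ e → proj₁ i e <? 0ℚ)
  ... | yes (e , neg) = let K , inF₀ , adj = negative-coefficient facet (λ j z → nz (j , z)) e neg in cliqueIneq K , inF₀ , adj
  ... | no nneg = by-cover (any? λ v → ¬? (missable? facet coefficients>0 v))
    where
    e₀ : E
    e₀ = facet⇒edge {i} facet
    coefficients>0 : ∀ e → 0ℚ < proj₁ i e
    coefficients>0 e = ≰⇒> λ le → nz (e , ≤-antisym le (≮⇒≥ λ lt → nneg (e , lt)))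
    by-cover : Dec (∃[ v ] ¬ (∃[ M ] Tight i M × Misses M v)) → ∃[ h ] InF₀ G h × Adjacent i h
    by-cover (yes (v , always)) = nonnegIneq e₀ , nonneg-InF₀ (standardFormulation e₀) e₀ ,
      clique-case facet (nonzero facet coefficients>0) (star-clique {v})
        (λ {M} t → let e , p , q = decidable-stable (covers? M v) (λ nc → always (M , t , nc)) in e , ∈-star q , p) e₀
    by-cover (no none) = balanced-case facet coefficients>0 (balanced facet coefficients>0 e₀ missable) missable e₀
      where
      missable : ∀ v → ∃[ M ] Tight i M × Misses M v
      missable v = decidable-stable (missable? facet coefficients>0 v) λ n → none (v , n)

theorem3 : (G : Graph) → GeometricRankAtMost1 G
theorem3 G f facet = inj₂ (facet-neighbour G f facet)
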